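{- Let $\lambda=(a,a)$ be a partition of $n=2a\ge3$. If $\Gamma$ is a (reduced) nb-admissible $\overline{\mathcal S_n}$-graph such that $U(\Gamma)\simeq\overline{\mathcal D}_\lambda$ and there exists an embedding from $\overline\Gamma_\lambda$ to $\Gamma$, then this embedding is an isomorphism.
   Context: **Conventions.** For $k\in\mathbb Z$, $\overline{k}$ is the unique element of $\{1,\dots,n\}$ congruent to $k$ modulo $n$; $[1,n]=\{1,\dots,n\}$. For $a',b'\in[1,n]$, $\langle a',b'\rangle$ is $\emptyset$ if $a'=\overline{b'+1}$, and otherwise the cyclic interval $\{a',\overline{a'+1},\dots,b'\}$. $\overline{\mathcal S_n}$ is the affine symmetric group, a Coxeter group with simple reflections $s_0=s_n,s_1,\dots,s_{n-1}$ (type $\widetilde A_{n-1}$), identified with $[1,n]$ via $s_i\leftrightarrow i$. **Tableaux.** $\mathrm{RSYT}(\lambda)$ is the set of fillings of the Young diagram of $\lambda$ (English convention) by $1,\dots,n$, each used once, with rows increasing; $T^1$ (top row), $T^2$ are the rows of $T$, regarded as sets. Interchanging entries is followed by re-sorting rows. $\overline{\mathrm{des}}(T)=\{i\in[1,n]\mid i\text{ lies in a strictly higher row of }T\text{ than }\overline{i+1}\}$. $T,T'$ are connected by a Knuth move if $\overline{\mathrm{des}}(T),\overline{\mathrm{des}}(T')$ are incomparable under inclusion and $T'$ is obtained from $T$ by interchanging $\overline i$ and $\overline{i+1}$ for some $i$. **Labeled graphs and $W$-graphs.** For a Coxeter group $W$ with simple reflections $I$, an $I$-labeled graph $(V,m,\tau)$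 consists of a set $V$, maps $m:V\times V\to\mathbb Z[q^{\pm1/2}]$ (written $m(u\triangleright v)$) and $\tau:V\to\{\text{subsets of }I\}$, such that for each $v$ only finitely many $w$ have $m(v\triangleright w)\ne0$ or $m(w\triangleright v)\neq0$. It is reduced if $m(u\triangleright v)=0$ whenever $\tau(u)\subset\tau(v)$. It is nb-admissible if all $m(u\triangleright v)\in\mathbb N=\{0,1,2,\dots\}$ and $m(u\triangleright v)=m(v\triangleright u)$ whenever $\tau(u),\tau(v)$ are incomparable. Let $\mathcal H_W$ be the Iwahori–Hecke algebra over $\mathbb Z[q^{\pm1/2}]$ with generators $T_i$ ($i\in I$) satisfying the braid relations and $(T_i-q)(T_i+1)=0$. The graph is a $W$-graph if the formulas $T_i(u)=qu$ if $i\notin\tau(u)$, and $T_i(u)=-u+q^{1/2}\sum_{v:\,i\notin\tau(v)}m(u\triangleright v)\,v$ if $i\in\tau(u)$, define an $\mathcal H_W$-module structure on $\bigoplus_{v\in V}\mathbb Z[q^{\pm1/2}]v$. The simple underlying graph $U(\Gamma)$ has the same $V,\tau$, and weight $m'$ with $m'(u\triangleright v)=m'(v\triangleright u)=1$ if $m(u\triangleright v)=m(v\triangleright u)=1$, and $m'(u\triangleright v)=m'(v\triangleright u)=0$ otherwise. Isomorphisms are bijections of vertices preserving $m$ and $\tau$. A subgraph of $(V',m',\tau')$ is $(V'',m'',\tau'')$ with $V''\subset V'$, $\tau''=\tau'|_{V''}$, $m''(u\triangleright v)\in\{m'(u\triangleright v),0\}$; an embedding $\Gamma\to\Gamma'$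 is an isomorphism of $\Gamma$ onto a subgraph of $\Gamma'$. **The graph $\overline{\mathcal D}_\lambda$.** Vertex set $\mathrm{RSYT}(\lambda)$, $\tau=\overline{\mathrm{des}}$, $m(u\triangleright v)=m(v\triangleright u)=1$ if $u,v$ are connected by a Knuth move, $0$ otherwise. **The graph $\overline\Gamma_\lambda$.** The $[1,n]$-labeled graph $(\mathrm{RSYT}(\lambda),m,\overline{\mathrm{des}})$ with $m\in\{0,1\}$ and $m(s\triangleright t)=1$ iff: (first kind) $t$ is obtained from $s$ by interchanging $\overline i\in s^1$ and $\overline{i+1}\in s^2$; or (second kind) $t$ is obtained from $s$ by interchanging $\overline i\in s^2$ and $\overline j\in s^1$, $\overline i\ne\overline{j+1}$, where $\overline{j-i}$ is odd; $\overline{i+1}\in s^1$ and $\overline{j-1}\in s^2$; $\overline{i-1}\in s^1$ or $\overline{j+1}\in s^2$; $\#(s^2\cap\langle\overline{j-1-2k},\overline{j-2}\rangle)\ge k$ for $k\in\{1,\dots,\frac{\overline{j-i}-3}2\}$; and $\#(s^2\cap\langle\overline{i+2},\overline{j-2}\rangle)=\frac{\overline{j-i}-3}2$ when $\overline j\neq\overline{i+1}$. -}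

module Defs where

open import Data.Bool.Base using (if_then_else_)
import Data.Bool.Properties as Bool
open import Data.Empty using (⊥-elim)
open import Data.Fin.Base using (Fin; toℕ; fromℕ<) renaming (_<_ to _<ᶠ_)
import Data.Fin.Properties as Fin
open import Data.Fin.Permutation.Components using (transpose)
open import Data.Fin.Subset using (Subset; _∈_; _⊆_; _∩_; ∣_∣)
open import Data.Fin.Subset.Properties using (_∈?_; _⊆?_)
open import Data.Integer.Base as ℤ using (ℤ; +_; 0ℤ; 1ℤ; -1ℤ; _%ℕ_)
open import Data.Integer.DivMod using (n%ℕd<d)
import Data.Integer.Properties as ℤ
open import Data.List.Base as List
  using (List; []; _∷_; [_]; _++_; map; filter; concatMap; deduplicate;
         cartesianProduct; cartesianProductWith; allFin)
import Data.List.Membership.DecPropositional as DecMembership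
open import Data.List.Membership.Propositional using () renaming (_∈_ to _∈ˡ_; _∉_ to _∉ˡ_)
open import Data.List.Membership.Propositional.Properties
  using (∈-allFin; ∈-cartesianProduct⁺; ∈-cartesianProductWith⁺; ∈-map⁺; ∈-++⁺ˡ; ∈-++⁺ʳ;
         ∈-concatMap⁺)
open import Data.List.Relation.Unary.All as All using (all?)
open import Data.List.Relation.Unary.Any as Any using (here; there)
open import Data.Nat.Base as ℕ using (ℕ; zero; suc; _+_; _*_; _∸_; _/_; _%_; _≤_)
import Data.Nat.Properties as ℕ
open import Data.Product.Base using (∃; ∃₂; _×_; _,_; proj₁; proj₂)
open import Data.Sum.Base using (_⊎_; inj₁; inj₂)
open import Data.Vec.Base as Vec using (Vec; tabulate; lookup; count)
import Data.Vec.Membership.DecPropositional as DecVecMembership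
import Data.Vec.Properties as Vec
open import Data.Vec.Relation.Unary.Linked using (Linked; linked?)
open import Function.Base using (_∘_)
open import Function.Definitions using (Injective; Bijective)
open import Relation.Binary.Definitions using (DecidableEquality)
open import Relation.Binary.PropositionalEquality using (_≡_; _≢_; refl; sym; trans)
open import Relation.Nullary using (¬_; Dec; yes; no; does; contradiction; contradiction-irr)
open import Relation.Nullary.Decidable using (_×-dec_; _⊎-dec_; ¬?; map′)

------------------------------------------------------------------------
-- Laurent polynomials ℤ[q^{±1/2}]

-- A finite formal sum of monomials; (c , e) stands for c·(q^{1/2})^e.
-- Different lists may denote the same polynomial: the equality is _≈_.
Laurent : Set
Laurent = List (ℤ × ℤ)

coeff : Laurent → ℤ → ℤ
coeff []            k = 0ℤ
coeff ((c , e) ∷ p) k = (if does (e ℤ.≟ k) then c else 0ℤ) ℤ.+ coeff p k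

infix 4 _≈_ _≈?_

_≈_ : Laurent → Laurent → Set
p ≈ r = ∀ k → coeff p k ≡ coeff r k

const : ℤ → Laurent
const c = [ (c , 0ℤ) ]

0ᴸ 1ᴸ q q½ : Laurent
0ᴸ = []
1ᴸ = const 1ℤ
q  = [ (1ℤ , + 2) ]
q½ = [ (1ℤ , + 1) ]

infixl 6 _+ᴸ_
infixl 7 _*ᴸ_

_+ᴸ_ : Laurent → Laurent → Laurent
_+ᴸ_ = _++_

_*ᴸ_ : Laurent → Laurent → Laurent
_*ᴸ_ = cartesianProductWith (λ (c , e) (d , f) → c ℤ.* d , e ℤ.+ f)

coeff-∉ : ∀ p {k} → k ∉ˡ map proj₂ p → coeff p k ≡ 0ℤ
coeff-∉ []            k∉ = refl
coeff-∉ ((c , e) ∷ p) {k} k∉ with e ℤ.≟ k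
... | yes e≡k = contradiction (here (sym e≡k)) k∉
... | no  _   = trans (ℤ.+-identityˡ _) (coeff-∉ p (k∉ ∘ there))

_≈?_ : ∀ p r → Dec (p ≈ r)
p ≈? r = map′ everywhere (λ p≈r → All.tabulate (λ {k} _ → p≈r k))
              (all? (λ k → coeff p k ℤ.≟ coeff r k) exps)
  where
  open DecMembership ℤ._≟_ using () renaming (_∈?_ to _∈ˡ?_)
  exps = map proj₂ p ++ map proj₂ r

  everywhere : All.All (λ k → coeff p k ≡ coeff r k) exps → p ≈ r
  everywhere eqs k with k ∈ˡ? exps
  ... | yes k∈ = All.lookup eqs k∈
  ... | no  k∉ = trans (coeff-∉ p (k∉ ∘ ∈-++⁺ˡ))
                       (sym (coeff-∉ r (k∉ ∘ ∈-++⁺ʳ (map proj₂ p))))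

1≉0 : ¬ (1ᴸ ≈ 0ᴸ)
1≉0 eq with () ← eq 0ℤ

indicator : ∀ {A : Set} → Dec A → Laurent
indicator a? = if does a? then 1ᴸ else 0ᴸ

indicator-≉0 : ∀ {A : Set} (a? : Dec A) → ¬ (indicator a? ≈ 0ᴸ) → A
indicator-≉0 (yes a) _  = a
indicator-≉0 (no _)  ≉0 = ⊥-elim (≉0 (λ _ → refl))

------------------------------------------------------------------------
-- I-labeled graphs, with I = Fin n

-- Local finiteness is given by finite lists `neighbours`, which may contain
-- repetitions and vertices joined by zero weights.
record LabeledGraph (n : ℕ) : Set₁ where
  field
    V          : Set
    _≟ⱽ_       : DecidableEquality V
    m          : V → V → Laurent
    τ          : V → Subset n
    neighbours : V → List V
    locallyFinite : ∀ v w → ¬ (m v w ≈ 0ᴸ) ⊎ ¬ (m w v ≈ 0ᴸ) → w ∈ˡ neighbours v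

open LabeledGraph using (V)

Incomparable : ∀ {n} → Subset n → Subset n → Set
Incomparable A B = ¬ (A ⊆ B) × ¬ (B ⊆ A)

module _ {n} (Γ : LabeledGraph n) where
  open LabeledGraph Γ hiding (V)

  Reduced : Set
  Reduced = ∀ u v → τ u ⊆ τ v → m u v ≈ 0ᴸ

  record NbAdmissible : Set where
    field
      natural   : ∀ u v → ∃ λ (k : ℕ) → m u v ≈ const (+ k)
      symmetric : ∀ u v → Incomparable (τ u) (τ v) → m u v ≈ m v u

module _ {n} (Γ Δ : LabeledGraph n) where
  private
    module Γ = LabeledGraph Γ
    module Δ = LabeledGraph Δ

  record IsIsomorphism (f : Γ.V → Δ.V) : Set where
    field
      bijective   : Bijective _≡_ _≡_ f
      τ-preserved : ∀ v → Δ.τ (f v) ≡ Γ.τ v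
      m-preserved : ∀ u v → Δ.m (f u) (f v) ≈ Γ.m u v

  infix 4 _≃_
  _≃_ : Set
  _≃_ = ∃ IsIsomorphism

  -- f is an isomorphism of Γ onto the subgraph of Δ whose vertex set is the
  -- image of f and whose weights m″ are those carried over from Γ; the last
  -- field is the requirement m″(x ▷ y) ∈ {m(x ▷ y), 0} on a subgraph.
  record IsEmbedding (f : Γ.V → Δ.V) : Set where
    field
      injective   : Injective _≡_ _≡_ f
      τ-preserved : ∀ v → Δ.τ (f v) ≡ Γ.τ v
      m-subgraph  : ∀ u v → (Γ.m u v ≈ Δ.m (f u) (f v)) ⊎ (Γ.m u v ≈ 0ᴸ)

-- The simple underlying graph.
U : ∀ {n} → LabeledGraph n → LabeledGraph n
U Γ = record
  { V = Γ.V
  ; _≟ⱽ_ = Γ._≟ⱽ_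
  ; m = λ u v → indicator (simple? u v)
  ; τ = Γ.τ
  ; neighbours = Γ.neighbours
  ; locallyFinite = λ v w → λ where
      (inj₁ ≉0) → Γ.locallyFinite v w (inj₁
        (nonzero (Γ.m v w) (proj₁ (indicator-≉0 (simple? v w) ≉0))))
      (inj₂ ≉0) → Γ.locallyFinite v w (inj₂
        (nonzero (Γ.m w v) (proj₁ (indicator-≉0 (simple? w v) ≉0))))
  }
  where
  module Γ = LabeledGraph Γ

  simple? : ∀ u v → Dec ((Γ.m u v ≈ 1ᴸ) × (Γ.m v u ≈ 1ᴸ))
  simple? u v = (Γ.m u v ≈? 1ᴸ) ×-dec (Γ.m v u ≈? 1ᴸ)

  nonzero : ∀ p → p ≈ 1ᴸ → ¬ (p ≈ 0ᴸ)
  nonzero p p≈1 p≈0 = 1≉0 (λ k → trans (sym (p≈1 k)) (p≈0 k))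

finiteGraph : ∀ {n} (V : Set) → DecidableEquality V →
              (enum : List V) → (∀ v → v ∈ˡ enum) →
              (V → V → Laurent) → (V → Subset n) → LabeledGraph n
finiteGraph V _≟_ enum complete m τ = record
  { V = V ; _≟ⱽ_ = _≟_ ; m = m ; τ = τ
  ; neighbours = λ _ → enum
  ; locallyFinite = λ _ w _ → complete w
  }

------------------------------------------------------------------------
-- W-graphs

-- The entry 0 encodes ∞, i.e. the absence of a braid relation.
CoxeterMatrix : ℕ → Set
CoxeterMatrix n = Fin n → Fin n → ℕ

module FreeModule {V : Set} (_≟_ : DecidableEquality V) where

  -- ⊕_{v ∈ V} ℤ[q^{±1/2}] v, as formal linear combinations which are equal
  -- when they have the same coordinates.
  Free : Set
  Free = List (Laurent × V)

  coord : Free → V → Laurent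
  coord []            v = 0ᴸ
  coord ((c , u) ∷ x) v = (if does (u ≟ v) then c else 0ᴸ) +ᴸ coord x v

  infix 4 _≋_
  _≋_ : Free → Free → Set
  x ≋ y = ∀ v → coord x v ≈ coord y v

  infixl 6 _⊞_
  infixr 7 _·_

  _⊞_ : Free → Free → Free
  _⊞_ = _++_

  _·_ : Laurent → Free → Free
  c · x = map (λ (d , v) → c *ᴸ d , v) x

  linear : (V → Free) → Free → Free
  linear f = concatMap (λ (c , v) → c · f v)

module _ {n} (Γ : LabeledGraph n) where
  open LabeledGraph Γ hiding (V)
  open FreeModule _≟ⱽ_

  T-basis : Fin n → V Γ → Free
  T-basis i u with i ∈? τ u
  ... | no  _ = [ (q , u) ]
  ... | yes _ = [ (const -1ℤ , u) ] ⊞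
                q½ · map (λ v → m u v , v)
                         (filter (λ v → ¬? (i ∈? τ v)) (deduplicate _≟ⱽ_ (neighbours u)))

  T : Fin n → Free → Free
  T i = linear (T-basis i)

  -- alternating k i j = T_i T_j T_i ⋯ with k factors.
  alternating : ℕ → Fin n → Fin n → Free → Free
  alternating zero    i j x = x
  alternating (suc k) i j x = T i (alternating k j i x)

  -- The Hecke algebra being given by generators and relations, the T i define
  -- a module structure exactly when they satisfy its defining relations.
  record IsWGraph (M : CoxeterMatrix n) : Set where
    field
      -- (T_i - q)(T_i + 1) = 0
      quadratic : ∀ i x → let y = T i x ⊞ x in T i y ⊞ (const -1ℤ *ᴸ q) · y ≋ []
      braid     : ∀ i j x → alternating (M i j) i j x ≋ alternating (M i j) j i x

------------------------------------------------------------------------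
-- Cyclic conventions: i : Fin n stands for the element toℕ i + 1 of [1,n]

infixl 6 _⊕_

-- i ⊕ k is \overline{i + k}; the shift by one between Fin n and [1,n] cancels.
_⊕_ : ∀ {n} → Fin n → ℤ → Fin n
_⊕_ {n} i k = fromℕ< (n%ℕd<d (+ toℕ i ℤ.+ k) n)
  where instance _ = Fin.nonZeroIndex i

infixl 6 _⊖_

-- j ⊖ i is \overline{j - i} as a number; it is n, not 0, when i = j.
_⊖_ : ∀ {n} → Fin n → Fin n → ℕ
_⊖_ {n} j i = suc ((+ toℕ j ℤ.- + toℕ i ℤ.- 1ℤ) %ℕ n)
  where instance _ = Fin.nonZeroIndex i

-- In the nonempty case, x ⊖ (a ⊕ -1ℤ) is the position of x, counted from 1,
-- in the sequence a, a+1, a+2, ….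
⟨_,_⟩ : ∀ {n} → Fin n → Fin n → Subset n
⟨ a , b ⟩ = tabulate λ x →
  does (¬? (a Fin.≟ b ⊕ 1ℤ) ×-dec (x ⊖ (a ⊕ -1ℤ) ℕ.≤? b ⊖ (a ⊕ -1ℤ)))

-- Type Ã_{n-1}, for n ≥ 3.
affineSymmetric : ∀ n → CoxeterMatrix n
affineSymmetric n i j =
  if does (i Fin.≟ j) then 1
  else if does ((j Fin.≟ i ⊕ 1ℤ) ⊎-dec (i Fin.≟ j ⊕ 1ℤ)) then 3
  else 2

------------------------------------------------------------------------
-- Row-standard tableaux of the two-row shape (a , b), with n = a + b

module _ {a b : ℕ} where

  RowsIncreasing : Vec (Fin (a + b)) a → Vec (Fin (a + b)) b → Set
  RowsIncreasing r₁ r₂ = Linked _<ᶠ_ r₁ × Linked _<ᶠ_ r₂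

  EachOnce : Vec (Fin (a + b)) a → Vec (Fin (a + b)) b → Set
  EachOnce r₁ r₂ = ∀ k → count (k Fin.≟_) (r₁ Vec.++ r₂) ≡ 1

  rowStandard? : ∀ r₁ r₂ → Dec (RowsIncreasing r₁ r₂ × EachOnce r₁ r₂)
  rowStandard? r₁ r₂ =
    (linked? Fin._<?_ r₁ ×-dec linked? Fin._<?_ r₂) ×-dec
    Fin.all? (λ k → count (k Fin.≟_) (r₁ Vec.++ r₂) ℕ.≟ 1)

-- The proof is irrelevant, so that tableaux with equal rows are equal.
record RSYT (a b : ℕ) : Set where
  constructor tableau
  field
    row₁ : Vec (Fin (a + b)) a
    row₂ : Vec (Fin (a + b)) b
    .rowStandard : RowsIncreasing row₁ row₂ × EachOnce row₁ row₂

open RSYT using (row₁; row₂)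

entries : ∀ {n k} → Vec (Fin n) k → Subset n
entries r = tabulate λ x → does (x ∈ᵛ? r)
  where open DecVecMembership Fin._≟_ using () renaming (_∈?_ to _∈ᵛ?_)

module _ {a b : ℕ} where

  infix 8 _¹ _²

  _¹ _² : RSYT a b → Subset (a + b)
  s ¹ = entries (row₁ s)
  s ² = entries (row₂ s)

  -- Rows are increasing, so t is determined by its rows as sets.
  Interchange : Fin (a + b) → Fin (a + b) → RSYT a b → RSYT a b → Set
  Interchange x y s t =
    ∀ z → lookup (t ¹) z ≡ lookup (s ¹) (transpose x y z)
        × lookup (t ²) z ≡ lookup (s ²) (transpose x y z)

  des : RSYT a b → Subset (a + b)
  des s = tabulate λ i → does (i ∈? s ¹ ×-dec (i ⊕ 1ℤ) ∈? s ²)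

  KnuthMove : RSYT a b → RSYT a b → Set
  KnuthMove s t = Incomparable (des s) (des t) × ∃ λ i → Interchange i (i ⊕ 1ℤ) s t

  FirstKind : RSYT a b → RSYT a b → Set
  FirstKind s t = ∃ λ i → i ∈ s ¹ × (i ⊕ 1ℤ) ∈ s ² × Interchange i (i ⊕ 1ℤ) s t

  -- When \overline{j - i} = 1 truncated subtraction gives (j ⊖ i ∸ 3) / 2 = 0,
  -- so that no k is considered; this agrees with the range {1, …, -1}.
  record SecondKindAt (i j : Fin (a + b)) (s t : RSYT a b) : Set where
    half : ℕ
    half = (j ⊖ i ∸ 3) / 2
    field
      i∈s²        : i ∈ s ²
      j∈s¹        : j ∈ s ¹
      interchange : Interchange i j s t
      i≢j+1       : i ≢ j ⊕ 1ℤ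
      odd         : (j ⊖ i) % 2 ≡ 1
      i+1∈s¹      : (i ⊕ 1ℤ) ∈ s ¹
      j-1∈s²      : (j ⊕ -1ℤ) ∈ s ²
      outer       : (i ⊕ -1ℤ) ∈ s ¹ ⊎ (j ⊕ 1ℤ) ∈ s ²
      -- k = toℕ k′ + 1 runs over 1, …, half
      dominance   : ∀ (k′ : Fin half) → let k = suc (toℕ k′) in
                    k ≤ ∣ s ² ∩ ⟨ j ⊕ (-1ℤ ℤ.- + (2 * k)) , j ⊕ (ℤ.- + 2) ⟩ ∣
      balance     : j ≢ i ⊕ 1ℤ →
                    ∣ s ² ∩ ⟨ i ⊕ + 2 , j ⊕ (ℤ.- + 2) ⟩ ∣ ≡ half

  SecondKind : RSYT a b → RSYT a b → Set
  SecondKind s t = ∃₂ λ i j → SecondKindAt i j s t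

  interchange? : ∀ x y s t → Dec (Interchange x y s t)
  interchange? x y s t = Fin.all? λ z →
    (lookup (t ¹) z Bool.≟ lookup (s ¹) (transpose x y z)) ×-dec
    (lookup (t ²) z Bool.≟ lookup (s ²) (transpose x y z))

  knuthMove? : ∀ s t → Dec (KnuthMove s t)
  knuthMove? s t =
    (¬? (des s ⊆? des t) ×-dec ¬? (des t ⊆? des s)) ×-dec
    Fin.any? (λ i → interchange? i (i ⊕ 1ℤ) s t)

  firstKind? : ∀ s t → Dec (FirstKind s t)
  firstKind? s t = Fin.any? λ i →
    i ∈? s ¹ ×-dec (i ⊕ 1ℤ) ∈? s ² ×-dec interchange? i (i ⊕ 1ℤ) s t

  secondKindAt? : ∀ i j s t → Dec (SecondKindAt i j s t)
  secondKindAt? i j s t = map′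
    (λ (p₁ , p₂ , p₃ , p₄ , p₅ , p₆ , p₇ , p₈ , p₉ , p₁₀) → record
      { i∈s² = p₁ ; j∈s¹ = p₂ ; interchange = p₃ ; i≢j+1 = p₄ ; odd = p₅
      ; i+1∈s¹ = p₆ ; j-1∈s² = p₇ ; outer = p₈ ; dominance = p₉ ; balance = p₁₀ })
    (λ r → let open SecondKindAt r in
      i∈s² , j∈s¹ , interchange , i≢j+1 , odd , i+1∈s¹ , j-1∈s² , outer , dominance , balance)
    ( i ∈? s ² ×-dec j ∈? s ¹ ×-dec interchange? i j s t
      ×-dec ¬? (i Fin.≟ j ⊕ 1ℤ)
      ×-dec ((j ⊖ i) % 2 ℕ.≟ 1)
      ×-dec (i ⊕ 1ℤ) ∈? s ¹ ×-dec (j ⊕ -1ℤ) ∈? s ²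
      ×-dec ((i ⊕ -1ℤ) ∈? s ¹ ⊎-dec (j ⊕ 1ℤ) ∈? s ²)
      ×-dec Fin.all? (λ k′ → _ ℕ.≤? _)
      ×-dec balance? )
    where
    balance? : Dec (j ≢ i ⊕ 1ℤ → ∣ s ² ∩ ⟨ i ⊕ + 2 , j ⊕ (ℤ.- + 2) ⟩ ∣ ≡ (j ⊖ i ∸ 3) / 2)
    balance? with j Fin.≟ i ⊕ 1ℤ | ∣ s ² ∩ ⟨ i ⊕ + 2 , j ⊕ (ℤ.- + 2) ⟩ ∣ ℕ.≟ (j ⊖ i ∸ 3) / 2
    ... | yes j≡ | _       = yes (λ j≢ → contradiction j≡ j≢)
    ... | no  j≢ | yes eq  = yes (λ _ → eq)
    ... | no  j≢ | no  neq = no (λ f → neq (f j≢))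

  secondKind? : ∀ s t → Dec (SecondKind s t)
  secondKind? s t = Fin.any? λ i → Fin.any? λ j → secondKindAt? i j s t

  _≟ᵀ_ : DecidableEquality (RSYT a b)
  tableau r₁ r₂ _ ≟ᵀ tableau r₁′ r₂′ _ =
    map′ (λ { (refl , refl) → refl }) (λ { refl → refl , refl })
         (Vec.≡-dec Fin._≟_ r₁ r₁′ ×-dec Vec.≡-dec Fin._≟_ r₂ r₂′)

allVecs : ∀ n k → List (Vec (Fin n) k)
allVecs n zero    = [ Vec.[] ]
allVecs n (suc k) = cartesianProductWith Vec._∷_ (allFin n) (allVecs n k)

∈-allVecs : ∀ {n k} (v : Vec (Fin n) k) → v ∈ˡ allVecs n k
∈-allVecs Vec.[]        = here refl
∈-allVecs (x Vec.∷ v) = ∈-cartesianProductWith⁺ Vec._∷_ (∈-allFin x) (∈-allVecs v)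

module _ (a b : ℕ) where

  private
    fromRows : Vec (Fin (a + b)) a × Vec (Fin (a + b)) b → List (RSYT a b)
    fromRows (r₁ , r₂) with rowStandard? r₁ r₂
    ... | yes p = [ tableau r₁ r₂ p ]
    ... | no  _ = []

    ∈-fromRows : ∀ r₁ r₂ .p → tableau r₁ r₂ p ∈ˡ fromRows (r₁ , r₂)
    ∈-fromRows r₁ r₂ p with rowStandard? r₁ r₂
    ... | yes _ = here refl
    ... | no ¬p = contradiction-irr p ¬p

  allRSYT : List (RSYT a b)
  allRSYT = concatMap fromRows (cartesianProduct (allVecs (a + b) a) (allVecs (a + b) b))

  ∈-allRSYT : ∀ s → s ∈ˡ allRSYT
  ∈-allRSYT (tableau r₁ r₂ p) =
    ∈-concatMap⁺ fromRows
      (Any.map (λ { refl → ∈-fromRows r₁ r₂ p })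
               (∈-cartesianProduct⁺ (∈-allVecs r₁) (∈-allVecs r₂)))

  -- \overline{𝒟}_λ and \overline{Γ}_λ for λ = (a , b).
  D̄ Γ̄ : LabeledGraph (a + b)
  D̄ = finiteGraph (RSYT a b) _≟ᵀ_ allRSYT ∈-allRSYT
        (λ s t → indicator (knuthMove? s t)) des
  Γ̄ = finiteGraph (RSYT a b) _≟ᵀ_ allRSYT ∈-allRSYT
        (λ s t → indicator (firstKind? s t ⊎-dec secondKind? s t)) des

{-# OPTIONS --safe #-}

-- At q^{1/2} = 1 the operators T i act on functionals g : V → ℤ, and positivity of the weights
-- turns the braid relations, applied to coordinate functionals, into three combinatorial rules:
-- * compatibility: an arc u ▷ v with i ∈ τ(u) ∖ τ(v) has j ∈ τ(v) ⇒ j ∈ τ(u) if i, j commute;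
-- * polygons: for commuting i, j a path u ▷ v ▷ w through a v with j ∈ τ(v), i ∉ τ(v) gives one
--   through a y with i ∈ τ(y);
-- * bonds: if i, j are adjacent and v has j but not i, at most one arc x ▷ v starts at an x with i
--   but not j.
--
-- A tableau is a cyclic word in + (first row) and − (second row), with a descent at each +−.
-- For a vertex v without descent i, at most one arc into v starts at a vertex with descent i:
-- by the three rules this property is unchanged when a pair +− of v is moved past a letter away
-- from the positions i, i + 1.  Such moves bring v to a word with a descent next to i, where the
-- bond rule applies, or to −+ followed by pairs +−, where by compatibility the source of the arc
-- has descents i, i + 2, i + 4, … and is thus determined.  Since \overline{Γ}_λ already has such
-- an arc for every v and i (of the first kind if v reads −+ at i, and otherwise of the second
-- kind, obtained by matching parentheses), Γ has no others.
module Submission where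

open import Defs
open import Data.Nat.Base using (ℕ; _+_; _≥_)
open import Data.Nat.Base as ℕ using (zero; suc; _*_; _∸_; _≤_; _<_; _<ᵇ_; _/_; _%_; NonZero)
open import Data.Nat.DivMod using (m*n/n≡m; [m+kn]%n≡m%n)
import Data.Nat.Properties as ℕ
import Data.Nat.Tactic.RingSolver as ℕ
open import Algebra.Properties.CommutativeMonoid.Sum ℕ.+-0-commutativeMonoid
  using (sum; sum-cong-≗; ∑-distrib-+; sum-permute; sum-replicate-zero)
open import Data.Bool.Base using (Bool; true; false; not; if_then_else_; _∧_; _∨_)
import Data.Bool.Properties as Bool
open import Data.Empty using (⊥)
open import Data.Fin.Base using (Fin; zero; suc; toℕ; fromℕ<) renaming (_<_ to _<ᶠ_)
open import Data.Fin.Permutation as Permutation using (Permutation; permutation)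
open import Data.Fin.Permutation.Components using (transpose; transpose-inverse)
import Data.Fin.Properties as Fin
open import Data.Fin.Subset using (Subset; inside; outside; _∈_; _∉_; _⊆_; _∩_; ∁; ∣_∣)
open import Data.Fin.Subset.Properties using (_∈?_; _⊆?_; ∣∁p∣≡n∸∣p∣)
open import Data.Integer.Base as ℤ using (ℤ; +_; 0ℤ; 1ℤ; -1ℤ; _%ℕ_; _/ℕ_)
open import Data.Integer.DivMod using (n%ℕd<d; a≡a%ℕn+[a/ℕn]*n)
import Data.Integer.Properties as ℤ
import Data.Integer.Tactic.RingSolver as ℤ
open import Data.List.Base as List
  using (List; []; _∷_; _++_; map; filter; deduplicate; length; replicate)
open import Data.List.Membership.Propositional using () renaming (_∈_ to _∈ˡ_)
open import Data.List.Membership.Propositional.Properties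
  using (∈-++⁺ˡ; ∈-++⁺ʳ; ∈-filter⁺; ∈-filter⁻; ∈-deduplicate⁺)
import Data.List.Properties as List
open import Data.List.Relation.Unary.All as All using ([]; _∷_)
open import Data.List.Relation.Unary.AllPairs using ([]; _∷_)
open import Data.List.Relation.Unary.Any as Any using (here; there)
import Data.List.Relation.Unary.Any.Properties as Any
import Data.List.Relation.Unary.Unique.DecPropositional.Properties as UniqueDec
open import Data.List.Relation.Unary.Unique.Propositional using (Unique)
import Data.List.Relation.Unary.Unique.Propositional.Properties as Unique
open import Data.Product.Base using (∃; ∃₂; _×_; _,_; proj₁; proj₂; map₂)
open import Data.Sum.Base using (_⊎_; inj₁; inj₂)
open import Data.Vec.Base as Vec using (Vec; []; _∷_; tabulate; lookup; count)
import Data.Vec.Membership.DecPropositional as DecVecMembership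
open import Data.Vec.Membership.Propositional using () renaming (_∈_ to _∈ᵛ_; _∉_ to _∉ᵛ_)
import Data.Vec.Properties as Vec
import Data.Vec.Relation.Unary.All as Allᵛ
open import Data.Vec.Relation.Unary.Any using (here; there)
open import Data.Vec.Relation.Unary.Linked as Linked using (Linked; []; [-]; _∷_)
import Data.Vec.Relation.Unary.Linked.Properties as Linked
open import Function.Base using (_∘_; id)
open import Function.Definitions using (Injective)
open import Relation.Binary.Construct.Closure.ReflexiveTransitive
  using (Star; _◅_; _◅◅_; gmap) renaming (ε to stop)
open import Relation.Binary.Definitions using (DecidableEquality)
open import Relation.Binary.PropositionalEquality
open import Relation.Nullary using (¬_; Dec; yes; no; does; contradiction)
open import Relation.Nullary.Decidable
  using (¬?; dec-true; dec-false; decidable-stable; recompute; _×-dec_; _⊎-dec_)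

open RSYT using (row₁; row₂)

-- Setting q^{1/2} = 1 loses nothing here: by nb-admissibility every weight is a constant natural
-- number, so it vanishes as soon as its value does. Functionals are preferred to vectors because
-- `T i`, transposed and applied to a coordinate functional, reads off the arcs entering a vertex,
-- and sources of arcs are what has to be unique. The obstacle is that the bond rule determines the
-- source only if `v` has a descent next to i. Carrying uniqueness from another word back to `v`
-- needs an arc from `v` to that word which is known to lie in Γ. The embedding supplies it: an
-- admissible move of a pair is a Knuth move, which gives an arc of the first kind one way and an
-- arc of the second kind the other way. The isomorphism of U(Γ) bounds the vertices of Γ by the
-- finite set of tableaux, so every vertex met in a polygon is a word. Equal row lengths enter
-- twice: they guarantee that the parenthesis needed for an arc has a partner, and they exclude the
-- normal forms that neither the bond rule nor compatibility would settle.

private variable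
  A B : Set

-- Finite sums of integers over lists

∑ : (A → ℤ) → List A → ℤ
∑ f []       = 0ℤ
∑ f (x ∷ xs) = f x ℤ.+ ∑ f xs

∑-cong : {f g : A → ℤ} → (∀ x → f x ≡ g x) → ∀ xs → ∑ f xs ≡ ∑ g xs
∑-cong f≗g []       = refl
∑-cong f≗g (x ∷ xs) = cong₂ ℤ._+_ (f≗g x) (∑-cong f≗g xs)

+-congˡ : ∀ x {y z} → y ≡ z → x ℤ.+ y ≡ x ℤ.+ z
+-congˡ x = cong (λ z → x ℤ.+ z)

∑-++ : ∀ (f : A → ℤ) xs ys → ∑ f (xs ++ ys) ≡ ∑ f xs ℤ.+ ∑ f ys
∑-++ f []       ys = sym (ℤ.+-identityˡ _)
∑-++ f (x ∷ xs) ys = trans (+-congˡ (f x) (∑-++ f xs ys)) (sym (ℤ.+-assoc (f x) (∑ f xs) (∑ f ys)))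

∑-map : ∀ (f : B → ℤ) (g : A → B) xs → ∑ f (map g xs) ≡ ∑ (f ∘ g) xs
∑-map f g []       = refl
∑-map f g (x ∷ xs) = +-congˡ (f (g x)) (∑-map f g xs)

interchange-+ : ∀ w x y z → (w ℤ.+ x) ℤ.+ (y ℤ.+ z) ≡ (w ℤ.+ y) ℤ.+ (x ℤ.+ z)
interchange-+ = ℤ.solve-∀

∑-+ : ∀ (f g : A → ℤ) xs → ∑ (λ x → f x ℤ.+ g x) xs ≡ ∑ f xs ℤ.+ ∑ g xs
∑-+ f g []       = refl
∑-+ f g (x ∷ xs) = trans (+-congˡ (f x ℤ.+ g x) (∑-+ f g xs)) (interchange-+ (f x) (g x) (∑ f xs) (∑ g xs))

∑-*ˡ : ∀ c (f : A → ℤ) xs → ∑ (λ x → c ℤ.* f x) xs ≡ c ℤ.* ∑ f xs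
∑-*ˡ c f []       = sym (ℤ.*-zeroʳ c)
∑-*ˡ c f (x ∷ xs) = trans (+-congˡ (c ℤ.* f x) (∑-*ˡ c f xs)) (sym (ℤ.*-distribˡ-+ c (f x) (∑ f xs)))

∑-zero : {f : A → ℤ} → ∀ xs → (∀ {x} → x ∈ˡ xs → f x ≡ 0ℤ) → ∑ f xs ≡ 0ℤ
∑-zero []       f≡0 = refl
∑-zero (x ∷ xs) f≡0 = cong₂ ℤ._+_ (f≡0 (here refl)) (∑-zero xs (f≡0 ∘ there))

∑-≢0 : (f : A → ℤ) → ∀ xs → ∑ f xs ≢ 0ℤ → ∃ λ x → x ∈ˡ xs × f x ≢ 0ℤ
∑-≢0 f []       ≢0 = contradiction refl ≢0
∑-≢0 f (x ∷ xs) ≢0 with f x ℤ.≟ 0ℤ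
... | no fx≢0  = x , here refl , fx≢0
... | yes fx≡0 with ∑-≢0 f xs (λ eq → ≢0 (cong₂ ℤ._+_ fx≡0 eq))
...   | y , y∈ , fy≢0 = y , there y∈ , fy≢0

module _ (f : A → ℤ) (f≥0 : ∀ x → 0ℤ ℤ.≤ f x) where

  ∑-≥0 : ∀ xs → 0ℤ ℤ.≤ ∑ f xs
  ∑-≥0 []       = ℤ.≤-refl
  ∑-≥0 (x ∷ xs) = ℤ.+-mono-≤ (f≥0 x) (∑-≥0 xs)

  ∑-≥-term : ∀ {x xs} → x ∈ˡ xs → f x ℤ.≤ ∑ f xs
  ∑-≥-term {x} {_ ∷ xs} (here refl) =
    subst (λ z → z ℤ.≤ f x ℤ.+ ∑ f xs) (ℤ.+-identityʳ (f x)) (ℤ.+-monoʳ-≤ (f x) (∑-≥0 xs))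
  ∑-≥-term {x} {y ∷ xs} (there x∈)  =
    subst (λ z → z ℤ.≤ f y ℤ.+ ∑ f xs) (ℤ.+-identityˡ (f x)) (ℤ.+-mono-≤ (f≥0 y) (∑-≥-term x∈))

  ∑-≥-terms : ∀ {x y xs} → x ≢ y → x ∈ˡ xs → y ∈ˡ xs → f x ℤ.+ f y ℤ.≤ ∑ f xs
  ∑-≥-terms x≢y (here refl) (here refl) = contradiction refl x≢y
  ∑-≥-terms {x} x≢y (here refl) (there y∈)  = ℤ.+-monoʳ-≤ (f x) (∑-≥-term y∈)
  ∑-≥-terms {x} {y} {_ ∷ xs} x≢y (there x∈) (here refl) =
    subst (λ t → t ℤ.≤ f y ℤ.+ ∑ f xs) (ℤ.+-comm (f y) (f x)) (ℤ.+-monoʳ-≤ (f y) (∑-≥-term x∈))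
  ∑-≥-terms {x} {y} {z ∷ xs} x≢y (there x∈) (there y∈) =
    subst (λ t → t ℤ.≤ f z ℤ.+ ∑ f xs) (ℤ.+-identityˡ (f x ℤ.+ f y))
      (ℤ.+-mono-≤ (f≥0 z) (∑-≥-terms x≢y x∈ y∈))

module _ (_≟_ : DecidableEquality A) where

  δ : A → A → ℤ
  δ w x = if does (x ≟ w) then 1ℤ else 0ℤ

  δ-refl : ∀ w → δ w w ≡ 1ℤ
  δ-refl w rewrite dec-true (w ≟ w) refl = refl

  δ-≢ : ∀ {w x} → x ≢ w → δ w x ≡ 0ℤ
  δ-≢ {w} {x} x≢w rewrite dec-false (x ≟ w) x≢w = refl

  -- Membership of `w` is demanded only where `f w` is nonzero, because local finiteness guarantees
  -- that a vertex is listed only if it is joined by a nonzero weight.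
  ∑-δ : ∀ (f : A → ℤ) {w xs} → Unique xs → (f w ≢ 0ℤ → w ∈ˡ xs) →
        ∑ (λ x → f x ℤ.* δ w x) xs ≡ f w
  ∑-δ f {w} {[]} _ w∈ with f w ℤ.≟ 0ℤ
  ... | yes fw≡0 = sym fw≡0
  ... | no  fw≢0 with () ← w∈ fw≢0
  ∑-δ f {w} {x ∷ xs} (x∉ ∷ xs!) w∈ with x ≟ w
  ... | yes refl = trans
    (cong₂ ℤ._+_ (ℤ.*-identityʳ (f w))
      (∑-zero xs λ {y} y∈ → trans (cong (f y ℤ.*_) (δ-≢ (≢-sym (All.lookup x∉ y∈)))) (ℤ.*-zeroʳ (f y))))
    (ℤ.+-identityʳ (f w))
  ... | no x≢w = trans
    (cong₂ ℤ._+_ (ℤ.*-zeroʳ (f x)) (∑-δ f xs! (tail∈ ∘ w∈)))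
    (ℤ.+-identityˡ (f w))
    where
    tail∈ : w ∈ˡ x ∷ xs → w ∈ˡ xs
    tail∈ (here w≡x) = contradiction (sym w≡x) x≢w
    tail∈ (there w∈) = w∈

-- Specialisation at q^{1/2} = 1

ε : Laurent → ℤ
ε = ∑ proj₁

-- Equal polynomials may be different lists of monomials, so `ε` has to be expressed through the
-- coefficients. Grouping the monomials by exponent over one list `ks` allows two equal polynomials
-- to share that list.
ε-coeff : ∀ {ks} → Unique ks → ∀ p → (∀ {k} → k ∈ˡ map proj₂ p → k ∈ˡ ks) →
          ε p ≡ ∑ (coeff p) ks
ε-coeff {ks} ks! []            ⊆ks = sym (∑-zero ks (λ _ → refl))
ε-coeff {ks} ks! ((c , e) ∷ p) ⊆ks = begin
  c ℤ.+ ε p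
    ≡⟨ cong₂ ℤ._+_ (sym (∑-δ ℤ._≟_ (λ _ → c) ks! (λ _ → ⊆ks (here refl))))
                   (ε-coeff ks! p (⊆ks ∘ there)) ⟩
  ∑ (λ k → c ℤ.* δ ℤ._≟_ e k) ks ℤ.+ ∑ (coeff p) ks
    ≡⟨ sym (∑-+ _ (coeff p) ks) ⟩
  ∑ (λ k → c ℤ.* δ ℤ._≟_ e k ℤ.+ coeff p k) ks
    ≡⟨ ∑-cong (λ k → cong (ℤ._+ coeff p k) (*-δ k)) ks ⟩
  ∑ (coeff ((c , e) ∷ p)) ks ∎
  where
  open ≡-Reasoning
  *-δ : ∀ k → c ℤ.* δ ℤ._≟_ e k ≡ (if does (e ℤ.≟ k) then c else 0ℤ)
  *-δ k with e ℤ.≟ k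
  ... | yes refl = trans (cong (c ℤ.*_) (δ-refl ℤ._≟_ e)) (ℤ.*-identityʳ c)
  ... | no  e≢k  = trans (cong (c ℤ.*_) (δ-≢ ℤ._≟_ (≢-sym e≢k))) (ℤ.*-zeroʳ c)

ε-cong : ∀ p r → p ≈ r → ε p ≡ ε r
ε-cong p r p≈r = begin
  ε p            ≡⟨ ε-coeff ks! p (λ k∈ → ∈-deduplicate⁺ ℤ._≟_ (∈-++⁺ˡ k∈)) ⟩
  ∑ (coeff p) ks ≡⟨ ∑-cong p≈r ks ⟩
  ∑ (coeff r) ks ≡⟨ sym (ε-coeff ks! r (λ k∈ → ∈-deduplicate⁺ ℤ._≟_ (∈-++⁺ʳ (map proj₂ p) k∈))) ⟩
  ε r ∎
  where
  open ≡-Reasoning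
  ks = deduplicate ℤ._≟_ (map proj₂ p ++ map proj₂ r)
  ks! = UniqueDec.deduplicate-! ℤ._≟_ (map proj₂ p ++ map proj₂ r)

ε-* : ∀ p r → ε (p *ᴸ r) ≡ ε p ℤ.* ε r
ε-* []            r = sym (ℤ.*-zeroˡ (ε r))
ε-* ((c , e) ∷ p) r = begin
  ε (map (λ (d , f) → c ℤ.* d , e ℤ.+ f) r ++ p *ᴸ r)
    ≡⟨ ∑-++ proj₁ (map (λ (d , f) → c ℤ.* d , e ℤ.+ f) r) (p *ᴸ r) ⟩
  ε (map (λ (d , f) → c ℤ.* d , e ℤ.+ f) r) ℤ.+ ε (p *ᴸ r)
    ≡⟨ cong₂ ℤ._+_ (trans (∑-map proj₁ _ r) (∑-*ˡ c proj₁ r)) (ε-* p r) ⟩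
  c ℤ.* ε r ℤ.+ ε p ℤ.* ε r
    ≡⟨ sym (ℤ.*-distribʳ-+ (ε r) c (ε p)) ⟩
  (c ℤ.+ ε p) ℤ.* ε r ∎
  where open ≡-Reasoning

-- The specialised action on linear functionals

module Dual {n} (Γ : LabeledGraph n) where
  open LabeledGraph Γ public
  open FreeModule _≟ⱽ_

  N : V → V → ℤ
  N u v = ε (m u v)

  ⟪_,_⟫ : Free → (V → ℤ) → ℤ
  ⟪ x , g ⟫ = ∑ (λ (c , u) → ε c ℤ.* g u) x

  targets : Fin n → V → List V
  targets i u = filter (λ v → ¬? (i ∈? τ v)) (deduplicate _≟ⱽ_ (neighbours u))

  targets-unique : ∀ i u → Unique (targets i u)
  targets-unique i u =
    Unique.filter⁺ (λ v → ¬? (i ∈? τ v)) (UniqueDec.deduplicate-! _≟ⱽ_ (neighbours u))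

  ∈-targets : ∀ {i u v} → i ∉ τ v → N u v ≢ 0ℤ → v ∈ˡ targets i u
  ∈-targets {i} {u} {v} i∉ N≢0 = ∈-filter⁺ (λ v → ¬? (i ∈? τ v))
    (∈-deduplicate⁺ _≟ⱽ_ (locallyFinite u v (inj₁ (N≢0 ∘ ε-cong (m u v) 0ᴸ)))) i∉

  targets⇒∉ : ∀ {i u v} → v ∈ˡ targets i u → i ∉ τ v
  targets⇒∉ {i} {u} v∈ =
    proj₂ (∈-filter⁻ (λ v → ¬? (i ∈? τ v)) {xs = deduplicate _≟ⱽ_ (neighbours u)} v∈)

  -- The transpose of `T i` at q^{1/2} = 1. Transposition reverses products: the leftmost factor of
  -- a word in the `T i` acts first on a functional.
  T* : Fin n → (V → ℤ) → V → ℤ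
  T* i g u with i ∈? τ u
  ... | no  _ = g u
  ... | yes _ = ℤ.- g u ℤ.+ ∑ (λ x → N u x ℤ.* g x) (targets i u)

  T*-∉ : ∀ {i g u} → i ∉ τ u → T* i g u ≡ g u
  T*-∉ {i} {g} {u} i∉ with i ∈? τ u
  ... | no  _  = refl
  ... | yes i∈ = contradiction i∈ i∉

  T*-∈ : ∀ {i g u} → i ∈ τ u →
         T* i g u ≡ ℤ.- g u ℤ.+ ∑ (λ x → N u x ℤ.* g x) (targets i u)
  T*-∈ {i} {g} {u} i∈ with i ∈? τ u
  ... | no  i∉ = contradiction i∈ i∉
  ... | yes _  = refl

  T*-cong : ∀ i {g h} → (∀ u → g u ≡ h u) → ∀ u → T* i g u ≡ T* i h u
  T*-cong i g≗h u with i ∈? τ u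
  ... | no  _ = g≗h u
  ... | yes _ = cong₂ ℤ._+_ (cong ℤ.-_ (g≗h u))
                            (∑-cong (λ x → cong (N u x ℤ.*_) (g≗h x)) (targets i u))

  T*-neg : ∀ i g u → T* i (ℤ.-_ ∘ g) u ≡ ℤ.- T* i g u
  T*-neg i g u with i ∈? τ u
  ... | no  _ = refl
  ... | yes _ = begin
    ℤ.- ℤ.- g u ℤ.+ ∑ (λ x → N u x ℤ.* ℤ.- g x) xs
      ≡⟨ +-congˡ (ℤ.- ℤ.- g u) (∑-cong (λ x → *-neg (N u x) (g x)) xs) ⟩
    ℤ.- ℤ.- g u ℤ.+ ∑ (λ x → -1ℤ ℤ.* (N u x ℤ.* g x)) xs
      ≡⟨ +-congˡ (ℤ.- ℤ.- g u) (∑-*ˡ -1ℤ (λ x → N u x ℤ.* g x) xs) ⟩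
    ℤ.- ℤ.- g u ℤ.+ -1ℤ ℤ.* ∑ (λ x → N u x ℤ.* g x) xs
      ≡⟨ neg-+ (ℤ.- g u) (∑ (λ x → N u x ℤ.* g x) xs) ⟩
    ℤ.- (ℤ.- g u ℤ.+ ∑ (λ x → N u x ℤ.* g x) xs) ∎
    where
    open ≡-Reasoning
    xs = targets i u
    *-neg : ∀ a b → a ℤ.* ℤ.- b ≡ -1ℤ ℤ.* (a ℤ.* b)
    *-neg = ℤ.solve-∀
    neg-+ : ∀ a b → ℤ.- a ℤ.+ -1ℤ ℤ.* b ≡ ℤ.- (a ℤ.+ b)
    neg-+ = ℤ.solve-∀

  ⟪⟫-++ : ∀ x y g → ⟪ x ++ y , g ⟫ ≡ ⟪ x , g ⟫ ℤ.+ ⟪ y , g ⟫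
  ⟪⟫-++ x y g = ∑-++ _ x y

  ⟪⟫-· : ∀ c x g → ⟪ c · x , g ⟫ ≡ ε c ℤ.* ⟪ x , g ⟫
  ⟪⟫-· c x g = begin
    ⟪ c · x , g ⟫
      ≡⟨ ∑-map _ _ x ⟩
    ∑ (λ (d , v) → ε (c *ᴸ d) ℤ.* g v) x
      ≡⟨ ∑-cong (λ (d , v) → trans (cong (ℤ._* g v) (ε-* c d)) (ℤ.*-assoc (ε c) (ε d) (g v))) x ⟩
    ∑ (λ (d , v) → ε c ℤ.* (ε d ℤ.* g v)) x
      ≡⟨ ∑-*ˡ (ε c) _ x ⟩
    ε c ℤ.* ⟪ x , g ⟫ ∎
    where open ≡-Reasoning

  ⟪⟫-linear : ∀ f x g → ⟪ linear f x , g ⟫ ≡ ⟪ x , (λ u → ⟪ f u , g ⟫) ⟫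
  ⟪⟫-linear f []            g = refl
  ⟪⟫-linear f ((c , u) ∷ x) g =
    trans (⟪⟫-++ (c · f u) (linear f x) g) (cong₂ ℤ._+_ (⟪⟫-· c (f u) g) (⟪⟫-linear f x g))

  ⟪⟫-δ : ∀ x w → ε (coord x w) ≡ ⟪ x , δ _≟ⱽ_ w ⟫
  ⟪⟫-δ []            w = refl
  ⟪⟫-δ ((c , u) ∷ x) w =
    trans (∑-++ proj₁ (if does (u ≟ⱽ w) then c else 0ᴸ) (coord x w)) (cong₂ ℤ._+_ head (⟪⟫-δ x w))
    where
    head : ε (if does (u ≟ⱽ w) then c else 0ᴸ) ≡ ε c ℤ.* δ _≟ⱽ_ w u
    head with u ≟ⱽ w
    ... | yes _ = sym (ℤ.*-identityʳ (ε c))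
    ... | no  _ = sym (ℤ.*-zeroʳ (ε c))

  ⟪T-basis⟫ : ∀ i g u → ⟪ T-basis Γ i u , g ⟫ ≡ T* i g u
  ⟪T-basis⟫ i g u with i ∈? τ u
  ... | no  _ = trans (ℤ.+-identityʳ _) (ℤ.*-identityˡ (g u))
  ... | yes _ = cong₂ ℤ._+_ (ℤ.-1*i≡-i (g u)) (begin
    ⟪ q½ · map (λ v → m u v , v) xs , g ⟫ ≡⟨ ⟪⟫-· q½ (map (λ v → m u v , v) xs) g ⟩
    1ℤ ℤ.* ⟪ map (λ v → m u v , v) xs , g ⟫ ≡⟨ ℤ.*-identityˡ _ ⟩
    ⟪ map (λ v → m u v , v) xs , g ⟫ ≡⟨ ∑-map _ _ xs ⟩
    ∑ (λ v → N u v ℤ.* g v) xs ∎)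
    where
    open ≡-Reasoning
    xs = targets i u

  ⟪T⟫ : ∀ i x g → ⟪ T Γ i x , g ⟫ ≡ ⟪ x , T* i g ⟫
  ⟪T⟫ i x g = trans (⟪⟫-linear (T-basis Γ i) x g)
    (∑-cong (λ (c , u) → cong (ε c ℤ.*_) (⟪T-basis⟫ i g u)) x)

  δ* : V → V → ℤ
  δ* = δ _≟ⱽ_

  ⟪basis⟫ : ∀ u g → ⟪ (1ᴸ , u) ∷ [] , g ⟫ ≡ g u
  ⟪basis⟫ u g = trans (ℤ.+-identityʳ _) (ℤ.*-identityˡ (g u))

  arc : Fin n → V → V → ℤ
  arc i w x = if does (i ∈? τ x) then N x w else 0ℤ

  arc-∈ : ∀ {i w x} → i ∈ τ x → arc i w x ≡ N x w
  arc-∈ {i} {w} {x} i∈ rewrite dec-true (i ∈? τ x) i∈ = refl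

  arc-≢0 : ∀ {i w x} → arc i w x ≢ 0ℤ → i ∈ τ x × N x w ≢ 0ℤ
  arc-≢0 {i} {w} {x} ≢0 with i ∈? τ x
  ... | yes i∈ = i∈ , ≢0
  ... | no  _  = contradiction refl ≢0

  ∑-targets-δ : ∀ {i u w} → i ∉ τ w → ∑ (λ x → N u x ℤ.* δ* w x) (targets i u) ≡ N u w
  ∑-targets-δ {i} {u} i∉w = ∑-δ _≟ⱽ_ (N u) (targets-unique i u) (∈-targets i∉w)

  T*δ-∉ : ∀ {i w} → i ∉ τ w → ∀ x → T* i (δ* w) x ≡ δ* w x ℤ.+ arc i w x
  T*δ-∉ {i} {w} i∉w x with i ∈? τ x
  ... | no  i∉x = sym (ℤ.+-identityʳ _)
  ... | yes i∈x = cong₂ ℤ._+_ (trans (cong ℤ.-_ δ≡0) (sym δ≡0)) (∑-targets-δ i∉w)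
    where
    δ≡0 : δ* w x ≡ 0ℤ
    δ≡0 = δ-≢ _≟ⱽ_ λ { refl → i∉w i∈x }

  -- No arc occurring in `T i` ends at a vertex whose label contains `i`, so such a coordinate
  -- functional is an eigenvector with eigenvalue -1. This sign drives both the compatibility rule
  -- and the bond rule.
  T*δ-∈ : ∀ {i w} → i ∈ τ w → ∀ x → T* i (δ* w) x ≡ ℤ.- δ* w x
  T*δ-∈ {i} {w} i∈w x with i ∈? τ x
  ... | no  i∉x = trans δ≡0 (sym (cong ℤ.-_ δ≡0))
    where
    δ≡0 : δ* w x ≡ 0ℤ
    δ≡0 = δ-≢ _≟ⱽ_ λ { refl → i∉x i∈w }
  ... | yes i∈x = trans (+-congˡ (ℤ.- δ* w x) (∑-zero (targets i x) vanish)) (ℤ.+-identityʳ (ℤ.- δ* w x))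
    where
    vanish : ∀ {y} → y ∈ˡ targets i x → N x y ℤ.* δ* w y ≡ 0ℤ
    vanish {y} y∈ = trans
      (cong (N x y ℤ.*_) (δ-≢ _≟ⱽ_ λ { refl → targets⇒∉ {u = x} y∈ i∈w })) (ℤ.*-zeroʳ (N x y))

  T*T*δ : ∀ {i j u w} → i ∉ τ w → j ∉ τ w → j ∈ τ u →
          T* j (T* i (δ* w)) u ≡ ℤ.- arc i w u ℤ.+ N u w ℤ.+ ∑ (λ x → N u x ℤ.* arc i w x) (targets j u)
  T*T*δ {i} {j} {u} {w} i∉w j∉w j∈u = begin
    T* j (T* i (δ* w)) u
      ≡⟨ T*-cong j (T*δ-∉ i∉w) u ⟩
    T* j (λ x → δ* w x ℤ.+ arc i w x) u
      ≡⟨ T*-∈ j∈u ⟩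
    ℤ.- (δ* w u ℤ.+ arc i w u) ℤ.+ ∑ (λ x → N u x ℤ.* (δ* w x ℤ.+ arc i w x)) xs
      ≡⟨ cong₂ ℤ._+_
           (cong ℤ.-_ (trans (cong (ℤ._+ arc i w u) (δ-≢ _≟ⱽ_ λ { refl → j∉w j∈u })) (ℤ.+-identityˡ (arc i w u))))
           (trans (∑-cong (λ x → ℤ.*-distribˡ-+ (N u x) (δ* w x) (arc i w x)) xs)
                  (∑-+ (λ x → N u x ℤ.* δ* w x) (λ x → N u x ℤ.* arc i w x) xs)) ⟩
    ℤ.- arc i w u ℤ.+ (∑ (λ x → N u x ℤ.* δ* w x) xs ℤ.+ ∑ (λ x → N u x ℤ.* arc i w x) xs)
      ≡⟨ cong (λ z → ℤ.- arc i w u ℤ.+ (z ℤ.+ ∑ (λ x → N u x ℤ.* arc i w x) xs)) (∑-targets-δ j∉w) ⟩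
    ℤ.- arc i w u ℤ.+ (N u w ℤ.+ ∑ (λ x → N u x ℤ.* arc i w x) xs)
      ≡⟨ sym (ℤ.+-assoc (ℤ.- arc i w u) (N u w) _) ⟩
    ℤ.- arc i w u ℤ.+ N u w ℤ.+ ∑ (λ x → N u x ℤ.* arc i w x) xs ∎
    where
    open ≡-Reasoning
    xs = targets j u

-- Consequences of the braid relations

module _ {n} (Γ : LabeledGraph n) (M : CoxeterMatrix n) (W : IsWGraph Γ M) where
  open Dual Γ
  open FreeModule _≟ⱽ_
  open IsWGraph W

  -- The order is a separate variable `k`, so that with 2 or 3 in its place `alternating` unfolds by
  -- computation.
  braid-coords : ∀ {k} i j → M i j ≡ k → ∀ x w →
                 ⟪ alternating Γ k i j x , δ* w ⟫ ≡ ⟪ alternating Γ k j i x , δ* w ⟫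
  braid-coords i j refl x w = begin
    ⟪ alternating Γ (M i j) i j x , δ* w ⟫ ≡⟨ sym (⟪⟫-δ (alternating Γ (M i j) i j x) w) ⟩
    ε (coord (alternating Γ (M i j) i j x) w) ≡⟨ ε-cong (coord (alternating Γ (M i j) i j x) w) (coord (alternating Γ (M i j) j i x) w) (braid i j x w) ⟩
    ε (coord (alternating Γ (M i j) j i x) w) ≡⟨ ⟪⟫-δ (alternating Γ (M i j) j i x) w ⟩
    ⟪ alternating Γ (M i j) j i x , δ* w ⟫ ∎
    where open ≡-Reasoning

  T*-commute : ∀ {i j} → M i j ≡ 2 → ∀ w u → T* j (T* i (δ* w)) u ≡ T* i (T* j (δ* w)) u
  T*-commute {i} {j} Mij≡2 w u =
    trans (sym (word i j)) (trans (braid-coords i j Mij≡2 ((1ᴸ , u) ∷ []) w) (word j i))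
    where
    word : ∀ i j → ⟪ alternating Γ 2 i j ((1ᴸ , u) ∷ []) , δ* w ⟫ ≡ T* j (T* i (δ* w)) u
    word i j = begin
      ⟪ T Γ i (T Γ j ((1ᴸ , u) ∷ [])) , δ* w ⟫ ≡⟨ ⟪T⟫ i (T Γ j b) (δ* w) ⟩
      ⟪ T Γ j ((1ᴸ , u) ∷ []) , T* i (δ* w) ⟫ ≡⟨ ⟪T⟫ j b (T* i (δ* w)) ⟩
      ⟪ (1ᴸ , u) ∷ [] , T* j (T* i (δ* w)) ⟫ ≡⟨ ⟪basis⟫ u (T* j (T* i (δ* w))) ⟩
      T* j (T* i (δ* w)) u ∎
      where
      open ≡-Reasoning
      b = (1ᴸ , u) ∷ []

  T*-braid : ∀ {i j} → M i j ≡ 3 → ∀ w u →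
             T* i (T* j (T* i (δ* w))) u ≡ T* j (T* i (T* j (δ* w))) u
  T*-braid {i} {j} Mij≡3 w u =
    trans (sym (word i j)) (trans (braid-coords i j Mij≡3 ((1ᴸ , u) ∷ []) w) (word j i))
    where
    word : ∀ i j → ⟪ alternating Γ 3 i j ((1ᴸ , u) ∷ []) , δ* w ⟫ ≡ T* i (T* j (T* i (δ* w))) u
    word i j = begin
      ⟪ T Γ i (T Γ j (T Γ i ((1ᴸ , u) ∷ []))) , δ* w ⟫ ≡⟨ ⟪T⟫ i (T Γ j (T Γ i b)) (δ* w) ⟩
      ⟪ T Γ j (T Γ i ((1ᴸ , u) ∷ [])) , T* i (δ* w) ⟫ ≡⟨ ⟪T⟫ j (T Γ i b) (T* i (δ* w)) ⟩
      ⟪ T Γ i ((1ᴸ , u) ∷ []) , T* j (T* i (δ* w)) ⟫ ≡⟨ ⟪T⟫ i b (T* j (T* i (δ* w))) ⟩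
      ⟪ (1ᴸ , u) ∷ [] , T* i (T* j (T* i (δ* w))) ⟫ ≡⟨ ⟪basis⟫ u (T* i (T* j (T* i (δ* w)))) ⟩
      T* i (T* j (T* i (δ* w))) u ∎
      where
      open ≡-Reasoning
      b = (1ᴸ , u) ∷ []

  -- Both orders of the commuting operators are evaluated at `u` on the coordinate of `w`. Since
  -- `j ∉ τ u`, the outer `T* j` is the identity there and leaves `N u w`; since `j ∈ τ w`, the
  -- inner `T* j` is -1 and leaves the negative of it.
  compatibility : ∀ {i j u w} → M i j ≡ 2 → i ∈ τ u → i ∉ τ w → j ∈ τ w → j ∉ τ u → N u w ≡ 0ℤ
  compatibility {i} {j} {u} {w} Mij≡2 i∈u i∉w j∈w j∉u = self-neg (begin
    N u w                              ≡⟨ sym (arc-∈ i∈u) ⟩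
    arc i w u                          ≡⟨ sym (ℤ.+-identityˡ _) ⟩
    0ℤ ℤ.+ arc i w u                   ≡⟨ cong (ℤ._+ arc i w u) (sym δ≡0) ⟩
    δ* w u ℤ.+ arc i w u               ≡⟨ sym (T*δ-∉ i∉w u) ⟩
    T* i (δ* w) u                      ≡⟨ sym (T*-∉ j∉u) ⟩
    T* j (T* i (δ* w)) u               ≡⟨ T*-commute Mij≡2 w u ⟩
    T* i (T* j (δ* w)) u               ≡⟨ T*-cong i (T*δ-∈ j∈w) u ⟩
    T* i (ℤ.-_ ∘ δ* w) u               ≡⟨ T*-neg i (δ* w) u ⟩
    ℤ.- T* i (δ* w) u                  ≡⟨ cong ℤ.-_ (T*δ-∉ i∉w u) ⟩
    ℤ.- (δ* w u ℤ.+ arc i w u)         ≡⟨ cong₂ (λ a b → ℤ.- (a ℤ.+ b)) δ≡0 (arc-∈ i∈u) ⟩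
    ℤ.- (0ℤ ℤ.+ N u w)                 ≡⟨ cong ℤ.-_ (ℤ.+-identityˡ _) ⟩
    ℤ.- N u w                          ∎)
    where
    open ≡-Reasoning
    δ≡0 : δ* w u ≡ 0ℤ
    δ≡0 = δ-≢ _≟ⱽ_ λ { refl → i∉w i∈u }
    self-neg : ∀ {z} → z ≡ ℤ.- z → z ≡ 0ℤ
    self-neg {+ zero} _ = refl

  -- As `u` has both labels, the direct arc to `w` occurs in `T*T*δ` once with each sign and
  -- cancels. What remains counts paths of two arcs, sorted by which of the two labels the middle
  -- vertex keeps.
  polygon-∑ : ∀ {i j u w} → M i j ≡ 2 → i ∈ τ u → j ∈ τ u → i ∉ τ w → j ∉ τ w →
              ∑ (λ x → N u x ℤ.* arc i w x) (targets j u) ≡ ∑ (λ x → N u x ℤ.* arc j w x) (targets i u)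
  polygon-∑ {i} {j} {u} {w} Mij≡2 i∈u j∈u i∉w j∉w =
    trans (sym (expand i∈u j∈u i∉w j∉w)) (trans (T*-commute Mij≡2 w u) (expand j∈u i∈u j∉w i∉w))
    where
    open ≡-Reasoning
    expand : ∀ {i j} → i ∈ τ u → j ∈ τ u → i ∉ τ w → j ∉ τ w →
             T* j (T* i (δ* w)) u ≡ ∑ (λ x → N u x ℤ.* arc i w x) (targets j u)
    expand {i} {j} i∈u j∈u i∉w j∉w = begin
      T* j (T* i (δ* w)) u ≡⟨ T*T*δ i∉w j∉w j∈u ⟩
      ℤ.- arc i w u ℤ.+ N u w ℤ.+ S ≡⟨ cong (λ z → ℤ.- z ℤ.+ N u w ℤ.+ S) (arc-∈ i∈u) ⟩
      ℤ.- N u w ℤ.+ N u w ℤ.+ S ≡⟨ cong (ℤ._+ S) (ℤ.+-inverseˡ (N u w)) ⟩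
      0ℤ ℤ.+ S ≡⟨ ℤ.+-identityˡ S ⟩
      S ∎
      where S = ∑ (λ x → N u x ℤ.* arc i w x) (targets j u)

  -- At `v` the outer `T* i` is the identity and the innermost `T* j` is -1, so the braid relation
  -- makes the value of `T* j (T* i (δ* v))` at `v` equal to its own negative. Expanding this zero
  -- gives -1 plus the sum.
  bond-∑ : ∀ {i j v} → M i j ≡ 3 → j ∈ τ v → i ∉ τ v →
           ∑ (λ x → N v x ℤ.* T* i (δ* v) x) (targets j v) ≡ 1ℤ
  bond-∑ {i} {j} {v} Mij≡3 j∈v i∉v = begin
    S                                 ≡⟨ shift (T* i (δ* v) v) S ⟩
    (ℤ.- T* i (δ* v) v ℤ.+ S) ℤ.+ T* i (δ* v) v
      ≡⟨ cong₂ ℤ._+_ (sym (T*-∈ j∈v)) (trans (T*-∉ i∉v) (δ-refl _≟ⱽ_ v)) ⟩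
    T* j (T* i (δ* v)) v ℤ.+ 1ℤ       ≡⟨ cong (ℤ._+ 1ℤ) (self-neg cycle) ⟩
    0ℤ ℤ.+ 1ℤ                         ∎
    where
    open ≡-Reasoning
    S = ∑ (λ x → N v x ℤ.* T* i (δ* v) x) (targets j v)
    shift : ∀ a b → b ≡ (ℤ.- a ℤ.+ b) ℤ.+ a
    shift = ℤ.solve-∀
    self-neg : ∀ {z} → z ≡ ℤ.- z → z ≡ 0ℤ
    self-neg {+ zero} _ = refl
    cycle : T* j (T* i (δ* v)) v ≡ ℤ.- T* j (T* i (δ* v)) v
    cycle = begin
      T* j (T* i (δ* v)) v           ≡⟨ sym (T*-∉ i∉v) ⟩
      T* i (T* j (T* i (δ* v))) v    ≡⟨ T*-braid Mij≡3 v v ⟩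
      T* j (T* i (T* j (δ* v))) v    ≡⟨ T*-cong j (T*-cong i (T*δ-∈ j∈v)) v ⟩
      T* j (T* i (ℤ.-_ ∘ δ* v)) v    ≡⟨ T*-cong j (T*-neg i (δ* v)) v ⟩
      T* j (ℤ.-_ ∘ T* i (δ* v)) v    ≡⟨ T*-neg j (T* i (δ* v)) v ⟩
      ℤ.- T* j (T* i (δ* v)) v       ∎

  module _ (A : NbAdmissible Γ) where
    open NbAdmissible A

    N-natural : ∀ u v → ∃ λ k → N u v ≡ + k
    N-natural u v with k , m≈k ← natural u v =
      k , trans (ε-cong (m u v) (const (+ k)) m≈k) (ℤ.+-identityʳ (+ k))

    N≥0 : ∀ u v → 0ℤ ℤ.≤ N u v
    N≥0 u v with k , eq ← N-natural u v = subst (0ℤ ℤ.≤_) (sym eq) (ℤ.+≤+ ℕ.z≤n)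

    -- The way back from the specialisation to polynomials: a constant is recovered from its value
    -- at q^{1/2} = 1.
    N≡0⇒m≈0 : ∀ u v → N u v ≡ 0ℤ → m u v ≈ 0ᴸ
    N≡0⇒m≈0 u v N≡0 e = trans (proj₂ (natural u v) e)
      (subst (λ z → const z ≈ 0ᴸ) (sym k≡0) const0≈0 e)
      where
      k≡0 : + proj₁ (natural u v) ≡ 0ℤ
      k≡0 = trans (sym (proj₂ (N-natural u v))) N≡0
      const0≈0 : const (+ 0) ≈ 0ᴸ
      const0≈0 e with does (0ℤ ℤ.≟ e)
      ... | true  = refl
      ... | false = refl

    *-≥0 : ∀ {x y} → 0ℤ ℤ.≤ x → 0ℤ ℤ.≤ y → 0ℤ ℤ.≤ x ℤ.* y
    *-≥0 {+ x} {+ y} _ _ = subst (0ℤ ℤ.≤_) (ℤ.pos-* x y) (ℤ.+≤+ ℕ.z≤n)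

    ≥0⇒≥1 : ∀ {x} → 0ℤ ℤ.≤ x → x ≢ 0ℤ → 1ℤ ℤ.≤ x
    ≥0⇒≥1 {+ zero}  _ ≢0 = contradiction refl ≢0
    ≥0⇒≥1 {+ suc x} _ _  = ℤ.+≤+ (ℕ.s≤s ℕ.z≤n)

    *-≢0 : ∀ {x y} → x ≢ 0ℤ → y ≢ 0ℤ → x ℤ.* y ≢ 0ℤ
    *-≢0 {x} x≢0 y≢0 xy≡0 with ℤ.i*j≡0⇒i≡0∨j≡0 x xy≡0
    ... | inj₁ x≡0 = x≢0 x≡0
    ... | inj₂ y≡0 = y≢0 y≡0

    *-≢0⁻ : ∀ x y → x ℤ.* y ≢ 0ℤ → x ≢ 0ℤ × y ≢ 0ℤ
    *-≢0⁻ x y xy≢0 = (λ { refl → xy≢0 refl }) , (λ { refl → xy≢0 (ℤ.*-zeroʳ x) })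

    arc≥0 : ∀ i w x → 0ℤ ℤ.≤ arc i w x
    arc≥0 i w x with does (i ∈? τ x)
    ... | true  = N≥0 x w
    ... | false = ℤ.≤-refl

    polygon : ∀ {i j u v w} → M i j ≡ 2 → i ∈ τ u → j ∈ τ u → i ∉ τ w → j ∉ τ w →
              j ∈ τ v → i ∉ τ v → N u v ≢ 0ℤ → N v w ≢ 0ℤ →
              ∃ λ y → i ∈ τ y × N u y ≢ 0ℤ × N y w ≢ 0ℤ
    polygon {i} {j} {u} {v} {w} Mij≡2 i∈u j∈u i∉w j∉w j∈v i∉v Nuv≢0 Nvw≢0 =
      decompose (∑-≢0 (λ x → N u x ℤ.* arc i w x) (targets j u) ∑≢0)
      where
      open ℤ.≤-Reasoning
      ∑≢0 : ∑ (λ x → N u x ℤ.* arc i w x) (targets j u) ≢ 0ℤ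
      ∑≢0 ∑≡0 with ℤ.+≤+ () ← begin
        1ℤ ≤⟨ ≥0⇒≥1 (*-≥0 (N≥0 u v) (arc≥0 j w v))
               (*-≢0 Nuv≢0 (λ eq → Nvw≢0 (trans (sym (arc-∈ {w = w} j∈v)) eq))) ⟩
        N u v ℤ.* arc j w v
          ≤⟨ ∑-≥-term (λ x → N u x ℤ.* arc j w x) (λ x → *-≥0 (N≥0 u x) (arc≥0 j w x))
               (∈-targets i∉v Nuv≢0) ⟩
        ∑ (λ x → N u x ℤ.* arc j w x) (targets i u)
          ≡⟨ sym (polygon-∑ Mij≡2 i∈u j∈u i∉w j∉w) ⟩
        ∑ (λ x → N u x ℤ.* arc i w x) (targets j u) ≡⟨ ∑≡0 ⟩
        0ℤ ∎
      decompose : (∃ λ y → y ∈ˡ targets j u × N u y ℤ.* arc i w y ≢ 0ℤ) →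
                  ∃ λ y → i ∈ τ y × N u y ≢ 0ℤ × N y w ≢ 0ℤ
      decompose (y , _ , y≢0) with Nuy≢0 , arc≢0 ← *-≢0⁻ (N u y) (arc i w y) y≢0
        with i∈y , Nyw≢0 ← arc-≢0 arc≢0 = y , i∈y , Nuy≢0 , Nyw≢0

    -- Each of two distinct sources would contribute at least 1 to `bond-∑`, whose nonnegative terms
    -- add up to 1.
    bond : ∀ {i j v x y} → M i j ≡ 3 → j ∈ τ v → i ∉ τ v →
           i ∈ τ x → j ∉ τ x → N x v ≢ 0ℤ → i ∈ τ y → j ∉ τ y → N y v ≢ 0ℤ → x ≡ y
    bond {i} {j} {v} {x} {y} Mij≡3 j∈v i∉v i∈x j∉x Nx≢0 i∈y j∉y Ny≢0 with x ≟ⱽ y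
    ... | yes x≡y = x≡y
    ... | no  x≢y = contradiction (begin
      1ℤ ℤ.+ 1ℤ
        ≤⟨ ℤ.+-mono-≤ (≥1 i∈x j∉x Nx≢0) (≥1 i∈y j∉y Ny≢0) ⟩
      f x ℤ.+ f y
        ≤⟨ ∑-≥-terms f f≥0 x≢y (∈-targets j∉x (back i∈x j∉x Nx≢0)) (∈-targets j∉y (back i∈y j∉y Ny≢0)) ⟩
      ∑ f (targets j v) ≡⟨ bond-∑ Mij≡3 j∈v i∉v ⟩
      1ℤ ∎) λ { (ℤ.+≤+ (ℕ.s≤s ())) }
      where
      open ℤ.≤-Reasoning
      f : V → ℤ
      f x = N v x ℤ.* T* i (δ* v) x
      δ≥0 : ∀ x → 0ℤ ℤ.≤ δ* v x
      δ≥0 x with does (x ≟ⱽ v)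
      ... | true  = ℤ.+≤+ ℕ.z≤n
      ... | false = ℤ.≤-refl
      f≥0 : ∀ x → 0ℤ ℤ.≤ f x
      f≥0 x = *-≥0 (N≥0 v x)
        (subst (0ℤ ℤ.≤_) (sym (T*δ-∉ i∉v x)) (ℤ.+-mono-≤ (δ≥0 x) (arc≥0 i v x)))
      -- The labels of `x` and `v` are incomparable, witnessed by `i` and `j`, so symmetry of the
      -- weights reverses the arc.
      back : ∀ {x} → i ∈ τ x → j ∉ τ x → N x v ≢ 0ℤ → N v x ≢ 0ℤ
      back {x} i∈x j∉x Nx≢0 = Nx≢0 ∘ trans
        (ε-cong (m x v) (m v x) (symmetric x v ((λ x⊆v → i∉v (x⊆v i∈x)) , (λ v⊆x → j∉x (v⊆x j∈v)))))
      ≥1 : ∀ {x} → i ∈ τ x → j ∉ τ x → N x v ≢ 0ℤ → 1ℤ ℤ.≤ f x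
      ≥1 {x} i∈x j∉x Nx≢0 = ≥0⇒≥1 (f≥0 x) (*-≢0 (back i∈x j∉x Nx≢0) (Nx≢0 ∘ trans (sym Tx≡N)))
        where
        Tx≡N : T* i (δ* v) x ≡ N x v
        Tx≡N = trans (T*δ-∉ i∉v x) (trans
          (cong₂ ℤ._+_ (δ-≢ _≟ⱽ_ λ { refl → i∉v i∈x }) (arc-∈ i∈x)) (ℤ.+-identityˡ (N x v)))

-- Cyclic arithmetic modulo `n`

residue-unique : ∀ {n x y} c → x < n → y < n → + x ≡ + y ℤ.+ c ℤ.* + n → x ≡ y
residue-unique {n} {x} {y} c x<n y<n eq = ℤ.+-injective (ℤ.i-j≡0⇒i≡j (+ x) (+ y) (trans diff (cong (ℤ._* + n) c≡0)))
  where
  diff : + x ℤ.- + y ≡ c ℤ.* + n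
  diff = trans (cong (ℤ._- + y) eq) (cancel (+ y) (c ℤ.* + n))
    where
    cancel : ∀ a b → a ℤ.+ b ℤ.- a ≡ b
    cancel = ℤ.solve-∀
  small : ℤ.∣ c ∣ * n < 1 * n
  small = begin-strict
    ℤ.∣ c ∣ * n        ≡⟨ sym (ℤ.abs-* c (+ n)) ⟩
    ℤ.∣ c ℤ.* + n ∣    ≡⟨ cong ℤ.∣_∣ (trans (sym diff) (ℤ.m-n≡m⊖n x y)) ⟩
    ℤ.∣ x ℤ.⊖ y ∣      ≤⟨ ℤ.∣m⊝n∣≤m⊔n x y ⟩
    x ℕ.⊔ y            <⟨ ℕ.⊔-lub x<n y<n ⟩
    n                  ≡⟨ sym (ℕ.*-identityˡ n) ⟩
    1 * n              ∎
    where open ℕ.≤-Reasoning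
  c≡0 : c ≡ 0ℤ
  c≡0 = ℤ.∣i∣≡0⇒i≡0 (ℕ.n≤0⇒n≡0 (ℕ.s≤s⁻¹ (ℕ.*-cancelʳ-< n ℤ.∣ c ∣ 1 small)))

%ℕ-unique : ∀ {n} .{{_ : NonZero n}} {z r} c → r < n → z ≡ + r ℤ.+ c ℤ.* + n → z %ℕ n ≡ r
%ℕ-unique {n} {z} {r} c r<n eq = residue-unique (c ℤ.- z /ℕ n) (n%ℕd<d z n) r<n (begin
  + (z %ℕ n)
    ≡⟨ move (+ (z %ℕ n)) (z /ℕ n ℤ.* + n) ⟩
  + (z %ℕ n) ℤ.+ z /ℕ n ℤ.* + n ℤ.- z /ℕ n ℤ.* + n
    ≡⟨ cong (ℤ._- z /ℕ n ℤ.* + n) (trans (sym (a≡a%ℕn+[a/ℕn]*n z n)) eq) ⟩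
  + r ℤ.+ c ℤ.* + n ℤ.- z /ℕ n ℤ.* + n
    ≡⟨ collect (+ r) c (z /ℕ n) (+ n) ⟩
  + r ℤ.+ (c ℤ.- z /ℕ n) ℤ.* + n ∎)
  where
  open ≡-Reasoning
  move : ∀ a b → a ≡ a ℤ.+ b ℤ.- b
  move = ℤ.solve-∀
  collect : ∀ r c d m → r ℤ.+ c ℤ.* m ℤ.- d ℤ.* m ≡ r ℤ.+ (c ℤ.- d) ℤ.* m
  collect = ℤ.solve-∀

module _ {n : ℕ} where

  -- An explicit quotient turns a congruence into an equation of integers, which the ring solver can
  -- handle.
  ⊕-quotient : ∀ (i : Fin n) j → ∃ λ c → + toℕ (i ⊕ j) ≡ + toℕ i ℤ.+ j ℤ.+ c ℤ.* + n
  ⊕-quotient i j = ℤ.- (z /ℕ n) , (begin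
    + toℕ (i ⊕ j)
      ≡⟨ cong +_ (Fin.toℕ-fromℕ< (n%ℕd<d z n)) ⟩
    + (z %ℕ n)
      ≡⟨ move (+ (z %ℕ n)) (z /ℕ n) (+ n) ⟩
    + (z %ℕ n) ℤ.+ z /ℕ n ℤ.* + n ℤ.+ ℤ.- (z /ℕ n) ℤ.* + n
      ≡⟨ cong (ℤ._+ ℤ.- (z /ℕ n) ℤ.* + n) (sym (a≡a%ℕn+[a/ℕn]*n z n)) ⟩
    z ℤ.+ ℤ.- (z /ℕ n) ℤ.* + n ∎)
    where
    instance _ = Fin.nonZeroIndex i
    open ≡-Reasoning
    z = + toℕ i ℤ.+ j
    move : ∀ a b m → a ≡ a ℤ.+ b ℤ.* m ℤ.+ ℤ.- b ℤ.* m
    move = ℤ.solve-∀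

  ⊕-unique : ∀ (i : Fin n) j {k} c → + toℕ i ℤ.+ j ≡ + toℕ k ℤ.+ c ℤ.* + n → i ⊕ j ≡ k
  ⊕-unique i j {k} c eq = Fin.toℕ-injective
    (trans (Fin.toℕ-fromℕ< (n%ℕd<d (+ toℕ i ℤ.+ j) n)) (%ℕ-unique c (Fin.toℕ<n k) eq))
    where instance _ = Fin.nonZeroIndex i

  ⊕-⊕ : ∀ (i : Fin n) j k → (i ⊕ j) ⊕ k ≡ i ⊕ (j ℤ.+ k)
  ⊕-⊕ i j k with c , p ← ⊕-quotient i j | d , r ← ⊕-quotient i (j ℤ.+ k) =
    ⊕-unique (i ⊕ j) k (c ℤ.- d) (begin
      + toℕ (i ⊕ j) ℤ.+ k                            ≡⟨ cong (ℤ._+ k) p ⟩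
      + toℕ i ℤ.+ j ℤ.+ c ℤ.* + n ℤ.+ k              ≡⟨ regroup (+ toℕ i) j k c d (+ n) ⟩
      + toℕ i ℤ.+ (j ℤ.+ k) ℤ.+ d ℤ.* + n ℤ.+ (c ℤ.- d) ℤ.* + n
        ≡⟨ cong (ℤ._+ (c ℤ.- d) ℤ.* + n) (sym r) ⟩
      + toℕ (i ⊕ (j ℤ.+ k)) ℤ.+ (c ℤ.- d) ℤ.* + n    ∎)
    where
    open ≡-Reasoning
    regroup : ∀ i j k c d m →
      i ℤ.+ j ℤ.+ c ℤ.* m ℤ.+ k ≡ i ℤ.+ (j ℤ.+ k) ℤ.+ d ℤ.* m ℤ.+ (c ℤ.- d) ℤ.* m
    regroup = ℤ.solve-∀

  ⊕-identityʳ : ∀ (i : Fin n) → i ⊕ 0ℤ ≡ i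
  ⊕-identityʳ i = ⊕-unique i 0ℤ 0ℤ (refl′ (+ toℕ i) (+ n))
    where
    refl′ : ∀ a m → a ℤ.+ 0ℤ ≡ a ℤ.+ 0ℤ ℤ.* m
    refl′ = ℤ.solve-∀

  ⊕-period : ∀ (i : Fin n) → i ⊕ + n ≡ i
  ⊕-period i = ⊕-unique i (+ n) 1ℤ (cong (λ z → + toℕ i ℤ.+ z) (sym (ℤ.*-identityˡ (+ n))))

  ⊕-injective : ∀ (i : Fin n) {s t} → s < n → t < n → i ⊕ + s ≡ i ⊕ + t → s ≡ t
  ⊕-injective i {s} {t} s<n t<n eq with c , p ← ⊕-quotient i (+ s) | d , r ← ⊕-quotient i (+ t) =
    residue-unique (d ℤ.- c) s<n t<n (begin
      + s ≡⟨ solveˢ (+ toℕ i) (+ s) c (+ n) ⟩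
      (+ toℕ i ℤ.+ + s ℤ.+ c ℤ.* + n) ℤ.- + toℕ i ℤ.- c ℤ.* + n
        ≡⟨ cong (λ z → z ℤ.- + toℕ i ℤ.- c ℤ.* + n)
             (trans (sym p) (trans (cong (λ z → + toℕ z) eq) r)) ⟩
      (+ toℕ i ℤ.+ + t ℤ.+ d ℤ.* + n) ℤ.- + toℕ i ℤ.- c ℤ.* + n
        ≡⟨ solveᵗ (+ toℕ i) (+ t) c d (+ n) ⟩
      + t ℤ.+ (d ℤ.- c) ℤ.* + n ∎)
    where
    open ≡-Reasoning
    solveˢ : ∀ i s c m → s ≡ (i ℤ.+ s ℤ.+ c ℤ.* m) ℤ.- i ℤ.- c ℤ.* m
    solveˢ = ℤ.solve-∀
    solveᵗ : ∀ i t c d m → (i ℤ.+ t ℤ.+ d ℤ.* m) ℤ.- i ℤ.- c ℤ.* m ≡ t ℤ.+ (d ℤ.- c) ℤ.* m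
    solveᵗ = ℤ.solve-∀

  ⊕-surjective : ∀ (i z : Fin n) → ∃ λ t → t < n × i ⊕ + t ≡ z
  ⊕-surjective i z = t %ℕ n , n%ℕd<d t n , ⊕-unique i (+ (t %ℕ n)) (ℤ.- (t /ℕ n)) (begin
    + toℕ i ℤ.+ + (t %ℕ n)
      ≡⟨ move (+ toℕ i) (+ (t %ℕ n)) (t /ℕ n) (+ n) ⟩
    + toℕ i ℤ.+ (+ (t %ℕ n) ℤ.+ t /ℕ n ℤ.* + n) ℤ.+ ℤ.- (t /ℕ n) ℤ.* + n
      ≡⟨ cong (λ s → + toℕ i ℤ.+ s ℤ.+ ℤ.- (t /ℕ n) ℤ.* + n) (sym (a≡a%ℕn+[a/ℕn]*n t n)) ⟩
    + toℕ i ℤ.+ (+ toℕ z ℤ.- + toℕ i) ℤ.+ ℤ.- (t /ℕ n) ℤ.* + n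
      ≡⟨ cong (ℤ._+ ℤ.- (t /ℕ n) ℤ.* + n) (cancel (+ toℕ i) (+ toℕ z)) ⟩
    + toℕ z ℤ.+ ℤ.- (t /ℕ n) ℤ.* + n ∎)
    where
    instance _ = Fin.nonZeroIndex i
    open ≡-Reasoning
    t = + toℕ z ℤ.- + toℕ i
    move : ∀ a b c m → a ℤ.+ b ≡ a ℤ.+ (b ℤ.+ c ℤ.* m) ℤ.+ ℤ.- c ℤ.* m
    move = ℤ.solve-∀
    cancel : ∀ a b → a ℤ.+ (b ℤ.- a) ≡ b
    cancel = ℤ.solve-∀

  ⊖-⊕ : ∀ (i : Fin n) {d} → d < n → (i ⊕ + suc d) ⊖ i ≡ suc d
  ⊖-⊕ i {d} d<n with c , p ← ⊕-quotient i (+ suc d) =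
    cong suc (%ℕ-unique c d<n (begin
      + toℕ (i ⊕ + suc d) ℤ.- + toℕ i ℤ.- 1ℤ
        ≡⟨ cong (λ z → z ℤ.- + toℕ i ℤ.- 1ℤ) p ⟩
      (+ toℕ i ℤ.+ (1ℤ ℤ.+ + d) ℤ.+ c ℤ.* + n) ℤ.- + toℕ i ℤ.- 1ℤ
        ≡⟨ cancel (+ toℕ i) (+ d) c (+ n) ⟩
      + d ℤ.+ c ℤ.* + n ∎))
    where
    instance _ = Fin.nonZeroIndex i
    open ≡-Reasoning
    cancel : ∀ i d c m → (i ℤ.+ (1ℤ ℤ.+ d) ℤ.+ c ℤ.* m) ℤ.- i ℤ.- 1ℤ ≡ d ℤ.+ c ℤ.* m
    cancel = ℤ.solve-∀

-- Counting entries of rows and elements of subsets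

bit : Bool → ℕ
bit b = if b then 1 else 0

bit-injective : ∀ {b c} → bit b ≡ bit c → b ≡ c
bit-injective {true}  {true}  _ = refl
bit-injective {false} {false} _ = refl

bit-not : ∀ b → bit b + bit (not b) ≡ 1
bit-not true  = refl
bit-not false = refl

module _ {n : ℕ} where
  open DecVecMembership {A = Fin n} Fin._≟_ using () renaming (_∈?_ to _∈ᵛ?_)

  count-++ : ∀ k {a b} (r : Vec (Fin n) a) (r′ : Vec (Fin n) b) →
             count (k Fin.≟_) (r Vec.++ r′) ≡ count (k Fin.≟_) r + count (k Fin.≟_) r′
  count-++ k []      r′ = refl
  count-++ k (x ∷ r) r′ with does (k Fin.≟ x)
  ... | true  = cong suc (count-++ k r r′)
  ... | false = count-++ k r r′

  count-∈ : ∀ {k a} {r : Vec (Fin n) a} → k ∈ᵛ r → 1 ≤ count (k Fin.≟_) r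
  count-∈ {k} {r = x ∷ r} (here refl) rewrite dec-true (k Fin.≟ k) refl = ℕ.s≤s ℕ.z≤n
  count-∈ {k} {r = x ∷ r} (there k∈) with does (k Fin.≟ x)
  ... | true  = ℕ.s≤s ℕ.z≤n
  ... | false = count-∈ k∈

  count-∉ : ∀ {k a} (r : Vec (Fin n) a) → k ∉ᵛ r → count (k Fin.≟_) r ≡ 0
  count-∉     []      k∉ = refl
  count-∉ {k} (x ∷ r) k∉ rewrite dec-false (k Fin.≟ x) (k∉ ∘ here) = count-∉ r (k∉ ∘ there)

  lookup-entries : ∀ {a} (r : Vec (Fin n) a) k → lookup (entries r) k ≡ does (k ∈ᵛ? r)
  lookup-entries r k = Vec.lookup∘tabulate (λ x → does (x ∈ᵛ? r)) k

  count⇒entries : ∀ {a} (r : Vec (Fin n) a) k b → count (k Fin.≟_) r ≡ bit b → lookup (entries r) k ≡ b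
  count⇒entries r k b eq = trans (lookup-entries r k) (go b eq)
    where
    go : ∀ b → count (k Fin.≟_) r ≡ bit b → does (k ∈ᵛ? r) ≡ b
    go b eq with k ∈ᵛ? r
    go true  eq | yes k∈ = refl
    go false eq | yes k∈ = contradiction (subst (1 ≤_) eq (count-∈ k∈)) λ ()
    go true  eq | no  k∉ with () ← trans (sym eq) (count-∉ r k∉)
    go false eq | no  k∉ = refl

  entries-count : ∀ {a} (r : Vec (Fin n) a) k → count (k Fin.≟_) r ≤ 1 →
                  bit (lookup (entries r) k) ≡ count (k Fin.≟_) r
  entries-count r k ≤1 rewrite lookup-entries r k with k ∈ᵛ? r
  ... | yes k∈ = ℕ.≤-antisym (count-∈ k∈) ≤1
  ... | no  k∉ = sym (count-∉ r k∉)

∑-single : ∀ {n} (x : Fin n) → sum (λ z → bit (does (z Fin.≟ x))) ≡ 1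
∑-single {suc n} zero    = cong suc (sum-replicate-zero n)
∑-single {suc n} (suc x) = ∑-single x

∑-count : ∀ {n a} (r : Vec (Fin n) a) → sum (λ z → count (z Fin.≟_) r) ≡ a
∑-count {n} []      = sum-replicate-zero n
∑-count {n} (x ∷ r) = begin
  sum (λ z → count (z Fin.≟_) (x ∷ r))
    ≡⟨ sum-cong-≗ (λ z → if-suc (does (z Fin.≟ x))) ⟩
  sum (λ z → bit (does (z Fin.≟ x)) + count (z Fin.≟_) r)
    ≡⟨ ∑-distrib-+ (λ z → bit (does (z Fin.≟ x))) (λ z → count (z Fin.≟_) r) ⟩
  sum (λ z → bit (does (z Fin.≟ x))) + sum (λ z → count (z Fin.≟_) r)
    ≡⟨ cong₂ _+_ (∑-single x) (∑-count r) ⟩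
  suc _ ∎
  where
  open ≡-Reasoning
  if-suc : ∀ b {m} → (if b then suc else id) m ≡ bit b + m
  if-suc true  = refl
  if-suc false = refl

∣∣-sum : ∀ {n} (p : Subset n) → ∣ p ∣ ≡ sum (λ z → bit (lookup p z))
∣∣-sum []            = refl
∣∣-sum (inside  ∷ p) = cong suc (∣∣-sum p)
∣∣-sum (outside ∷ p) = ∣∣-sum p

elements : ∀ {n} (p : Subset n) → Vec (Fin n) ∣ p ∣
elements []            = []
elements (inside  ∷ p) = zero ∷ Vec.map suc (elements p)
elements (outside ∷ p) = Vec.map suc (elements p)

elements-linked : ∀ {n} (p : Subset n) → Linked _<ᶠ_ (elements p)
elements-linked []            = []
elements-linked (outside ∷ p) = Linked.map⁺ (Linked.map ℕ.s≤s (elements-linked p))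
elements-linked (inside  ∷ p) = zero∷ (elements p) (elements-linked p)
  where
  zero∷ : ∀ {n k} (r : Vec (Fin n) k) → Linked _<ᶠ_ r → Linked _<ᶠ_ (zero ∷ Vec.map suc r)
  zero∷ []      _  = [-]
  zero∷ (x ∷ r) r↗ = ℕ.s≤s ℕ.z≤n ∷ Linked.map⁺ (Linked.map ℕ.s≤s r↗)

elements-count : ∀ {n} (p : Subset n) k → count (k Fin.≟_) (elements p) ≡ bit (lookup p k)
elements-count (b ∷ p) k = go b k
  where
  count-zero : ∀ {n k} (r : Vec (Fin n) k) → count (zero Fin.≟_) (Vec.map suc r) ≡ 0
  count-zero []      = refl
  count-zero (x ∷ r) = count-zero r
  count-suc : ∀ {n a} k (r : Vec (Fin n) a) → count (suc k Fin.≟_) (Vec.map suc r) ≡ count (k Fin.≟_) r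
  count-suc k []      = refl
  count-suc k (x ∷ r) with does (k Fin.≟ x)
  ... | true  = cong suc (count-suc k r)
  ... | false = count-suc k r
  go : ∀ b k → count (k Fin.≟_) (elements (b ∷ p)) ≡ bit (lookup (b ∷ p) k)
  go true  zero    = cong suc (count-zero (elements p))
  go false zero    = count-zero (elements p)
  go true  (suc k) = trans (count-suc k (elements p)) (elements-count p k)
  go false (suc k) = trans (count-suc k (elements p)) (elements-count p k)

linked-unique : ∀ {n k} {r r′ : Vec (Fin n) k} → Linked _<ᶠ_ r → Linked _<ᶠ_ r′ →
                (∀ {z} → z ∈ᵛ r → z ∈ᵛ r′) → (∀ {z} → z ∈ᵛ r′ → z ∈ᵛ r) → r ≡ r′
linked-unique {r = []}    {[]}     _  _   _   _  = refl
linked-unique {r = x ∷ r} {y ∷ r′} r↗ r′↗ ⊆r′ ⊆r = cong₂ _∷_ x≡y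
  (linked-unique (Linked.tail r↗) (Linked.tail r′↗)
    (λ z∈ → drop (⊆r′ (there z∈)) λ { refl → Fin.<-irrefl x≡y (below r↗ z∈) })
    (λ z∈ → drop (⊆r (there z∈)) λ { refl → Fin.<-irrefl (sym x≡y) (below r′↗ z∈) }))
  where
  below : ∀ {n k} {x z : Fin n} {r : Vec (Fin n) k} → Linked _<ᶠ_ (x ∷ r) → z ∈ᵛ r → x <ᶠ z
  below (x<y ∷ r↗) z∈ = Allᵛ.lookup (Linked.Linked⇒All Fin.<-trans x<y r↗) z∈
  drop : ∀ {n k} {x z : Fin n} {r : Vec (Fin n) k} → z ∈ᵛ x ∷ r → z ≢ x → z ∈ᵛ r
  drop (here z≡x) z≢x = contradiction z≡x z≢x
  drop (there z∈) _   = z∈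
  x≡y : x ≡ y
  x≡y with ⊆r′ (here refl) | ⊆r (here refl)
  ... | here x≡y  | _         = x≡y
  ... | there _   | here y≡x  = sym y≡x
  ... | there x∈  | there y∈  = contradiction (below r↗ y∈) (Fin.<-asym (below r′↗ x∈))

-- Tableaux as words: true marks the first row

module _ {a b : ℕ} where

  word : RSYT a b → Fin (a + b) → Bool
  word s z = lookup (s ¹) z

  -- The proof stored in a tableau is irrelevant; decidability of the property yields one that can
  -- be inspected.
  standard : ∀ (s : RSYT a b) → RowsIncreasing (row₁ s) (row₂ s) × EachOnce (row₁ s) (row₂ s)
  standard (tableau r₁ r₂ p) = recompute (rowStandard? r₁ r₂) p

  count-rows : ∀ (s : RSYT a b) z → count (z Fin.≟_) (row₁ s) + count (z Fin.≟_) (row₂ s) ≡ 1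
  count-rows s z = trans (sym (count-++ z (row₁ s) (row₂ s))) (proj₂ (standard s) z)

  word-count : ∀ (s : RSYT a b) z → bit (word s z) ≡ count (z Fin.≟_) (row₁ s)
  word-count s z = entries-count (row₁ s) z (subst (count (z Fin.≟_) (row₁ s) ≤_) (count-rows s z) (ℕ.m≤m+n _ _))

  row₂-count : ∀ (s : RSYT a b) z → bit (lookup (s ²) z) ≡ count (z Fin.≟_) (row₂ s)
  row₂-count s z = entries-count (row₂ s) z (subst (count (z Fin.≟_) (row₂ s) ≤_) (count-rows s z) (ℕ.m≤n+m _ _))

  row₂-word : ∀ (s : RSYT a b) z → lookup (s ²) z ≡ not (word s z)
  row₂-word s z = bit-injective (ℕ.+-cancelˡ-≡ (bit (word s z)) _ _ (trans
    (trans (cong₂ _+_ (word-count s z) (row₂-count s z)) (count-rows s z)) (sym (bit-not (word s z)))))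

  ∑-word : ∀ (s : RSYT a b) → sum (bit ∘ word s) ≡ a
  ∑-word s = trans (sum-cong-≗ (word-count s)) (∑-count (row₁ s))

  ∑-not-word : ∀ (s : RSYT a b) → sum (bit ∘ not ∘ word s) ≡ b
  ∑-not-word s = trans
    (sum-cong-≗ (λ z → trans (cong bit (sym (row₂-word s z))) (row₂-count s z))) (∑-count (row₂ s))

  word-injective : ∀ {s t : RSYT a b} → (∀ z → word s z ≡ word t z) → s ≡ t
  word-injective {s} {t} eq = rows-injective (row-injective (proj₁ (proj₁ (standard s))) (proj₁ (proj₁ (standard t))) eq)
    (row-injective (proj₂ (proj₁ (standard s))) (proj₂ (proj₁ (standard t)))
      λ z → trans (row₂-word s z) (trans (cong not (eq z)) (sym (row₂-word t z))))
    where
    open DecVecMembership {A = Fin (a + b)} Fin._≟_ using () renaming (_∈?_ to _∈ᵛ?_)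
    rows-injective : ∀ {s t : RSYT a b} → row₁ s ≡ row₁ t → row₂ s ≡ row₂ t → s ≡ t
    rows-injective refl refl = refl
    transfer : ∀ {k} {r r′ : Vec (Fin (a + b)) k} {z} →
               lookup (entries r) z ≡ lookup (entries r′) z → z ∈ᵛ r → z ∈ᵛ r′
    transfer {r = r} {r′} {z} eq z∈ with z ∈ᵛ? r′
    ... | yes z∈′ = z∈′
    ... | no  z∉′ with () ← trans (sym (dec-true (z ∈ᵛ? r) z∈))
      (trans (trans (sym (lookup-entries r z)) (trans eq (lookup-entries r′ z))) (dec-false (z ∈ᵛ? r′) z∉′))
    row-injective : ∀ {k} {r r′ : Vec (Fin (a + b)) k} → Linked _<ᶠ_ r → Linked _<ᶠ_ r′ →
                    (∀ z → lookup (entries r) z ≡ lookup (entries r′) z) → r ≡ r′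
    row-injective r↗ r′↗ eq = linked-unique r↗ r′↗ (transfer (eq _)) (transfer (sym (eq _)))

  fromSubset : ∀ (p : Subset (a + b)) → ∣ p ∣ ≡ a →
               ∃ λ (t : RSYT a b) → ∀ z → word t z ≡ lookup p z
  fromSubset p ∣p∣≡a = tableau r₁ r₂ ((↗ p ∣p∣≡a , ↗ (∁ p) ∣∁p∣≡b) , once) ,
    λ z → count⇒entries r₁ z (lookup p z) (counts p ∣p∣≡a z)
    where
    ∣∁p∣≡b : ∣ ∁ p ∣ ≡ b
    ∣∁p∣≡b = trans (∣∁p∣≡n∸∣p∣ p) (trans (cong (a + b ∸_) ∣p∣≡a) (ℕ.m+n∸m≡n a b))
    enumerate : ∀ {n k} (p : Subset n) → ∣ p ∣ ≡ k → Vec (Fin n) k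
    enumerate p refl = elements p
    ↗ : ∀ {n k} (p : Subset n) (eq : ∣ p ∣ ≡ k) → Linked _<ᶠ_ (enumerate p eq)
    ↗ p refl = elements-linked p
    counts : ∀ {n k} (p : Subset n) (eq : ∣ p ∣ ≡ k) z → count (z Fin.≟_) (enumerate p eq) ≡ bit (lookup p z)
    counts p refl = elements-count p
    r₁ = enumerate p ∣p∣≡a
    r₂ = enumerate (∁ p) ∣∁p∣≡b
    once : EachOnce r₁ r₂
    once z = begin
      count (z Fin.≟_) (r₁ Vec.++ r₂)               ≡⟨ count-++ z r₁ r₂ ⟩
      count (z Fin.≟_) r₁ + count (z Fin.≟_) r₂
        ≡⟨ cong₂ _+_ (counts p ∣p∣≡a z) (counts (∁ p) ∣∁p∣≡b z) ⟩
      bit (lookup p z) + bit (lookup (∁ p) z)       ≡⟨ cong (λ c → bit (lookup p z) + bit c) (Vec.lookup-map z not p) ⟩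
      bit (lookup p z) + bit (not (lookup p z))     ≡⟨ bit-not (lookup p z) ⟩
      1                                             ∎
      where open ≡-Reasoning

  -- A transposition permutes the summands of `∑-word`, so the new first row still has `a` entries.
  swap : ∀ x y (s : RSYT a b) → ∃ λ (t : RSYT a b) → ∀ z → word t z ≡ word s (transpose x y z)
  swap x y s = proj₁ t , λ z → trans (proj₂ t z) (Vec.lookup∘tabulate f z)
    where
    f : Fin (a + b) → Bool
    f = word s ∘ transpose x y
    p : Subset (a + b)
    p = tabulate f
    ∣p∣≡a : ∣ p ∣ ≡ a
    ∣p∣≡a = begin
      ∣ p ∣                                       ≡⟨ ∣∣-sum p ⟩
      sum (λ z → bit (lookup p z))                ≡⟨ sum-cong-≗ (λ z → cong bit (Vec.lookup∘tabulate f z)) ⟩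
      sum (λ z → bit (word s (transpose x y z))) ≡⟨ sym (sum-permute (bit ∘ word s) (Permutation.transpose x y)) ⟩
      sum (bit ∘ word s)                          ≡⟨ ∑-word s ⟩
      a                                           ∎
      where open ≡-Reasoning
    t = fromSubset p ∣p∣≡a

  word⇒interchange : ∀ {x y} {s t : RSYT a b} →
    (∀ z → word t z ≡ word s (transpose x y z)) → Interchange x y s t
  word⇒interchange {x} {y} {s} {t} eq z =
    eq z , trans (row₂-word t z) (trans (cong not (eq z)) (sym (row₂-word s _)))

-- Sums along a cyclic word and over cyclic intervals

∑< : (ℕ → ℕ) → ℕ → ℕ
∑< h zero    = 0
∑< h (suc t) = h 0 + ∑< (h ∘ suc) t

∑<-cong : ∀ {h k} t → (∀ {s} → s < t → h s ≡ k s) → ∑< h t ≡ ∑< k t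
∑<-cong zero    eq = refl
∑<-cong (suc t) eq = cong₂ _+_ (eq ℕ.z<s) (∑<-cong t (eq ∘ ℕ.s<s))

∑<-+ : ∀ h s t → ∑< h (s + t) ≡ ∑< h s + ∑< (λ r → h (s + r)) t
∑<-+ h zero    t = refl
∑<-+ h (suc s) t = trans (cong (λ m → h 0 + m) (∑<-+ (h ∘ suc) s t)) (sym (ℕ.+-assoc (h 0) _ _))

∑<-suc : ∀ h t → ∑< h (suc t) ≡ ∑< h t + h t
∑<-suc h zero    = ℕ.+-identityʳ (h 0)
∑<-suc h (suc t) = trans (cong (λ m → h 0 + m) (∑<-suc (h ∘ suc) t)) (sym (ℕ.+-assoc (h 0) _ _))

∑<-zero : ∀ t → ∑< (λ _ → 0) t ≡ 0
∑<-zero zero    = refl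
∑<-zero (suc t) = ∑<-zero t

sum-∑< : ∀ n h → sum {n} (h ∘ toℕ) ≡ ∑< h n
sum-∑< zero    h = refl
sum-∑< (suc n) h = cong (λ m → h 0 + m) (sum-∑< n (h ∘ suc))

module _ {n : ℕ} (i : Fin n) where

  rotation : Permutation n n
  rotation = permutation to from to∘from from∘to
    where
    to from : Fin n → Fin n
    to t   = i ⊕ + toℕ t
    from z = fromℕ< (proj₁ (proj₂ (⊕-surjective i z)))
    to∘from : ∀ z → to (from z) ≡ z
    to∘from z = trans (cong (λ s → i ⊕ + s) (Fin.toℕ-fromℕ< (proj₁ (proj₂ (⊕-surjective i z)))))
                      (proj₂ (proj₂ (⊕-surjective i z)))
    from∘to : ∀ t → from (to t) ≡ t
    from∘to t = Fin.toℕ-injective (⊕-injective i (Fin.toℕ<n _) (Fin.toℕ<n t) (to∘from (to t)))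

  sum-cyclic : ∀ f → sum f ≡ ∑< (λ t → f (i ⊕ + t)) n
  sum-cyclic f = trans (sum-permute f rotation) (sum-∑< n (λ t → f (i ⊕ + t)))

  -- The bound on `len` matters: for `len = n` the right end is again the predecessor of `i`, which
  -- the convention reads as the empty interval.
  lookup-interval : ∀ {t len} → t < n → len < n →
    lookup ⟨ i , i ⊕ (+ len ℤ.- 1ℤ) ⟩ (i ⊕ + t) ≡ (t <ᵇ len)
  lookup-interval {t} {len} t<n len<n = trans (Vec.lookup∘tabulate _ (i ⊕ + t)) (go len len<n)
    where
    i′ = i ⊕ -1ℤ
    position : ∀ s → i ⊕ + s ≡ i′ ⊕ + suc s
    position s = sym (⊕-⊕ i -1ℤ (+ suc s))
    last+1 : ∀ len → (i ⊕ (+ len ℤ.- 1ℤ)) ⊕ 1ℤ ≡ i ⊕ + len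
    last+1 len = trans (⊕-⊕ i (+ len ℤ.- 1ℤ) 1ℤ)
      (cong (i ⊕_) (trans (ℤ.+-assoc (+ len) -1ℤ 1ℤ) (ℤ.+-identityʳ (+ len))))
    ⊖-position : ∀ {s} → s < n → (i ⊕ + s) ⊖ i′ ≡ suc s
    ⊖-position {s} s<n = trans (cong (_⊖ i′) (position s)) (⊖-⊕ i′ s<n)
    go : ∀ len → len < n → does (¬? (i Fin.≟ i ⊕ (+ len ℤ.- 1ℤ) ⊕ 1ℤ) ×-dec
           ((i ⊕ + t) ⊖ i′ ℕ.≤? (i ⊕ (+ len ℤ.- 1ℤ)) ⊖ i′)) ≡ (t <ᵇ len)
    go zero len<n = cong (λ c → not c ∧ does ((i ⊕ + t) ⊖ i′ ℕ.≤? (i ⊕ (0ℤ ℤ.- 1ℤ)) ⊖ i′))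
      (dec-true (i Fin.≟ i ⊕ (0ℤ ℤ.- 1ℤ) ⊕ 1ℤ) (sym (trans (last+1 0) (⊕-identityʳ i))))
    go (suc len) len<n = cong₂ (λ c d → not c ∧ d)
      (dec-false (i Fin.≟ i ⊕ + len ⊕ 1ℤ) λ eq → contradiction
        (⊕-injective i (ℕ.<-trans ℕ.z<s len<n) len<n
          (trans (⊕-identityʳ i) (trans eq (last+1 (suc len))))) λ ())
      (cong₂ (λ x y → does (x ℕ.≤? y)) (⊖-position t<n) (⊖-position (ℕ.<-trans (ℕ.n<1+n len) len<n)))

  ∣∩⟨⟩∣ : ∀ (p : Subset n) {len} → len < n →
          ∣ p ∩ ⟨ i , i ⊕ (+ len ℤ.- 1ℤ) ⟩ ∣ ≡ ∑< (λ t → bit (lookup p (i ⊕ + t))) len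
  ∣∩⟨⟩∣ p {len} len<n = begin
    ∣ p ∩ I ∣
      ≡⟨ ∣∣-sum (p ∩ I) ⟩
    sum (λ z → bit (lookup (p ∩ I) z))
      ≡⟨ sum-cong-≗ (λ z → cong bit (Vec.lookup-zipWith _∧_ z p I)) ⟩
    sum (λ z → bit (lookup p z ∧ lookup I z))
      ≡⟨ sum-cyclic (λ z → bit (lookup p z ∧ lookup I z)) ⟩
    ∑< (λ t → bit (lookup p (i ⊕ + t) ∧ lookup I (i ⊕ + t))) n
      ≡⟨ ∑<-cong n (λ {t} t<n → cong (λ c → bit (lookup p (i ⊕ + t) ∧ c)) (lookup-interval t<n len<n)) ⟩
    ∑< h n
      ≡⟨ cong (∑< h) (sym (ℕ.m+[n∸m]≡n (ℕ.<⇒≤ len<n))) ⟩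
    ∑< h (len + (n ∸ len))
      ≡⟨ ∑<-+ h len (n ∸ len) ⟩
    ∑< h len + ∑< (λ r → h (len + r)) (n ∸ len)
      ≡⟨ cong₂ _+_ (∑<-cong len inside′) (trans (∑<-cong (n ∸ len) (λ {r} _ → outside′ r)) (∑<-zero (n ∸ len))) ⟩
    ∑< (λ t → bit (lookup p (i ⊕ + t))) len + 0
      ≡⟨ ℕ.+-identityʳ _ ⟩
    ∑< (λ t → bit (lookup p (i ⊕ + t))) len ∎
    where
    open ≡-Reasoning
    I = ⟨ i , i ⊕ (+ len ℤ.- 1ℤ) ⟩
    h : ℕ → ℕ
    h t = bit (lookup p (i ⊕ + t) ∧ (t <ᵇ len))
    inside′ : ∀ {t} → t < len → h t ≡ bit (lookup p (i ⊕ + t))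
    inside′ {t} t<len = cong bit (trans (cong (lookup p (i ⊕ + t) ∧_) (dec-true (t ℕ.<? len) t<len)) (Bool.∧-identityʳ _))
    outside′ : ∀ r → h (len + r) ≡ 0
    outside′ r = cong bit (trans (cong (lookup p (i ⊕ + (len + r)) ∧_)
      (dec-false (len + r ℕ.<? len) (ℕ.m+n≮m len r))) (Bool.∧-zeroʳ _))

-- Dyck words

falses : (ℕ → Bool) → ℕ → ℕ
falses f = ∑< (bit ∘ not ∘ f)

-- The letters f 0 , … , f l form a word with true opening and false closing
-- parentheses, in which f 0 and f l match each other.
record Arch (f : ℕ → Bool) (l : ℕ) : Set where
  field
    starts : f 0 ≡ true
    ends   : f l ≡ false
    above  : ∀ {t} → 1 ≤ t → t ≤ l → 2 * falses f t < t
    closed : 2 * falses f (suc l) ≡ suc l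

falses-suc : ∀ f t → falses f (suc t) ≡ falses f t + bit (not (f t))
falses-suc f = ∑<-suc (bit ∘ not ∘ f)

-- The height, the number of opening minus closing parentheses, starts at 1 and changes by one per
-- letter. At the first prefix where it is no longer positive it is therefore exactly 0, and the
-- letter that brought it there closes.
first-return : ∀ f n → f 0 ≡ true → 1 ≤ n → n ≤ 2 * falses f n → ∃ λ l → suc l ≤ n × Arch f l
first-return f n f0 1≤n return with search n
  where
  search : ∀ m → (∀ {t} → 1 ≤ t → t ≤ m → 2 * falses f t < t) ⊎
    ∃ λ l → suc l ≤ m × (∀ {t} → 1 ≤ t → t ≤ l → 2 * falses f t < t) × suc l ≤ 2 * falses f (suc l)
  search zero = inj₁ λ 1≤t t≤0 → contradiction (ℕ.≤-trans 1≤t t≤0) λ ()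
  search (suc m) with search m
  ... | inj₂ (l , l<m , rest) = inj₂ (l , ℕ.m≤n⇒m≤1+n l<m , rest)
  ... | inj₁ above with suc m ℕ.≤? 2 * falses f (suc m)
  ...   | yes ret = inj₂ (m , ℕ.≤-refl , above , ret)
  ...   | no  ¬ret = inj₁ λ {t} 1≤t t≤1+m → extend 1≤t (ℕ.m≤n⇒m<n∨m≡n t≤1+m)
    where
    extend : ∀ {t} → 1 ≤ t → t < suc m ⊎ t ≡ suc m → 2 * falses f t < t
    extend 1≤t (inj₁ t<1+m) = above 1≤t (ℕ.s≤s⁻¹ t<1+m)
    extend 1≤t (inj₂ refl)  = ℕ.≰⇒> ¬ret
... | inj₁ above = contradiction (above 1≤n ℕ.≤-refl) (ℕ.≤⇒≯ return)
... | inj₂ (zero  , _   , _     , ret) = contradiction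
  (subst (1 ≤_) (cong (λ b → 2 * (bit (not b) + 0)) f0) ret) λ ()
... | inj₂ (suc l , l<n , above , ret) = suc l , l<n , record
  { starts = f0 ; ends = proj₁ last ; above = above ; closed = proj₂ last }
  where
  last : f (suc l) ≡ false × 2 * falses f (suc (suc l)) ≡ suc (suc l)
  last with f (suc l) | falses-suc f (suc l)
  ... | true  | eq = contradiction
    (ℕ.≤-trans ret (ℕ.≤-trans (ℕ.≤-reflexive (cong (2 *_) (trans eq (ℕ.+-identityʳ _)))) (ℕ.<⇒≤ (above (ℕ.s≤s ℕ.z≤n) ℕ.≤-refl))))
    (ℕ.<⇒≱ (ℕ.n<1+n _))
  ... | false | eq = refl , ℕ.≤-antisym (begin
    2 * falses f (suc (suc l))  ≡⟨ cong (2 *_) (trans eq (ℕ.+-comm _ 1)) ⟩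
    2 * suc (falses f (suc l))  ≡⟨ ℕ.*-suc 2 _ ⟩
    2 + 2 * falses f (suc l)    ≤⟨ ℕ.s≤s (above (ℕ.s≤s ℕ.z≤n) ℕ.≤-refl) ⟩
    suc (suc l) ∎) ret
    where open ℕ.≤-Reasoning

Arch-cong : ∀ {f g l} → (∀ {t} → t ≤ l → f t ≡ g t) → Arch f l → Arch g l
Arch-cong {f} {g} {l} f≗g A = record
  { starts = trans (sym (f≗g ℕ.z≤n)) starts
  ; ends   = trans (sym (f≗g ℕ.≤-refl)) ends
  ; above  = λ {t} 1≤t t≤l → subst (λ m → 2 * m < t) (falses-cong (ℕ.m≤n⇒m≤1+n t≤l)) (above 1≤t t≤l)
  ; closed = trans (cong (2 *_) (sym (falses-cong ℕ.≤-refl))) closed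
  }
  where
  open Arch A
  falses-cong : ∀ {t} → t ≤ suc l → falses f t ≡ falses g t
  falses-cong {t} t≤1+l = ∑<-cong t λ s<t → cong (bit ∘ not) (f≗g (ℕ.s≤s⁻¹ (ℕ.≤-trans s<t t≤1+l)))

-- A Dyck word read backwards with its parentheses exchanged is a Dyck word: after `t` letters its
-- height is that of the original before its last `t` letters.
Arch-reverse : ∀ {f l} → Arch f l → Arch (λ t → not (f (l ∸ t))) l
Arch-reverse {f} {l} A = record
  { starts = cong not ends
  ; ends   = trans (cong (not ∘ f) (ℕ.n∸n≡0 l)) (cong not starts)
  ; above  = λ {t} 1≤t t≤l → ℕ.+-cancelʳ-< (suc l) (2 * falses g t) t (above′ 1≤t t≤l)
  ; closed = ℕ.+-cancelʳ-≡ (suc l) _ _ (begin-equality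
      2 * falses g (suc l) + suc l              ≡⟨ doubled ℕ.≤-refl ⟩
      2 * suc l + 2 * falses f (suc l ∸ suc l)  ≡⟨ cong (λ m → 2 * suc l + 2 * falses f m) (ℕ.n∸n≡0 l) ⟩
      2 * suc l + 0                             ≡⟨ ℕ.+-identityʳ _ ⟩
      2 * suc l                                 ≡⟨ cong (λ m → suc l + m) (ℕ.+-identityʳ (suc l)) ⟩
      suc l + suc l                             ∎)
  }
  where
  open Arch A
  open ℕ.≤-Reasoning
  g : ℕ → Bool
  g t = not (f (l ∸ t))
  -- The equality of the two heights, written with counts of closing parentheses on both sides so
  -- that no difference of counts appears.
  mirror : ∀ t → t ≤ suc l → falses g t + falses f (suc l) ≡ t + falses f (suc l ∸ t)
  mirror zero    _   = refl
  mirror (suc t) t<l = begin-equality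
    falses g (suc t) + falses f (suc l)
      ≡⟨ cong (_+ falses f (suc l)) (falses-suc g t) ⟩
    falses g t + bit (not (g t)) + falses f (suc l)
      ≡⟨ shuffle (falses g t) (bit (not (g t))) (falses f (suc l)) ⟩
    falses g t + falses f (suc l) + bit (not (g t))
      ≡⟨ cong₂ _+_ (mirror t (ℕ.<⇒≤ t<l)) (cong bit (Bool.not-involutive (f (l ∸ t)))) ⟩
    t + falses f (suc l ∸ t) + bit (f (l ∸ t))
      ≡⟨ cong (λ m → t + falses f m + bit (f (l ∸ t))) (ℕ.+-∸-assoc 1 (ℕ.s≤s⁻¹ t<l)) ⟩
    t + falses f (suc (l ∸ t)) + bit (f (l ∸ t))
      ≡⟨ cong (λ m → t + m + bit (f (l ∸ t))) (falses-suc f (l ∸ t)) ⟩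
    t + (falses f (l ∸ t) + bit (not (f (l ∸ t)))) + bit (f (l ∸ t))
      ≡⟨ regroup t (falses f (l ∸ t)) (bit (not (f (l ∸ t)))) (bit (f (l ∸ t))) ⟩
    t + (falses f (l ∸ t) + (bit (f (l ∸ t)) + bit (not (f (l ∸ t)))))
      ≡⟨ cong (λ m → t + (falses f (l ∸ t) + m)) (bit-not (f (l ∸ t))) ⟩
    t + (falses f (l ∸ t) + 1)
      ≡⟨ move t (falses f (l ∸ t)) ⟩
    suc t + falses f (l ∸ t) ∎
    where
    shuffle : ∀ x y z → x + y + z ≡ x + z + y
    shuffle = ℕ.solve-∀
    regroup : ∀ t x y z → t + (x + y) + z ≡ t + (x + (z + y))
    regroup = ℕ.solve-∀
    move : ∀ t x → t + (x + 1) ≡ suc t + x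
    move = ℕ.solve-∀
  doubled : ∀ {t} → t ≤ suc l → 2 * falses g t + suc l ≡ 2 * t + 2 * falses f (suc l ∸ t)
  doubled {t} t≤1+l = begin-equality
    2 * falses g t + suc l                  ≡⟨ cong (λ m → 2 * falses g t + m) (sym closed) ⟩
    2 * falses g t + 2 * falses f (suc l)   ≡⟨ sym (ℕ.*-distribˡ-+ 2 (falses g t) _) ⟩
    2 * (falses g t + falses f (suc l))     ≡⟨ cong (2 *_) (mirror t t≤1+l) ⟩
    2 * (t + falses f (suc l ∸ t))          ≡⟨ ℕ.*-distribˡ-+ 2 t _ ⟩
    2 * t + 2 * falses f (suc l ∸ t)        ∎
  above′ : ∀ {t} → 1 ≤ t → t ≤ l → 2 * falses g t + suc l < t + suc l
  above′ {t} 1≤t t≤l = begin-strict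
    2 * falses g t + suc l             ≡⟨ doubled (ℕ.m≤n⇒m≤1+n t≤l) ⟩
    2 * t + 2 * falses f (suc l ∸ t)   <⟨ ℕ.+-monoʳ-< (2 * t) (above (ℕ.m<n⇒0<n∸m (ℕ.s≤s t≤l)) (ℕ.∸-monoʳ-≤ (suc l) 1≤t)) ⟩
    2 * t + (suc l ∸ t)                ≡⟨ cong (_+ (suc l ∸ t)) (cong (λ m → t + m) (ℕ.+-identityʳ t)) ⟩
    t + t + (suc l ∸ t)                ≡⟨ ℕ.+-assoc t t _ ⟩
    t + (t + (suc l ∸ t))              ≡⟨ cong (λ m → t + m) (ℕ.m+[n∸m]≡n (ℕ.m≤n⇒m≤1+n t≤l)) ⟩
    t + suc l                          ∎

-- Transpositions and descents in terms of letters

does-∈? : ∀ {n} (x : Fin n) p → does (x ∈? p) ≡ lookup p x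
does-∈? x p with x ∈? p
... | yes x∈ = sym (Vec.[]=⇒lookup x∈)
... | no  x∉ = sym (Bool.¬-not (x∉ ∘ Vec.lookup⇒[]= x p))

module _ {n : ℕ} where

  transpose-x : ∀ (x y : Fin n) → transpose x y x ≡ y
  transpose-x x y rewrite dec-true (x Fin.≟ x) refl = refl

  transpose-y : ∀ (x y : Fin n) → transpose x y y ≡ x
  transpose-y x y with y Fin.≟ x
  ... | yes y≡x = y≡x
  ... | no  _ rewrite dec-true (y Fin.≟ y) refl = refl

  transpose-≢ : ∀ {x y z : Fin n} → z ≢ x → z ≢ y → transpose x y z ≡ z
  transpose-≢ {x} {y} {z} z≢x z≢y
    rewrite dec-false (z Fin.≟ x) z≢x | dec-false (z Fin.≟ y) z≢y = refl

  ⊕-retreat : ∀ (x : Fin n) {m j} → j < m → (x ⊕ + m) ⊕ (-1ℤ ℤ.- + j) ≡ x ⊕ + (m ∸ suc j)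
  ⊕-retreat x {m} {j} j<m = trans (⊕-⊕ x (+ m) (-1ℤ ℤ.- + j))
    (cong (x ⊕_) (trans (cong (λ z → + m ℤ.+ z) (-1-j j)) (ℤ.⊖-≥ j<m)))
    where
    -1-j : ∀ j → -1ℤ ℤ.- + j ≡ ℤ.- + suc j
    -1-j zero    = refl
    -1-j (suc j) = refl

  ⊕-last : ∀ (x : Fin n) → x ⊕ -1ℤ ≡ x ⊕ + (n ∸ 1)
  ⊕-last x = trans (cong (_⊕ -1ℤ) (sym (⊕-period x))) (⊕-retreat x {n} {0} (ℕ.≤-<-trans ℕ.z≤n (Fin.toℕ<n x)))

module _ {a b : ℕ} where

  ∈¹ : ∀ {s : RSYT a b} {x} → word s x ≡ true → x ∈ s ¹
  ∈¹ {s} {x} = Vec.lookup⇒[]= x (s ¹)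

  ∈² : ∀ {s : RSYT a b} {x} → word s x ≡ false → x ∈ s ²
  ∈² {s} {x} eq = Vec.lookup⇒[]= x (s ²) (trans (row₂-word s x) (cong not eq))

  lookup-des : ∀ (s : RSYT a b) i → lookup (des s) i ≡ word s i ∧ not (word s (i ⊕ 1ℤ))
  lookup-des s i = trans (Vec.lookup∘tabulate (λ i → does (i ∈? s ¹ ×-dec (i ⊕ 1ℤ) ∈? s ²)) i)
    (cong₂ _∧_ (does-∈? i (s ¹)) (trans (does-∈? (i ⊕ 1ℤ) (s ²)) (row₂-word s (i ⊕ 1ℤ))))

  ∈-des⁺ : ∀ {s : RSYT a b} {i} → word s i ≡ true → word s (i ⊕ 1ℤ) ≡ false → i ∈ des s
  ∈-des⁺ {s} {i} eq eq′ = Vec.lookup⇒[]= i (des s)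
    (trans (lookup-des s i) (cong₂ (λ c d → c ∧ not d) eq eq′))

  ∈-des⁻ : ∀ {s : RSYT a b} {i} → i ∈ des s → word s i ≡ true × word s (i ⊕ 1ℤ) ≡ false
  ∈-des⁻ {s} {i} i∈ = go (word s i) (word s (i ⊕ 1ℤ)) (trans (sym (lookup-des s i)) (Vec.[]=⇒lookup i∈))
    where
    go : ∀ c d → c ∧ not d ≡ true → c ≡ true × d ≡ false
    go true false _ = refl , refl

-- Arcs of the second kind from matched parentheses

arch-odd : ∀ {f l} → Arch f l → ∃ λ h → l ≡ suc (2 * h)
arch-odd {f} {l} A = go (falses f (suc l)) (Arch.closed A)
  where
  go : ∀ m → 2 * m ≡ suc l → ∃ λ h → l ≡ suc (2 * h)
  go (suc h) eq = h , ℕ.suc-injective (trans (sym eq) (ℕ.*-suc 2 h))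

module NonemptyArch {f g} (A : Arch f (suc (2 * suc g))) where
  open Arch A

  -- The outer pair encloses `suc g` pairs, so it may not close at the second letter; dually the
  -- letter before the last has to close.
  second : f 1 ≡ true
  second with f 1 | above {2} (ℕ.s≤s ℕ.z≤n) (ℕ.s≤s (subst (1 ≤_) (sym (ℕ.*-suc 2 g)) (ℕ.s≤s ℕ.z≤n)))
  ... | true  | _  = refl
  ... | false | lt = contradiction lt (ℕ.≤⇒≯ (ℕ.*-monoʳ-≤ 2 (ℕ.m≤n+m 1 (bit (not (f 0))))))

  private
    l-falses : falses f (suc (2 * suc g)) ≡ suc g
    l-falses = ℕ.suc-injective (ℕ.*-cancelˡ-≡ _ (suc (suc g)) 2 (begin
      2 * suc (falses f l)          ≡⟨ cong (2 *_) (sym (trans (falses-suc f l) (trans (cong (λ c → falses f l + bit (not c)) ends) (ℕ.+-comm _ 1)))) ⟩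
      2 * falses f (suc l)          ≡⟨ closed ⟩
      2 + 2 * suc g                 ≡⟨ sym (ℕ.*-suc 2 (suc g)) ⟩
      2 * suc (suc g)               ∎))
      where
      open ≡-Reasoning
      l = suc (2 * suc g)

    below : falses f (2 * suc g) ≤ g
    below = ℕ.s≤s⁻¹ (ℕ.*-cancelˡ-< 2 _ (suc g) (above (subst (1 ≤_) (sym (ℕ.*-suc 2 g)) (ℕ.s≤s ℕ.z≤n)) (ℕ.n≤1+n _)))

  penultimate : f (2 * suc g) ≡ false × falses f (2 * suc g) ≡ g
  penultimate with f (2 * suc g) | trans (sym l-falses) (falses-suc f (2 * suc g))
  ... | false | eq = refl , ℕ.suc-injective (sym (trans eq (ℕ.+-comm _ 1)))
  ... | true  | eq = contradiction below (ℕ.<⇒≱ (ℕ.≤-reflexive (trans eq (ℕ.+-identityʳ _))))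

  below-at : ∀ m → m ≤ g → falses f (2 * suc m) ≤ m
  below-at m m≤g = ℕ.s≤s⁻¹ (ℕ.*-cancelˡ-< 2 _ (suc m)
    (above (subst (1 ≤_) (sym (ℕ.*-suc 2 m)) (ℕ.s≤s ℕ.z≤n)) (ℕ.m≤n⇒m≤1+n (ℕ.*-monoʳ-≤ 2 (ℕ.s≤s m≤g)))))

module _ {a b : ℕ} (v : RSYT a b) (x : Fin (a + b)) where

  private
    f : ℕ → Bool
    f t = word v (x ⊕ + t)

  module _ (h : ℕ) (l+1<n : suc (suc (2 * h)) < a + b) (A : Arch f (suc (2 * h))) where
    open Arch A

    private
      l : ℕ
      l = suc (2 * h)

      y : Fin (a + b)
      y = x ⊕ + l

      u : RSYT a b
      u = proj₁ (swap y x v)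

      u-word : ∀ z → word u z ≡ word v (transpose y x z)
      u-word = proj₂ (swap y x v)

      x≡ : x ⊕ + 0 ≡ x
      x≡ = ⊕-identityʳ x

      u-x : word u x ≡ false
      u-x = trans (u-word x) (trans (cong (word v) (transpose-y y x)) ends)

      u-y : word u y ≡ true
      u-y = trans (u-word y) (trans (cong (word v) (trans (transpose-x y x) (sym x≡))) starts)

      u-inner : ∀ {t} → t < a + b → t ≢ 0 → t ≢ l → word u (x ⊕ + t) ≡ f t
      u-inner {t} t<n t≢0 t≢l = trans (u-word (x ⊕ + t)) (cong (word v) (transpose-≢
        (λ eq → t≢l (⊕-injective x t<n (ℕ.<-trans (ℕ.n<1+n l) l+1<n) eq))
        (λ eq → t≢0 (⊕-injective x t<n (ℕ.<-trans ℕ.z<s l+1<n) (trans eq (sym x≡))))))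

      y⊖x : y ⊖ x ≡ l
      y⊖x = ⊖-⊕ x (ℕ.<-trans (ℕ.n<1+n _) (ℕ.<-trans (ℕ.n<1+n l) l+1<n))

      y+1 : y ⊕ 1ℤ ≡ x ⊕ + suc l
      y+1 = trans (⊕-⊕ x (+ l) 1ℤ) (cong (λ m → x ⊕ + m) (ℕ.+-comm l 1))

      y-1 : y ⊕ -1ℤ ≡ x ⊕ + (2 * h)
      y-1 = ⊕-⊕ x (+ l) -1ℤ

      half≡ : (y ⊖ x ∸ 3) / 2 ≡ h ∸ 1
      half≡ = trans (cong (λ m → (m ∸ 3) / 2) y⊖x) (go h)
        where
        go : ∀ h → (suc (2 * h) ∸ 3) / 2 ≡ h ∸ 1
        go zero    = refl
        go (suc g) = trans (cong (λ m → (suc m ∸ 3) / 2) (ℕ.*-suc 2 g))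
                           (trans (cong (_/ 2) (ℕ.*-comm 2 g)) (m*n/n≡m g 2))

    -- The source arises from `v` by exchanging the two outer parentheses of the arch. The letters
    -- strictly between them agree in `u` and `v`, so the counting conditions on `u` follow from the
    -- heights inside the arch.
    arch-arc : word v (x ⊕ -1ℤ) ≡ true ⊎ word v (x ⊕ + suc l) ≡ false →
      ∃ λ u → SecondKindAt x y u v × (∀ z → word u z ≡ word v (transpose y x z))
    arch-arc outer = u , record
      { i∈s²        = ∈² {s = u} u-x
      ; j∈s¹        = ∈¹ {s = u} u-y
      ; interchange = word⇒interchange {s = u} {t = v} λ z →
          sym (trans (u-word (transpose x y z)) (cong (word v) (transpose-inverse y x {z})))
      ; i≢j+1       = λ eq → contradiction
          (⊕-injective x (ℕ.<-trans ℕ.z<s l+1<n) l+1<n (trans x≡ (trans eq y+1))) λ ()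
      ; odd         = trans (cong (_% 2) (trans y⊖x (cong suc (ℕ.*-comm 2 h)))) ([m+kn]%n≡m%n 1 h 2)
      ; i+1∈s¹      = ∈¹ {s = u} (next h refl)
      ; j-1∈s²      = ∈² {s = u} (trans (cong (word u) y-1) (previous h refl))
      ; outer       = outer′ outer
      ; dominance   = λ k′ → dominance h refl (suc (toℕ k′))
          (subst (suc (toℕ k′) ≤_) half≡ (Fin.toℕ<n k′))
      ; balance     = λ y≢x+1 → trans (balance h refl y≢x+1) (sym half≡)
      } , u-word
      where
      n = a + b

      -- Here and below `h′` is a copy of the module parameter `h` that can be split into cases: for
      -- `h = 0` the neighbour of `x` is `y` itself, otherwise it lies inside the arch.
      next : ∀ h′ → h′ ≡ h → word u (x ⊕ 1ℤ) ≡ true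
      next zero    refl = u-y
      next (suc g) refl = trans
        (u-inner (ℕ.<-trans (ℕ.s≤s ℕ.z<s) l+1<n) (λ ()) (λ ()))
        (NonemptyArch.second A)

      previous : ∀ h′ → h′ ≡ h → word u (x ⊕ + (2 * h)) ≡ false
      previous zero    refl = trans (cong (word u) x≡) u-x
      previous (suc g) refl = trans
        (u-inner (ℕ.<-trans (ℕ.n<1+n _) (ℕ.<-trans (ℕ.n<1+n l) l+1<n)) (λ ()) (ℕ.<⇒≢ (ℕ.n<1+n _)))
        (proj₁ (NonemptyArch.penultimate A))

      u-last : word u (x ⊕ -1ℤ) ≡ word v (x ⊕ -1ℤ)
      u-last = trans (cong (word u) (⊕-last x)) (trans (u-inner (ℕ.∸-monoʳ-< ℕ.z<s 0<n) n-1≢0 n-1≢l)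
        (cong (word v) (sym (⊕-last x))))
        where
        0<n : 0 < n
        0<n = ℕ.<-trans ℕ.z<s l+1<n
        l<n-1 : l < n ∸ 1
        l<n-1 = ℕ.∸-monoˡ-≤ 1 l+1<n
        n-1≢0 : n ∸ 1 ≢ 0
        n-1≢0 eq = contradiction (subst (l <_) eq l<n-1) λ ()
        n-1≢l : n ∸ 1 ≢ l
        n-1≢l = ℕ.>⇒≢ l<n-1

      outer′ : word v (x ⊕ -1ℤ) ≡ true ⊎ word v (x ⊕ + suc l) ≡ false →
               (x ⊕ -1ℤ) ∈ u ¹ ⊎ (y ⊕ 1ℤ) ∈ u ²
      outer′ (inj₁ eq) = inj₁ (∈¹ {s = u} (trans u-last eq))
      outer′ (inj₂ eq) = inj₂ (∈² {s = u} (trans (cong (word u) y+1)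
        (trans (u-inner l+1<n (λ ()) (ℕ.>⇒≢ (ℕ.n<1+n l))) eq)))

      module _ {g} (g+1≡h : suc g ≡ h) {k} (k≤g : k ≤ g) where
        c = 2 * (suc g ∸ k)

        c+2k : c + 2 * k ≡ 2 * h
        c+2k = trans (sym (ℕ.*-distribˡ-+ 2 (suc g ∸ k) k))
          (cong (2 *_) (trans (ℕ.m∸n+n≡m (ℕ.m≤n⇒m≤1+n k≤g)) g+1≡h))

        1<c : 1 < c
        1<c = ℕ.*-monoʳ-≤ 2 (ℕ.m<n⇒0<n∸m (ℕ.s≤s k≤g))

        interval-end : y ⊕ (ℤ.- + 2) ≡ (x ⊕ + c) ⊕ (+ (2 * k) ℤ.- 1ℤ)
        interval-end = begin
          y ⊕ (ℤ.- + 2)                         ≡⟨ ⊕-retreat x {l} {1} (ℕ.s≤s (subst (1 ≤_) c+2k (ℕ.≤-trans (ℕ.<⇒≤ 1<c) (ℕ.m≤m+n c _)))) ⟩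
          x ⊕ + (2 * h ∸ 1)                     ≡⟨ cong (λ m → x ⊕ + (m ∸ 1)) (sym c+2k) ⟩
          x ⊕ + (c + 2 * k ∸ 1)                 ≡⟨ sym (⊕-retreat x {c + 2 * k} {0} (ℕ.≤-trans (ℕ.<⇒≤ 1<c) (ℕ.m≤m+n c _))) ⟩
          (x ⊕ + (c + 2 * k)) ⊕ -1ℤ             ≡⟨ ⊕-⊕ x (+ (c + 2 * k)) -1ℤ ⟩
          x ⊕ (+ (c + 2 * k) ℤ.+ -1ℤ)           ≡⟨ cong (x ⊕_) (ℤ.+-assoc (+ c) (+ (2 * k)) -1ℤ) ⟩
          x ⊕ (+ c ℤ.+ (+ (2 * k) ℤ.- 1ℤ))      ≡⟨ sym (⊕-⊕ x (+ c) (+ (2 * k) ℤ.- 1ℤ)) ⟩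
          (x ⊕ + c) ⊕ (+ (2 * k) ℤ.- 1ℤ)        ∎
          where open ≡-Reasoning

        c+2k<l : c + 2 * k < l
        c+2k<l = ℕ.s≤s (ℕ.≤-reflexive c+2k)

        u²-inner : ∀ {t} → t < 2 * k →
          bit (lookup (u ²) ((x ⊕ + c) ⊕ + t)) ≡ bit (not (f (c + t)))
        u²-inner {t} t<2k = cong bit (trans (row₂-word u _) (cong not
          (trans (cong (word u) (⊕-⊕ x (+ c) (+ t))) (u-inner
            (ℕ.<-trans c+t<l (ℕ.<-trans (ℕ.n<1+n l) l+1<n))
            (ℕ.>⇒≢ (ℕ.≤-trans (ℕ.<⇒≤ 1<c) (ℕ.m≤m+n c t)))
            (ℕ.<⇒≢ c+t<l)))))
          where
          c+t<l : c + t < l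
          c+t<l = ℕ.<-trans (ℕ.+-monoʳ-< c t<2k) c+2k<l

        -- With `k = g` this block starts at `x ⊕ + 2` and serves `balance`; general `k` serves
        -- `dominance`.
        block : ∣ u ² ∩ ⟨ x ⊕ + c , y ⊕ (ℤ.- + 2) ⟩ ∣ + falses f c ≡ falses f (2 * h)
        block = begin
          ∣ u ² ∩ ⟨ x ⊕ + c , y ⊕ (ℤ.- + 2) ⟩ ∣ + falses f c
            ≡⟨ cong (λ z → ∣ u ² ∩ ⟨ x ⊕ + c , z ⟩ ∣ + falses f c) interval-end ⟩
          ∣ u ² ∩ ⟨ x ⊕ + c , (x ⊕ + c) ⊕ (+ (2 * k) ℤ.- 1ℤ) ⟩ ∣ + falses f c
            ≡⟨ cong (_+ falses f c) (∣∩⟨⟩∣ (x ⊕ + c) (u ²)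
                 (ℕ.≤-<-trans (ℕ.m≤n+m _ c) (ℕ.<-trans c+2k<l (ℕ.<-trans (ℕ.n<1+n l) l+1<n)))) ⟩
          ∑< (λ t → bit (lookup (u ²) ((x ⊕ + c) ⊕ + t))) (2 * k) + falses f c
            ≡⟨ cong (_+ falses f c) (∑<-cong (2 * k) u²-inner) ⟩
          ∑< (λ t → bit (not (f (c + t)))) (2 * k) + falses f c
            ≡⟨ ℕ.+-comm _ (falses f c) ⟩
          falses f c + ∑< (λ t → bit (not (f (c + t)))) (2 * k)
            ≡⟨ sym (∑<-+ (bit ∘ not ∘ f) c (2 * k)) ⟩
          falses f (c + 2 * k)
            ≡⟨ cong (falses f) c+2k ⟩
          falses f (2 * h) ∎
          where open ≡-Reasoning

      -- The first `2 * h` letters contain `g` closing parentheses, and by positivity of the height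
      -- at most `g ∸ k` of them lie before the block. Hence at least `k` lie in it.
      dominance : ∀ h′ → h′ ≡ h → ∀ k → k ≤ h ∸ 1 →
        k ≤ ∣ u ² ∩ ⟨ y ⊕ (-1ℤ ℤ.- + (2 * k)) , y ⊕ (ℤ.- + 2) ⟩ ∣
      dominance zero    refl zero k≤0 = ℕ.z≤n
      dominance (suc g) refl k k≤g = ℕ.+-cancelʳ-≤ (g ∸ k) _ _ (begin
        k + (g ∸ k)                     ≡⟨ ℕ.m+[n∸m]≡n k≤g ⟩
        g                               ≡⟨ sym (proj₂ (NonemptyArch.penultimate A)) ⟩
        falses f (2 * h)                ≡⟨ sym (block refl k≤g) ⟩
        ∣ u ² ∩ ⟨ x ⊕ + (2 * (suc g ∸ k)) , y ⊕ (ℤ.- + 2) ⟩ ∣ + falses f (2 * (suc g ∸ k))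
          ≡⟨ cong₂ (λ z m → ∣ u ² ∩ ⟨ z , y ⊕ (ℤ.- + 2) ⟩ ∣ + falses f (2 * m)) interval-start (ℕ.+-∸-assoc 1 k≤g) ⟩
        ∣ u ² ∩ ⟨ y ⊕ (-1ℤ ℤ.- + (2 * k)) , y ⊕ (ℤ.- + 2) ⟩ ∣ + falses f (2 * suc (g ∸ k))
          ≤⟨ ℕ.+-monoʳ-≤ _ (NonemptyArch.below-at A (g ∸ k) (ℕ.m∸n≤m g k)) ⟩
        ∣ u ² ∩ ⟨ y ⊕ (-1ℤ ℤ.- + (2 * k)) , y ⊕ (ℤ.- + 2) ⟩ ∣ + (g ∸ k) ∎)
        where
        open ℕ.≤-Reasoning
        interval-start : x ⊕ + (2 * (suc g ∸ k)) ≡ y ⊕ (-1ℤ ℤ.- + (2 * k))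
        interval-start = sym (trans (⊕-retreat x {l} {2 * k} (ℕ.s≤s (ℕ.*-monoʳ-≤ 2 (ℕ.m≤n⇒m≤1+n k≤g))))
          (cong (λ m → x ⊕ + m) (sym (ℕ.*-distribˡ-∸ 2 (suc g) k))))

      balance : ∀ h′ → h′ ≡ h → y ≢ x ⊕ 1ℤ → ∣ u ² ∩ ⟨ x ⊕ + 2 , y ⊕ (ℤ.- + 2) ⟩ ∣ ≡ h ∸ 1
      balance zero    refl y≢x+1 = contradiction refl y≢x+1
      balance (suc g) refl _ = begin
        ∣ u ² ∩ ⟨ x ⊕ + 2 , y ⊕ (ℤ.- + 2) ⟩ ∣
          ≡⟨ sym (ℕ.+-identityʳ _) ⟩
        ∣ u ² ∩ ⟨ x ⊕ + 2 , y ⊕ (ℤ.- + 2) ⟩ ∣ + 0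
          ≡⟨ cong₂ (λ m r → ∣ u ² ∩ ⟨ x ⊕ + (2 * m) , y ⊕ (ℤ.- + 2) ⟩ ∣ + r)
               (sym (ℕ.m+n∸n≡m 1 g)) (sym falses-2) ⟩
        ∣ u ² ∩ ⟨ x ⊕ + (2 * (suc g ∸ g)) , y ⊕ (ℤ.- + 2) ⟩ ∣ + falses f (2 * (suc g ∸ g))
          ≡⟨ block refl ℕ.≤-refl ⟩
        falses f (2 * h)
          ≡⟨ proj₂ (NonemptyArch.penultimate A) ⟩
        g ∎
        where
        open ≡-Reasoning
        falses-2 : falses f (2 * (suc g ∸ g)) ≡ 0
        falses-2 = ℕ.n≤0⇒n≡0 (subst (λ m → falses f (2 * m) ≤ 0) (sym (ℕ.m+n∸n≡m 1 g))
          (NonemptyArch.below-at A 0 ℕ.z≤n))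

-- Existence of an arc into `v` from a source with descent `i`

transpose-comm : ∀ {n} (x y z : Fin n) → transpose x y z ≡ transpose y x z
transpose-comm x y z = go (z Fin.≟ x) (z Fin.≟ y)
  where
  go : Dec (z ≡ x) → Dec (z ≡ y) → transpose x y z ≡ transpose y x z
  go (yes z≡x) _         = trans (cong (transpose x y) z≡x) (trans (transpose-x x y)
    (sym (trans (cong (transpose y x) z≡x) (transpose-y y x))))
  go (no _)    (yes z≡y) = trans (cong (transpose x y) z≡y) (trans (transpose-y x y)
    (sym (trans (cong (transpose y x) z≡y) (transpose-x y x))))
  go (no z≢x)  (no z≢y)  = trans (transpose-≢ z≢x z≢y) (sym (transpose-≢ z≢y z≢x))

∑<-reverse : ∀ h m → ∑< h (suc m) ≡ ∑< (λ t → h (m ∸ t)) (suc m)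
∑<-reverse h zero    = refl
∑<-reverse h (suc m) = trans (∑<-suc h (suc m))
  (trans (ℕ.+-comm _ (h (suc m))) (cong (λ r → h (suc m) + r) (∑<-reverse h m)))

∸-∸ : ∀ m {l t} → l ≤ m → t ≤ l → m ∸ (l ∸ t) ≡ m ∸ l + t
∸-∸ m {l} {t} l≤m t≤l = trans (cong (_∸ (l ∸ t)) (sym split)) (ℕ.m+n∸n≡m (m ∸ l + t) (l ∸ t))
  where
  split : m ∸ l + t + (l ∸ t) ≡ m
  split = trans (ℕ.+-assoc (m ∸ l) t (l ∸ t))
    (trans (cong (λ r → m ∸ l + r) (ℕ.m+[n∸m]≡n t≤l)) (ℕ.m∸n+n≡m l≤m))

module _ {a b : ℕ} where

  Arc : RSYT a b → RSYT a b → Set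
  Arc s t = FirstKind s t ⊎ SecondKind s t

  word-surjective : ∀ {s t : RSYT a b} i → (∀ {r} → r < a + b → word s (i ⊕ + r) ≡ word t (i ⊕ + r)) → s ≡ t
  word-surjective {s} {t} i eq = word-injective λ z → go z (⊕-surjective i z)
    where
    go : ∀ z → (∃ λ r → r < a + b × i ⊕ + r ≡ z) → word s z ≡ word t z
    go z (r , r<n , refl) = eq r<n

  swap-first-kind : ∀ {s t : RSYT a b} x → word s x ≡ true → word s (x ⊕ 1ℤ) ≡ false →
    (∀ z → word t z ≡ word s (transpose x (x ⊕ 1ℤ) z)) → FirstKind s t
  swap-first-kind {s} {t} x eq eq′ t≡ = x , ∈¹ {s = s} eq , ∈² {s = s} eq′ , word⇒interchange {s = s} {t = t} t≡

  -- From `s` to `t` the arc is of the first kind. Backwards it is of the second kind with adjacent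
  -- positions, coming from the arch of just two letters, and `outer` is the outer condition of that
  -- arc.
  knuth-arcs : ∀ {s t : RSYT a b} x → 2 < a + b → word s x ≡ true → word s (x ⊕ 1ℤ) ≡ false →
    word s (x ⊕ -1ℤ) ≡ true ⊎ word s (x ⊕ + 2) ≡ false →
    (∀ z → word t z ≡ word s (transpose (x ⊕ 1ℤ) x z)) → Arc s t × Arc t s
  knuth-arcs {s} {t} x 2<n eq eq′ outer t≡ =
    inj₁ (swap-first-kind {s} {t} x eq eq′ λ z → trans (t≡ z) (cong (word s) (transpose-comm (x ⊕ 1ℤ) x z))) ,
    inj₂ (back (arch-arc s x 0 2<n arch outer))
    where
    back : (∃ λ u → SecondKindAt x (x ⊕ 1ℤ) u s × (∀ z → word u z ≡ word s (transpose (x ⊕ 1ℤ) x z))) →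
           SecondKind t s
    back (u , arc , u≡) = x , x ⊕ 1ℤ ,
      subst (λ u → SecondKindAt x (x ⊕ 1ℤ) u s) (word-injective λ z → trans (u≡ z) (sym (t≡ z))) arc
    start : word s (x ⊕ 0ℤ) ≡ true
    start = trans (cong (word s) (⊕-identityʳ x)) eq
    f = λ t → word s (x ⊕ + t)
    arch : Arch f 1
    arch = record
      { starts = start
      ; ends   = eq′
      ; above  = λ where (ℕ.s≤s ℕ.z≤n) (ℕ.s≤s ℕ.z≤n) → ℕ.≤-reflexive (cong (λ c → suc (2 * (bit (not c) + 0))) start)
      ; closed = cong₂ (λ c d → 2 * (bit (not c) + (bit (not d) + 0))) start eq′
      }

module _ {a : ℕ} where

  private
    n = a + a

  word-falses : ∀ (s : RSYT a a) i → falses (λ t → word s (i ⊕ + t)) n ≡ a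
  word-falses s i = trans (sym (sum-cyclic i (bit ∘ not ∘ word s))) (∑-not-word s)

  word-trues : ∀ (s : RSYT a a) i → ∑< (λ t → bit (word s (i ⊕ + t))) n ≡ a
  word-trues s i = trans (sym (sum-cyclic i (bit ∘ word s))) (∑-word s)

  arc-into-arch : ∀ (v : RSYT a a) x {l} → suc l < n → Arch (λ t → word v (x ⊕ + t)) l →
    word v (x ⊕ -1ℤ) ≡ true ⊎ word v (x ⊕ + suc l) ≡ false →
    ∃ λ u → Arc u v × (∀ z → word u z ≡ word v (transpose (x ⊕ + l) x z))
  arc-into-arch v x l+1<n arch outer = go (arch-odd arch) l+1<n arch outer
    where
    go : ∀ {l} → (∃ λ h → l ≡ suc (2 * h)) → suc l < n → Arch (λ t → word v (x ⊕ + t)) l →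
      word v (x ⊕ -1ℤ) ≡ true ⊎ word v (x ⊕ + suc l) ≡ false →
      ∃ λ u → Arc u v × (∀ z → word u z ≡ word v (transpose (x ⊕ + l) x z))
    go (h , refl) l+1<n arch outer =
      map₂ (λ (arc , u≡) → inj₂ (x , x ⊕ + suc (2 * h) , arc) , u≡) (arch-arc v x h l+1<n arch outer)

  module _ (1<n : 1 < n) (v : RSYT a a) (i : Fin n) where

    private
      0<n : 0 < n
      0<n = ℕ.<-trans ℕ.z<s 1<n

      suc-pred-n : suc (n ∸ 1) ≡ n
      suc-pred-n = ℕ.m+[n∸m]≡n 0<n

      x = i ⊕ 1ℤ

      i+1-1 : x ⊕ -1ℤ ≡ i
      i+1-1 = trans (⊕-⊕ i 1ℤ -1ℤ) (⊕-identityʳ i)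

      x+n-1 : x ⊕ + (n ∸ 1) ≡ i
      x+n-1 = trans (sym (⊕-last x)) i+1-1

      -- A final + leaves all `a` letters - among the first `n ∸ 1`, so the matching parenthesis is
      -- found before the word closes up at its last letter.
      enough-falses : ∀ f → falses f n ≡ a → f (n ∸ 1) ≡ true → n ∸ 1 ≤ 2 * falses f (n ∸ 1)
      enough-falses f total last = begin
        n ∸ 1                   ≤⟨ ℕ.m∸n≤m n 1 ⟩
        a + a                   ≡⟨ cong (λ m → a + m) (sym (ℕ.+-identityʳ a)) ⟩
        2 * a                   ≡⟨ cong (2 *_) (sym total) ⟩
        2 * falses f n          ≡⟨ cong (λ m → 2 * falses f m) (sym suc-pred-n) ⟩
        2 * falses f (suc (n ∸ 1)) ≡⟨ cong (2 *_) (trans (falses-suc f (n ∸ 1))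
          (trans (cong (λ c → falses f (n ∸ 1) + bit (not c)) last) (ℕ.+-identityʳ _))) ⟩
        2 * falses f (n ∸ 1)    ∎
        where open ℕ.≤-Reasoning

    -- The + at i + 1 is exchanged with the - matching it. This puts a - at i + 1, while the + at i
    -- stays: together they form the descent, and the + at i is also the outer condition of the arc.
    arc-into-plus : word v i ≡ true → word v (i ⊕ 1ℤ) ≡ true → ∃ λ u → i ∈ des u × Arc u v
    arc-into-plus eq eq′ = conclude (first-return f (n ∸ 1)
        (trans (cong (word v) (⊕-identityʳ x)) eq′) (ℕ.∸-monoˡ-≤ 1 1<n)
        (enough-falses f (word-falses v x) (trans (cong (word v) x+n-1) eq)))
      where
      f : ℕ → Bool
      f t = word v (x ⊕ + t)
      conclude : (∃ λ l → suc l ≤ n ∸ 1 × Arch f l) → ∃ λ u → i ∈ des u × Arc u v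
      conclude (l , l<n-1 , arch) = u , ∈-des⁺ {s = u} u-i u-x , proj₁ (proj₂ into)
        where
        into = arc-into-arch v x
          (ℕ.≤-trans (ℕ.s≤s l<n-1) (ℕ.≤-reflexive suc-pred-n)) arch
          (inj₁ (trans (cong (word v) i+1-1) eq))
        u = proj₁ into
        u≡ = proj₂ (proj₂ into)
        n-1<n : n ∸ 1 < n
        n-1<n = ℕ.≤-reflexive suc-pred-n
        i≢y : i ≢ x ⊕ + l
        i≢y i≡y = ℕ.<⇒≢ l<n-1 (sym (⊕-injective x n-1<n (ℕ.<-trans l<n-1 n-1<n) (trans x+n-1 i≡y)))
        i≢x : i ≢ x
        i≢x i≡x = ℕ.<⇒≢ (ℕ.≤-<-trans ℕ.z≤n l<n-1)
          (sym (⊕-injective x n-1<n 0<n (trans x+n-1 (trans i≡x (sym (⊕-identityʳ x))))))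
        u-i : word u i ≡ true
        u-i = trans (u≡ i) (trans (cong (word v) (transpose-≢ i≢y i≢x)) eq)
        u-x : word u x ≡ false
        u-x = trans (u≡ x) (trans (cong (word v) (transpose-y (x ⊕ + l) x)) (Arch.ends arch))

    -- The mirror image: the - at i is exchanged with the + matching it, found by reading backwards
    -- from i with the letters complemented. The - at i + 1 is the outer condition.
    arc-into-minus : word v i ≡ false → word v (i ⊕ 1ℤ) ≡ false → ∃ λ u → i ∈ des u × Arc u v
    arc-into-minus eq eq′ = conclude (first-return g (n ∸ 1)
        (cong not (trans (cong (word v) x+n-1) eq)) (ℕ.∸-monoˡ-≤ 1 1<n)
        (enough-falses g total (cong not (trans (cong f (ℕ.n∸n≡0 (n ∸ 1))) (trans (cong (word v) (⊕-identityʳ x)) eq′)))))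
      where
      f g : ℕ → Bool
      f t = word v (x ⊕ + t)
      g t = not (f (n ∸ 1 ∸ t))
      total : falses g n ≡ a
      total = begin
        falses g n                                        ≡⟨ ∑<-cong n (λ {t} _ → cong bit (Bool.not-involutive (f (n ∸ 1 ∸ t)))) ⟩
        ∑< (λ t → bit (f (n ∸ 1 ∸ t))) n                   ≡⟨ cong (∑< _) (sym suc-pred-n) ⟩
        ∑< (λ t → bit (f (n ∸ 1 ∸ t))) (suc (n ∸ 1))       ≡⟨ sym (∑<-reverse (bit ∘ f) (n ∸ 1)) ⟩
        ∑< (bit ∘ f) (suc (n ∸ 1))                         ≡⟨ cong (∑< (bit ∘ f)) suc-pred-n ⟩
        ∑< (bit ∘ f) n                                     ≡⟨ word-trues v x ⟩
        a ∎
        where open ≡-Reasoning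
      y≡i : ∀ {l} → suc l ≤ n ∸ 1 → (x ⊕ + (n ∸ 1 ∸ l)) ⊕ + l ≡ i
      y≡i {l} l<n-1 = trans (⊕-⊕ x (+ (n ∸ 1 ∸ l)) (+ l))
        (trans (cong (λ m → x ⊕ + m) (ℕ.m∸n+n≡m (ℕ.<⇒≤ l<n-1))) x+n-1)
      y+1 : ∀ {l} → suc l ≤ n ∸ 1 → (x ⊕ + (n ∸ 1 ∸ l)) ⊕ + suc l ≡ x
      y+1 {l} l<n-1 = trans (cong (λ m → (x ⊕ + (n ∸ 1 ∸ l)) ⊕ + m) (ℕ.+-comm 1 l))
        (trans (sym (⊕-⊕ (x ⊕ + (n ∸ 1 ∸ l)) (+ l) 1ℤ)) (cong (_⊕ 1ℤ) (y≡i l<n-1)))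
      conclude : (∃ λ l → suc l ≤ n ∸ 1 × Arch g l) → ∃ λ u → i ∈ des u × Arc u v
      conclude (l , l<n-1 , arch) = u , ∈-des⁺ {s = u} u-i u-i+1 , proj₁ (proj₂ into)
        where
        into = arc-into-arch v (x ⊕ + (n ∸ 1 ∸ l))
          (ℕ.≤-trans (ℕ.s≤s l<n-1) (ℕ.≤-reflexive suc-pred-n))
          (Arch-cong (λ {t} t≤l → trans (Bool.not-involutive _) (cong (word v) (trans
              (cong (λ m → x ⊕ + m) (∸-∸ (n ∸ 1) (ℕ.<⇒≤ l<n-1) t≤l))
              (sym (⊕-⊕ x (+ (n ∸ 1 ∸ l)) (+ t))))))
            (Arch-reverse arch))
          (inj₂ (trans (cong (word v) (y+1 l<n-1)) eq′))
        u = proj₁ into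
        u≡ = proj₂ (proj₂ into)
        z = x ⊕ + (n ∸ 1 ∸ l)
        l+1<n : suc l < n
        l+1<n = ℕ.≤-trans (ℕ.s≤s l<n-1) (ℕ.≤-reflexive suc-pred-n)
        u-i : word u i ≡ true
        u-i = trans (u≡ i) (trans (cong (word v) (trans (cong (transpose (z ⊕ + l) z) (sym (y≡i l<n-1))) (transpose-x (z ⊕ + l) z)))
          (trans (sym (Bool.not-involutive (word v z))) (cong not (Arch.ends arch))))
        u-i+1 : word u x ≡ false
        u-i+1 = trans (u≡ x) (trans (cong (word v) (transpose-≢
          (λ x≡y → ℕ.1+n≢n (⊕-injective z l+1<n (ℕ.<-trans (ℕ.n<1+n l) l+1<n) (trans (y+1 l<n-1) x≡y)))
          (λ x≡z → contradiction (⊕-injective z l+1<n 0<n (trans (y+1 l<n-1) (trans x≡z (sym (⊕-identityʳ z))))) λ ()))) eq′)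

  arc-into : 1 < n → ∀ (v : RSYT a a) i → i ∉ des v → ∃ λ u → i ∈ des u × Arc u v
  arc-into 1<n v i i∉ = go (word v i) (word v j) refl refl
    where
    j = i ⊕ 1ℤ
    u = proj₁ (swap i j v)
    u≡ : ∀ z → word u z ≡ word v (transpose i j z)
    u≡ = proj₂ (swap i j v)
    go : ∀ c d → word v i ≡ c → word v j ≡ d → ∃ λ u → i ∈ des u × Arc u v
    go true  true  eq eq′ = arc-into-plus 1<n v i eq eq′
    go false false eq eq′ = arc-into-minus 1<n v i eq eq′
    go true  false eq eq′ = contradiction (∈-des⁺ {s = v} eq eq′) i∉
    go false true  eq eq′ = u , ∈-des⁺ {s = u} u-i u-j ,
      inj₁ (swap-first-kind {s = u} {v} i u-i u-j λ z → sym (trans (u≡ (transpose i j z))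
        (cong (word v) (trans (transpose-comm i j (transpose i j z)) (transpose-inverse j i {z})))))
      where
      u-i : word u i ≡ true
      u-i = trans (u≡ i) (trans (cong (word v) (transpose-x i j)) eq′)
      u-j : word u j ≡ false
      u-j = trans (u≡ j) (trans (cong (word v) (transpose-y i j)) eq)

-- Moving a pair +− past a letter

infix 4 _⇝_ _⇝*_

data _⇝_ : List Bool → List Bool → Set where
  rightward : ∀ {c B} → true ∷ false ∷ c ∷ B ⇝ c ∷ true ∷ false ∷ B
  leftward  : ∀ {c B} → c ∷ true ∷ false ∷ B ⇝ true ∷ false ∷ c ∷ B
  skip      : ∀ {c A B} → A ⇝ B → c ∷ A ⇝ c ∷ B

_⇝*_ : List Bool → List Bool → Set
_⇝*_ = Star _⇝_

skip* : ∀ c {A B} → A ⇝* B → c ∷ A ⇝* c ∷ B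
skip* c = gmap (c ∷_) skip

++-⇝* : ∀ X {A B} → A ⇝* B → X ++ A ⇝* X ++ B
++-⇝* []      A⇝B = A⇝B
++-⇝* (c ∷ X) A⇝B = skip* c (++-⇝* X A⇝B)

pass : ∀ X {B} → true ∷ false ∷ X ++ B ⇝* X ++ true ∷ false ∷ B
pass []      = stop
pass (c ∷ X) = rightward ◅ skip* c (pass X)

pairs : ℕ → List Bool
pairs zero    = []
pairs (suc t) = true ∷ false ∷ pairs t

normal : ℕ → ℕ → ℕ → List Bool
normal p q t = replicate p false ++ replicate q true ++ pairs t

-- Letters are added from the right. A + in front of at least one - takes the first of them as
-- partner, and this new pair is moved past the remaining unpaired letters.
⇝*-normal : ∀ R → ∃ λ p → ∃ λ q → ∃ λ t → R ⇝* normal p q t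
⇝*-normal []      = 0 , 0 , 0 , stop
⇝*-normal (c ∷ R) with p , q , t , R⇝ ← ⇝*-normal R = go c p R⇝
  where
  go : ∀ c p → R ⇝* normal p q t → ∃ λ p → ∃ λ q → ∃ λ t → c ∷ R ⇝* normal p q t
  go false p       R⇝ = suc p , q , t , skip* false R⇝
  go true  zero    R⇝ = 0 , suc q , t , skip* true R⇝
  go true  (suc p) R⇝ = p , q , suc t , skip* true R⇝ ◅◅
    subst₂ _⇝*_ (cong (λ B → true ∷ false ∷ B) (List.++-assoc (replicate p false) _ _))
      (List.++-assoc (replicate p false) _ _) (pass (replicate p false ++ replicate q true))

pairs-pass : ∀ t → true ∷ pairs t ⇝* pairs t ++ true ∷ []
pairs-pass zero    = stop
pairs-pass (suc t) = leftward ◅ skip* true (skip* false (pairs-pass t))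

-- Moving every pair to the left past one + carries that + to the end of the list, where it is
-- cyclically adjacent to the start of the word.
normal-last : ∀ p q t → normal p (suc q) t ⇝* normal p q t ++ true ∷ []
normal-last p q t = subst (normal p (suc q) t ⇝*_) (sym (List.++-assoc (replicate p false) _ _))
  (++-⇝* (replicate p false) (true-last q))
  where
  true-last : ∀ q → true ∷ replicate q true ++ pairs t ⇝* (replicate q true ++ pairs t) ++ true ∷ []
  true-last zero    = pairs-pass t
  true-last (suc q) = skip* true (true-last q)

letters : (Bool → Bool) → List Bool → ℕ
letters φ []      = 0
letters φ (c ∷ R) = bit (φ c) + letters φ R

letters-++ : ∀ φ A B → letters φ (A ++ B) ≡ letters φ A + letters φ B
letters-++ φ []      B = refl
letters-++ φ (c ∷ A) B = trans (cong (λ m → bit (φ c) + m) (letters-++ φ A B)) (sym (ℕ.+-assoc (bit (φ c)) _ _))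

letters-replicate : ∀ φ p c → letters φ (replicate p c) ≡ p * bit (φ c)
letters-replicate φ zero    c = refl
letters-replicate φ (suc p) c = cong (λ m → bit (φ c) + m) (letters-replicate φ p c)

letters-pairs : ∀ t → letters id (pairs t) ≡ t × letters not (pairs t) ≡ t
letters-pairs zero    = refl , refl
letters-pairs (suc t) = cong suc (proj₁ (letters-pairs t)) , cong suc (proj₂ (letters-pairs t))

letters-normal : ∀ p q t → letters id (normal p q t) ≡ q + t × letters not (normal p q t) ≡ p + t
letters-normal p q t =
  trans (split id) (cong₂ _+_ (ℕ.*-zeroʳ p) (cong₂ _+_ (ℕ.*-identityʳ q) (proj₁ (letters-pairs t)))) ,
  trans (split not) (cong₂ _+_ (ℕ.*-identityʳ p) (cong₂ _+_ (ℕ.*-zeroʳ q) (proj₂ (letters-pairs t))))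
  where
  split : ∀ φ → letters φ (normal p q t) ≡ p * bit (φ false) + (q * bit (φ true) + letters φ (pairs t))
  split φ = trans (letters-++ φ (replicate p false) _) (cong₂ _+_ (letters-replicate φ p false)
    (trans (letters-++ φ (replicate q true) _) (cong (λ m → m + letters φ (pairs t)) (letters-replicate φ q true))))

-- Commuting and adjacent reflections among cyclic positions

module _ {n : ℕ} where

  Bonded Unrelated : Fin n → Fin n → Set
  Bonded    i j = affineSymmetric n i j ≡ 3
  Unrelated i j = affineSymmetric n i j ≡ 2

  -- The nested conditional of `affineSymmetric` as a function of its tests, so that `cong₂` can
  -- rewrite both.
  order : Bool → Bool → ℕ
  order c d = if c then 1 else if d then 3 else 2

  ⊕-≢ : ∀ (i : Fin n) {r t} → r < n → t < n → r ≢ t → i ⊕ + r ≢ i ⊕ + t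
  ⊕-≢ i r<n t<n r≢t eq = r≢t (⊕-injective i r<n t<n eq)

  ⊕+1 : ∀ (i : Fin n) r → (i ⊕ + r) ⊕ 1ℤ ≡ i ⊕ + suc r
  ⊕+1 i r = trans (⊕-⊕ i (+ r) 1ℤ) (cong (λ m → i ⊕ + m) (ℕ.+-comm r 1))

  bonded-suc : 1 < n → ∀ i → Bonded (i ⊕ 1ℤ) i
  bonded-suc 1<n i = cong₂ order
    (dec-false ((i ⊕ 1ℤ) Fin.≟ i) λ eq → contradiction
      (⊕-injective i 1<n (ℕ.<-trans ℕ.z<s 1<n) (trans eq (sym (⊕-identityʳ i)))) λ ())
    (trans (cong (does (i Fin.≟ i ⊕ 1ℤ ⊕ 1ℤ) ∨_) (dec-true ((i ⊕ 1ℤ) Fin.≟ i ⊕ 1ℤ) refl)) (Bool.∨-zeroʳ _))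

  bonded-pred : 1 < n → ∀ i → Bonded i (i ⊕ 1ℤ)
  bonded-pred 1<n i = cong₂ order
    (dec-false (i Fin.≟ (i ⊕ 1ℤ)) λ eq → contradiction
      (⊕-injective i 1<n (ℕ.<-trans ℕ.z<s 1<n) (trans (sym eq) (sym (⊕-identityʳ i)))) λ ())
    (cong (_∨ does (i Fin.≟ i ⊕ 1ℤ ⊕ 1ℤ)) (dec-true ((i ⊕ 1ℤ) Fin.≟ i ⊕ 1ℤ) refl))

  unrelated : ∀ (i : Fin n) r → 2 ≤ r → suc r < n → Unrelated i (i ⊕ + r)
  unrelated i r 2≤r r+1<n = cong₂ order
    (dec-false (i Fin.≟ i ⊕ + r) λ eq →
      ⊕-≢ i 0<n r<n (ℕ.<⇒≢ (ℕ.<-trans ℕ.z<s 2≤r)) (trans (⊕-identityʳ i) eq))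
    (cong₂ _∨_
      (dec-false ((i ⊕ + r) Fin.≟ i ⊕ 1ℤ) (⊕-≢ i r<n (ℕ.<-trans 2≤r r<n) (ℕ.>⇒≢ 2≤r)))
      (dec-false (i Fin.≟ i ⊕ + r ⊕ 1ℤ) λ eq →
        ⊕-≢ i 0<n r+1<n (λ ()) (trans (⊕-identityʳ i) (trans eq (⊕+1 i r)))))
    where
    r<n = ℕ.<-trans (ℕ.n<1+n r) r+1<n
    0<n = ℕ.<-trans ℕ.z<s r+1<n

-- Uniqueness of the arcs into v whose source contains i

module Uniqueness {a : ℕ} (3≤n : 3 ≤ a + a) (_⟶_ : RSYT a a → RSYT a a → Set)
  (arc⇒⟶ : ∀ {u v} → Arc u v → u ⟶ v)
  (compatible : ∀ {i j u w} → Unrelated i j → i ∈ des u → i ∉ des w → j ∈ des w → u ⟶ w → j ∈ des u)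
  (square : ∀ {i j u v w} → Unrelated i j → i ∈ des u → j ∈ des u → i ∉ des w → j ∉ des w →
            j ∈ des v → i ∉ des v → u ⟶ v → v ⟶ w → ∃ λ y → i ∈ des y × u ⟶ y × y ⟶ w)
  (bonded-unique : ∀ {i j v x y} → Bonded i j → j ∈ des v → i ∉ des v →
            i ∈ des x → j ∉ des x → x ⟶ v → i ∈ des y → j ∉ des y → y ⟶ v → x ≡ y)
  where

  private
    n = a + a

  UniqueArc : Fin n → RSYT a a → Set
  UniqueArc i v = ∀ {x y} → i ∈ des x → x ⟶ v → i ∈ des y → y ⟶ v → x ≡ y

  ∉-des : ∀ {s : RSYT a a} {i : Fin n} → word s i ≡ false → i ∉ des s
  ∉-des {s} eq i∈ = contradiction (trans (sym (proj₁ (∈-des⁻ {s = s} i∈))) eq) λ ()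

  ∉-des′ : ∀ {s : RSYT a a} {i : Fin n} → word s (i ⊕ 1ℤ) ≡ true → i ∉ des s
  ∉-des′ {s} eq i∈ = contradiction (trans (sym (proj₂ (∈-des⁻ {s = s} i∈))) eq) λ ()

  -- Every arc u ⟶ v closes up to a square u ⟶ y ⟶ w with y determined by w,
  -- and u is in turn determined by y.
  transfer : ∀ {i k k′ v w} → Unrelated i k → Unrelated i k′ → Bonded k k′ →
    i ∉ des v → i ∉ des w → k ∈ des v → k ∉ des w → k′ ∈ des w →
    (∀ {u : RSYT a a} → k ∈ des u → k′ ∉ des u) → (∀ {u : RSYT a a} → k′ ∈ des u → k ∉ des u) →
    v ⟶ w → UniqueArc i w → UniqueArc i v
  transfer {i} {k} {k′} {v} {w} i-k i-k′ k-k′ i∉v i∉w k∈v k∉w k′∈w k⇒¬k′ k′⇒¬k v⟶w unique {x} {y} i∈x x⟶v i∈y y⟶v =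
    go (corner i∈x x⟶v) (corner i∈y y⟶v)
    where
    k∈ : ∀ {u} → i ∈ des u → u ⟶ v → k ∈ des u
    k∈ i∈u u⟶v = compatible i-k i∈u i∉v k∈v u⟶v
    corner : ∀ {u} → i ∈ des u → u ⟶ v → ∃ λ z → i ∈ des z × u ⟶ z × z ⟶ w
    corner i∈u u⟶v = square i-k i∈u (k∈ i∈u u⟶v) i∉w k∉w k∈v i∉v u⟶v v⟶w
    go : (∃ λ z → i ∈ des z × x ⟶ z × z ⟶ w) → (∃ λ z → i ∈ des z × y ⟶ z × z ⟶ w) → x ≡ y
    go (z , i∈z , x⟶z , z⟶w) (z′ , i∈z′ , y⟶z′ , z′⟶w) =
      bonded-unique k-k′ k′∈z (k′⇒¬k {z} k′∈z)
        (k∈ i∈x x⟶v) (k⇒¬k′ {x} (k∈ i∈x x⟶v)) x⟶z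
        (k∈ i∈y y⟶v) (k⇒¬k′ {y} (k∈ i∈y y⟶v)) (subst (y ⟶_) (unique i∈z′ z′⟶w i∈z z⟶w) y⟶z′)
      where
      k′∈z : k′ ∈ des z
      k′∈z = compatible i-k′ i∈z i∉w k′∈w z⟶w

  module _ (i : Fin n) where

    letter : RSYT a a → ℕ → Bool
    letter s r = word s (i ⊕ + r)

    ∈-des-letter : ∀ {s r} → letter s r ≡ true → letter s (suc r) ≡ false → (i ⊕ + r) ∈ des s
    ∈-des-letter {s} {r} eq eq′ = ∈-des⁺ {s = s} eq (trans (cong (word s) (⊕+1 i r)) eq′)

    letter-∈-des : ∀ {s r} → (i ⊕ + r) ∈ des s → letter s r ≡ true × letter s (suc r) ≡ false
    letter-∈-des {s} {r} r∈ = proj₁ (∈-des⁻ {s = s} r∈) ,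
      trans (cong (word s) (sym (⊕+1 i r))) (proj₂ (∈-des⁻ {s = s} r∈))

    -- The empty list is read only at position `n`, so a list that is read reaches the end of the
    -- word. This bounds the positions of moves and keeps them from wrapping round to i.
    Reads : RSYT a a → ℕ → List Bool → Set
    Reads s r []      = r ≡ n
    Reads s r (c ∷ R) = letter s r ≡ c × Reads s (suc r) R

    reads : ∀ s m {r} → r + m ≡ n → ∃ λ R → Reads s r R
    reads s zero    {r} eq = [] , trans (sym (ℕ.+-identityʳ r)) eq
    reads s (suc m) {r} eq = _ , refl , proj₂ (reads s m (trans (sym (ℕ.+-suc r m)) eq))

    reads-length : ∀ {s} R {r} → Reads s r R → r + length R ≡ n
    reads-length []      {r} eq       = trans (ℕ.+-identityʳ r) eq
    reads-length (c ∷ R) {r} (_ , rd) = trans (ℕ.+-suc r (length R)) (reads-length R rd)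

    reads-< : ∀ {s} R {c r} → Reads s r (c ∷ R) → r < n
    reads-< R {c} {r} rd = subst (r <_) (reads-length (c ∷ R) rd) (ℕ.m<m+n r ℕ.z<s)

    reads-cong : ∀ {s t} R {r} → (∀ {k} → r ≤ k → k < n → letter s k ≡ letter t k) → Reads s r R → Reads t r R
    reads-cong []      agree eq = eq
    reads-cong (c ∷ R) agree rd@(eq , rd′) =
      trans (sym (agree ℕ.≤-refl (reads-< R rd))) eq , reads-cong R (λ r<k → agree (ℕ.<⇒≤ r<k)) rd′

    reads-agree : ∀ {s t} R {r k} → Reads s r R → Reads t r R → r ≤ k → k < n → letter s k ≡ letter t k
    reads-agree []      refl      _          r≤k k<n = contradiction k<n (ℕ.≤⇒≯ r≤k)
    reads-agree (c ∷ R) {r} {k} (eq , rd) (eq′ , rd′) r≤k k<n = go (ℕ.m≤n⇒m<n∨m≡n r≤k)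
      where
      go : r < k ⊎ r ≡ k → _
      go (inj₁ r<k)  = reads-agree R rd rd′ r<k k<n
      go (inj₂ refl) = trans eq (sym eq′)

    reads-last : ∀ {s} X {c r} → Reads s r (X ++ c ∷ []) → letter s (n ∸ 1) ≡ c
    reads-last {s} []      (eq , end) = trans (cong (λ m → letter s (m ∸ 1)) (sym end)) eq
    reads-last     (_ ∷ X) (_ , rd)   = reads-last X rd

    reads-letters : ∀ φ {s} R {r} → Reads s r R → ∑< (λ k → bit (φ (letter s (r + k)))) (length R) ≡ letters φ R
    reads-letters φ     []      _         = refl
    reads-letters φ {s} (c ∷ R) {r} (eq , rd) = cong₂ _+_
      (cong (bit ∘ φ) (trans (cong (letter s) (ℕ.+-identityʳ r)) eq))
      (trans (∑<-cong (length R) (λ {k} _ → cong (λ m → bit (φ (letter s m))) (ℕ.+-suc r k))) (reads-letters φ R rd))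

    des⁺ : ∀ {s} → letter s 0 ≡ true → letter s 1 ≡ false → i ∈ des s
    des⁺ {s} eq eq′ = ∈-des⁺ {s = s} (trans (cong (word s) (sym (⊕-identityʳ i))) eq) eq′

    des⁻ : ∀ {s} → i ∈ des s → letter s 0 ≡ true × letter s 1 ≡ false
    des⁻ {s} i∈ = trans (cong (word s) (⊕-identityʳ i)) (proj₁ (∈-des⁻ {s = s} i∈)) , proj₂ (∈-des⁻ {s = s} i∈)

    record Swapped (s : RSYT a a) (r : ℕ) (t : RSYT a a) : Set where
      field
        swapped   : ∀ z → word t z ≡ word s (transpose ((i ⊕ + r) ⊕ 1ℤ) (i ⊕ + r) z)
        at-r      : letter t r ≡ letter s (suc r)
        at-suc-r  : letter t (suc r) ≡ letter s r
        elsewhere : ∀ {k} → k < n → k ≢ r → k ≢ suc r → letter t k ≡ letter s k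

    Swapped-sym : ∀ {s r t} → Swapped s r t → Swapped t r s
    Swapped-sym {s} {r} sw = record
      { swapped   = λ z → sym (trans (swapped (transpose y x z)) (cong (word s)
          (trans (cong (transpose y x) (transpose-comm y x z)) (transpose-inverse y x {z}))))
      ; at-r      = sym at-suc-r
      ; at-suc-r  = sym at-r
      ; elsewhere = λ k<n k≢r k≢1+r → sym (elsewhere k<n k≢r k≢1+r)
      }
      where
      open Swapped sw
      x = i ⊕ + r
      y = x ⊕ 1ℤ

    swap-adjacent : ∀ s {r} → suc r < n → ∃ (Swapped s r)
    swap-adjacent s {r} r+1<n = proj₁ t , record
      { swapped   = proj₂ t
      ; at-r      = trans (proj₂ t x) (cong (word s) (trans (transpose-y y x) (⊕+1 i r)))
      ; at-suc-r  = trans (proj₂ t (i ⊕ + suc r)) (cong (word s)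
          (trans (cong (transpose y x) (sym (⊕+1 i r))) (transpose-x y x)))
      ; elsewhere = λ k<n k≢r k≢1+r → trans (proj₂ t _) (cong (word s) (transpose-≢
          (λ eq → ⊕-≢ i k<n r+1<n k≢1+r (trans eq (⊕+1 i r)))
          (⊕-≢ i k<n (ℕ.<-trans (ℕ.n<1+n r) r+1<n) k≢r)))
      }
      where
      x = i ⊕ + r
      y = x ⊕ 1ℤ
      t = swap y x s

    Swapped-arcs : ∀ {s r t} → Swapped s r t → letter s r ≡ true → letter s (suc r) ≡ false →
      word s ((i ⊕ + r) ⊕ -1ℤ) ≡ true ⊎ letter s (suc (suc r)) ≡ false → s ⟶ t × t ⟶ s
    Swapped-arcs {s} {r} {t} sw eq eq′ outer = arc⇒⟶ (proj₁ arcs) , arc⇒⟶ (proj₂ arcs)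
      where
      right : word s ((i ⊕ + r) ⊕ -1ℤ) ≡ true ⊎ letter s (suc (suc r)) ≡ false →
              word s ((i ⊕ + r) ⊕ -1ℤ) ≡ true ⊎ word s ((i ⊕ + r) ⊕ + 2) ≡ false
      right (inj₁ eq) = inj₁ eq
      right (inj₂ eq) = inj₂ (trans (cong (word s) (trans (⊕-⊕ i (+ r) (+ 2)) (cong (λ m → i ⊕ + m) (ℕ.+-comm r 2)))) eq)
      arcs = knuth-arcs {s = s} {t} (i ⊕ + r) 3≤n eq (trans (cong (word s) (⊕+1 i r)) eq′)
        (right outer) (Swapped.swapped sw)

    module _ {r} (2≤r : 2 ≤ r) (r+2<n : suc (suc r) < n) where

      private
        r+1<n : suc r < n
        r+1<n = ℕ.<-trans (ℕ.n<1+n _) r+2<n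
        1<n : 1 < n
        1<n = ℕ.<-trans (ℕ.n<1+n 1) 3≤n
        k k′ : Fin n
        k  = i ⊕ + r
        k′ = i ⊕ + suc r
        i-k : Unrelated i k
        i-k = unrelated i r 2≤r r+1<n
        i-k′ : Unrelated i k′
        i-k′ = unrelated i (suc r) (ℕ.m≤n⇒m≤1+n 2≤r) r+2<n
        k⇒¬k′ : ∀ {u : RSYT a a} → k ∈ des u → k′ ∉ des u
        k⇒¬k′ {u} k∈ = ∉-des {s = u} (proj₂ (letter-∈-des {s = u} k∈))
        ¬k : ∀ {u : RSYT a a} → letter u (suc r) ≡ true → k ∉ des u
        ¬k {u} eq = ∉-des′ {s = u} (trans (cong (word u) (⊕+1 i r)) eq)
        k′⇒¬k : ∀ {u : RSYT a a} → k′ ∈ des u → k ∉ des u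
        k′⇒¬k {u} k′∈ = ¬k {u} (proj₁ (letter-∈-des {s = u} k′∈))

      -- A pair at position `r` is the descent `k`, and one place further it is the descent `k′`.
      -- The bounds on `r` keep both away from i and its two neighbours, so both commute with i
      -- while being adjacent to each other.
      transfer-rightward : ∀ {s t} → i ∉ des s → i ∉ des t → letter s r ≡ true → letter s (suc r) ≡ false →
        letter t (suc r) ≡ true → letter t (suc (suc r)) ≡ false → s ⟶ t → UniqueArc i t → UniqueArc i s
      transfer-rightward {s} {t} i∉s i∉t s-r s-r+1 t-r+1 t-r+2 =
        transfer i-k i-k′ (subst (Bonded k) (⊕+1 i r) (bonded-pred 1<n k)) i∉s i∉t
          (∈-des-letter {s} s-r s-r+1) (¬k {t} t-r+1) (∈-des-letter {t} t-r+1 t-r+2)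
          (λ {u} → k⇒¬k′ {u}) (λ {u} → k′⇒¬k {u})

      transfer-leftward : ∀ {s t} → i ∉ des s → i ∉ des t → letter s (suc r) ≡ true → letter s (suc (suc r)) ≡ false →
        letter t r ≡ true → letter t (suc r) ≡ false → s ⟶ t → UniqueArc i t → UniqueArc i s
      transfer-leftward {s} {t} i∉s i∉t s-r+1 s-r+2 t-r t-r+1 =
        transfer i-k′ i-k (subst (λ z → Bonded z k) (⊕+1 i r) (bonded-suc 1<n k)) i∉s i∉t
          (∈-des-letter {s} s-r+1 s-r+2) (∉-des {s = t} t-r+1) (∈-des-letter {t} t-r t-r+1)
          (λ {u} → k′⇒¬k {u}) (λ {u} → k⇒¬k′ {u})

    -- Uniqueness is pulled back from the simplified word `t` to `s`. Agreement before `r` lets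
    -- `skip` reattach letters and keeps the letters at i and i + 1, hence the absence of the
    -- descent i.
    Reduces : RSYT a a → ℕ → List Bool → Set
    Reduces s r B = ∃ λ t → (∀ {k} → k < r → letter t k ≡ letter s k) × Reads t r B × (UniqueArc i t → UniqueArc i s)

    i∉-cong : ∀ {s t r} → 2 ≤ r → (∀ {k} → k < r → letter t k ≡ letter s k) → i ∉ des s → i ∉ des t
    i∉-cong {s} {t} 2≤r agree i∉s i∈t = i∉s (des⁺ {s}
      (trans (sym (agree (ℕ.<-trans ℕ.z<s 2≤r))) (proj₁ (des⁻ {t} i∈t)))
      (trans (sym (agree 2≤r)) (proj₂ (des⁻ {t} i∈t))))

    module Step {s r B} (2≤r : 2 ≤ r) (r+2<n : suc (suc r) < n) (i∉s : i ∉ des s)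
      (rest : Reads s (suc (suc (suc r))) B) where

      private
        r+1<n : suc r < n
        r+1<n = ℕ.<-trans (ℕ.n<1+n _) r+2<n

      module First (t : RSYT a a) (sw : Swapped s r t) where
        open Swapped sw public
        agree : ∀ {k} → k < r → letter t k ≡ letter s k
        agree k<r = elsewhere (ℕ.<-trans k<r (ℕ.<-trans (ℕ.n<1+n r) r+1<n)) (ℕ.<⇒≢ k<r) (ℕ.<⇒≢ (ℕ.m≤n⇒m≤1+n k<r))
        third : letter t (suc (suc r)) ≡ letter s (suc (suc r))
        third = elsewhere r+2<n (ℕ.>⇒≢ (ℕ.m≤n⇒m≤1+n ℕ.≤-refl)) (ℕ.>⇒≢ ℕ.≤-refl)
        rest′ : Reads t (suc (suc (suc r))) B
        rest′ = reads-cong B (λ r+3≤k k<n → sym (elsewhere k<n (ℕ.>⇒≢ (ℕ.<-trans (ℕ.n<1+n r) (ℕ.<-trans (ℕ.n<1+n _) r+3≤k)))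
          (ℕ.>⇒≢ (ℕ.<-trans (ℕ.n<1+n _) r+3≤k)))) rest
        i∉t : i ∉ des t
        i∉t = i∉-cong {s} {t} 2≤r agree i∉s

      module Second (t : RSYT a a) (sw : Swapped s (suc r) t) where
        open Swapped sw public
        agree : ∀ {k} → k < suc r → letter t k ≡ letter s k
        agree k<1+r = elsewhere (ℕ.<-trans k<1+r r+1<n) (ℕ.<⇒≢ k<1+r) (ℕ.<⇒≢ (ℕ.m≤n⇒m≤1+n k<1+r))
        rest′ : Reads t (suc (suc (suc r))) B
        rest′ = reads-cong B (λ r+3≤k k<n → sym (elsewhere k<n (ℕ.>⇒≢ (ℕ.<-trans (ℕ.n<1+n _) r+3≤k)) (ℕ.>⇒≢ r+3≤k))) rest
        i∉t : i ∉ des t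
        i∉t = i∉-cong {s} {t} 2≤r (λ k<r → agree (ℕ.m≤n⇒m≤1+n k<r)) i∉s

      -- Passing a letter is a single exchange of neighbours: + - - becomes - + - at `r`, and + - +
      -- becomes + + - at `suc r`. The third letter, unaffected by the exchange, provides the outer
      -- condition of `knuth-arcs`; in the second case the arc of the first kind runs from `t` to
      -- `s`.
      right : ∀ c → letter s r ≡ true → letter s (suc r) ≡ false → letter s (suc (suc r)) ≡ c →
              Reduces s r (c ∷ true ∷ false ∷ B)
      right false s-r s-r+1 s-r+2 = t , agree ,
        (trans at-r s-r+1 , trans at-suc-r s-r , trans third s-r+2 , rest′) ,
        transfer-rightward 2≤r r+2<n {s} {t} i∉s i∉t s-r s-r+1 (trans at-suc-r s-r) (trans third s-r+2)
          (proj₁ (Swapped-arcs {s} sw s-r s-r+1 (inj₂ s-r+2)))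
        where
        t = proj₁ (swap-adjacent s r+1<n)
        sw = proj₂ (swap-adjacent s r+1<n)
        open First t sw
      right true s-r s-r+1 s-r+2 = t , (λ k<r → agree (ℕ.m≤n⇒m≤1+n k<r)) ,
        (trans (agree ℕ.≤-refl) s-r , trans at-r s-r+2 , trans at-suc-r s-r+1 , rest′) ,
        transfer-rightward 2≤r r+2<n {s} {t} i∉s i∉t s-r s-r+1 (trans at-r s-r+2) (trans at-suc-r s-r+1)
          (proj₂ (Swapped-arcs {t} (Swapped-sym sw) (trans at-r s-r+2) (trans at-suc-r s-r+1)
            (inj₁ (trans (cong (word t) (⊕-⊕ i (+ suc r) -1ℤ)) (trans (agree ℕ.≤-refl) s-r)))))
        where
        t = proj₁ (swap-adjacent s r+2<n)
        sw = proj₂ (swap-adjacent s r+2<n)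
        open Second t sw

      left : ∀ c → letter s r ≡ c → letter s (suc r) ≡ true → letter s (suc (suc r)) ≡ false →
             Reduces s r (true ∷ false ∷ c ∷ B)
      left false s-r s-r+1 s-r+2 = t , agree ,
        (trans at-r s-r+1 , trans at-suc-r s-r , trans third s-r+2 , rest′) ,
        transfer-leftward 2≤r r+2<n {s} {t} i∉s i∉t s-r+1 s-r+2 (trans at-r s-r+1) (trans at-suc-r s-r)
          (proj₂ (Swapped-arcs {t} (Swapped-sym sw) (trans at-r s-r+1) (trans at-suc-r s-r) (inj₂ (trans third s-r+2))))
        where
        t = proj₁ (swap-adjacent s r+1<n)
        sw = proj₂ (swap-adjacent s r+1<n)
        open First t sw
      left true s-r s-r+1 s-r+2 = t , (λ k<r → agree (ℕ.m≤n⇒m≤1+n k<r)) ,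
        (trans (agree ℕ.≤-refl) s-r , trans at-r s-r+2 , trans at-suc-r s-r+1 , rest′) ,
        transfer-leftward 2≤r r+2<n {s} {t} i∉s i∉t s-r+1 s-r+2 (trans (agree ℕ.≤-refl) s-r) (trans at-r s-r+2)
          (proj₁ (Swapped-arcs {s} sw s-r+1 s-r+2 (inj₁ (trans (cong (word s) (⊕-⊕ i (+ suc r) -1ℤ)) s-r))))
        where
        t = proj₁ (swap-adjacent s r+2<n)
        sw = proj₂ (swap-adjacent s r+2<n)
        open Second t sw

    step : ∀ {A B} → A ⇝ B → ∀ {s r} → 2 ≤ r → i ∉ des s → Reads s r A → Reduces s r B
    step (rightward {c} {B}) {s} 2≤r i∉s (s-r , s-r+1 , s-r+2 , rest) =
      Step.right 2≤r (reads-< {s} B (s-r+2 , rest)) i∉s rest c s-r s-r+1 s-r+2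
    step (leftward {c} {B}) {s} 2≤r i∉s (s-r , s-r+1 , s-r+2 , rest) =
      Step.left 2≤r (reads-< {s} B (s-r+2 , rest)) i∉s rest c s-r s-r+1 s-r+2
    step (skip A⇝B) {s} {r} 2≤r i∉s (s-r , rd) = go (step A⇝B (ℕ.m≤n⇒m≤1+n 2≤r) i∉s rd)
      where
      go : Reduces s (suc r) _ → Reduces s r _
      go (t , agree , rd′ , unique) =
        t , (λ k<r → agree (ℕ.m≤n⇒m≤1+n k<r)) , (trans (agree ℕ.≤-refl) s-r , rd′) , unique

    steps : ∀ {A B} → A ⇝* B → ∀ {s r} → 2 ≤ r → i ∉ des s → Reads s r A → Reduces s r B
    steps stop               {s} _ _ rd = s , (λ _ → refl) , rd , λ unique → unique
    steps (A⇝B ◅ B⇝*C) {s} {r} 2≤r i∉s rd = go (step A⇝B 2≤r i∉s rd)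
      where
      go : Reduces s r _ → Reduces s r _
      go (t , agree , rd′ , unique) = go′ (steps B⇝*C 2≤r (i∉-cong {s} {t} 2≤r agree i∉s) rd′)
        where
        go′ : Reduces t r _ → Reduces s r _
        go′ (t′ , agree′ , rd″ , unique′) =
          t′ , (λ k<r → trans (agree′ k<r) (agree k<r)) , rd″ , λ u → unique (unique′ u)

    private
      1<n : 1 < n
      1<n = ℕ.<-trans (ℕ.n<1+n 1) 3≤n

    -- A source with descent i has - at i + 1, so it lacks the descent i + 1 of `s`: exactly the
    -- situation of the bond rule.
    unique-suc : ∀ {s} → i ∉ des s → letter s 1 ≡ true → letter s 2 ≡ false → UniqueArc i s
    unique-suc {s} i∉s s-1 s-2 {x} {y} i∈x x⟶s i∈y y⟶s =
      bonded-unique (bonded-pred 1<n i) (∈-des-letter {s} s-1 s-2) i∉s i∈x (∉ {x} i∈x) x⟶s i∈y (∉ {y} i∈y) y⟶s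
      where
      ∉ : ∀ {x} → i ∈ des x → (i ⊕ 1ℤ) ∉ des x
      ∉ {x} i∈x = ∉-des {s = x} (proj₂ (des⁻ {x} i∈x))

    unique-pred : ∀ {s} → i ∉ des s → letter s (n ∸ 1) ≡ true → letter s 0 ≡ false → UniqueArc i s
    unique-pred {s} i∉s s-n-1 s-0 {x} {y} i∈x x⟶s i∈y y⟶s =
      bonded-unique (subst (λ z → Bonded z (i ⊕ -1ℤ)) -1+1 (bonded-suc 1<n (i ⊕ -1ℤ)))
        (∈-des⁺ {s = s} (trans (cong (word s) (⊕-last i)) s-n-1) (trans (cong (word s) (⊕-⊕ i -1ℤ 1ℤ)) s-0))
        i∉s i∈x (∉ {x} i∈x) x⟶s i∈y (∉ {y} i∈y) y⟶s
      where
      -1+1 : (i ⊕ -1ℤ) ⊕ 1ℤ ≡ i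
      -1+1 = trans (⊕-⊕ i -1ℤ 1ℤ) (⊕-identityʳ i)
      ∉ : ∀ {x} → i ∈ des x → (i ⊕ -1ℤ) ∉ des x
      ∉ {x} i∈x = ∉-des′ {s = x} (trans (cong (word x) -1+1) (proj₁ (∈-des⁻ {s = x} i∈x)))

    unique-pairs : ∀ {s} t → i ∉ des s → Reads s 2 (pairs t) → UniqueArc i s
    unique-pairs {s} t i∉s rd {x} {y} i∈x x⟶s i∈y y⟶s = word-surjective i agree
      where
      copy : ∀ {x} → i ∈ des x → x ⟶ s → ∀ t {r} → 2 ≤ r → Reads s r (pairs t) → Reads x r (pairs t)
      copy         i∈x x⟶s zero    _   end = end
      copy {x} i∈x x⟶s (suc t) {r} 2≤r (s-r , s-r+1 , rd) =
        proj₁ letters-x , proj₂ letters-x , copy {x} i∈x x⟶s t (ℕ.m≤n⇒m≤1+n (ℕ.m≤n⇒m≤1+n 2≤r)) rd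
        where
        letters-x = letter-∈-des {x} (compatible
          (unrelated i r 2≤r (reads-< {s} (pairs t) (s-r+1 , rd))) i∈x i∉s (∈-des-letter {s} s-r s-r+1) x⟶s)
      agree : ∀ {r} → r < a + a → letter x r ≡ letter y r
      agree {zero}        _   = trans (proj₁ (des⁻ {x} i∈x)) (sym (proj₁ (des⁻ {y} i∈y)))
      agree {suc zero}    _   = trans (proj₂ (des⁻ {x} i∈x)) (sym (proj₂ (des⁻ {y} i∈y)))
      agree {suc (suc r)} r<n = reads-agree {x} {y} (pairs t) (copy {x} i∈x x⟶s t ℕ.≤-refl rd) (copy {y} i∈y y⟶s t ℕ.≤-refl rd)
        (ℕ.s≤s (ℕ.s≤s ℕ.z≤n)) r<n

    -- Both letters occur `a` times. After - + or + + with `p = 0` this forces - + and `q = 0`,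
    -- leaving only pairs; after - - it forces `q` to be positive. A letter + at i + 1 with `p`
    -- positive gives a descent there at once.
    unique-normal : ∀ {s} p q t → i ∉ des s → Reads s 2 (normal p q t) → UniqueArc i s
    unique-normal {s} p q t i∉s rd =
      go (letter s 0) (letter s 1) p q refl refl rd
        (trans (sym (tally id (proj₁ (letters-normal p q t)))) (word-trues s i))
        (trans (sym (tally not (proj₂ (letters-normal p q t)))) (word-falses s i))
      where
      tally : ∀ φ {m} → letters φ (normal p q t) ≡ m →
              ∑< (λ r → bit (φ (letter s r))) n ≡ bit (φ (letter s 0)) + (bit (φ (letter s 1)) + m)
      tally φ eq = trans (cong (∑< _) (sym (reads-length {s} (normal p q t) rd)))
        (cong (λ m → bit (φ (letter s 0)) + (bit (φ (letter s 1)) + m)) (trans (reads-letters φ {s} (normal p q t) rd) eq))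
      go : ∀ c c′ p q → letter s 0 ≡ c → letter s 1 ≡ c′ → Reads s 2 (normal p q t) →
           bit c + (bit c′ + (q + t)) ≡ a → bit (not c) + (bit (not c′) + (p + t)) ≡ a → UniqueArc i s
      go true  false _       _ s-0 s-1 _ _ _ = contradiction (des⁺ {s} s-0 s-1) i∉s
      go _     true  (suc p) _ _ s-1 (s-2 , _) _ _ = unique-suc {s} i∉s s-1 s-2
      go true  true  zero    q _ _ _ trues falses = contradiction (trans trues (sym falses)) (ℕ.>⇒≢ (ℕ.s≤s (ℕ.m≤n⇒m≤1+n (ℕ.m≤n+m t q))))
      go false true  zero    zero    _ _ rd _ _ = unique-pairs {s} t i∉s rd
      go false true  zero    (suc q) _ _ _ trues falses = contradiction (trans trues (sym falses)) (ℕ.>⇒≢ (ℕ.s≤s (ℕ.s≤s (ℕ.m≤n+m t q))))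
      go false false p       zero    _ _ _ trues falses = contradiction (trans trues (sym falses)) (ℕ.<⇒≢ (ℕ.s≤s (ℕ.m≤n⇒m≤1+n (ℕ.m≤n+m t p))))
      -- One of the unpaired letters + is carried to the last position, where with the - at i it
      -- forms a descent i - 1.
      go false false p       (suc q) s-0 _ rd _ _ = go′ (steps (normal-last p q t) ℕ.≤-refl i∉s rd)
        where
        go′ : Reduces s 2 (normal p q t ++ true ∷ []) → UniqueArc i s
        go′ (s′ , agree , rd′ , unique) = unique (unique-pred {s′} (i∉-cong {s} {s′} ℕ.≤-refl agree i∉s)
          (reads-last {s′} (normal p q t) rd′) (trans (agree ℕ.z<s) s-0))

    unique-arc : ∀ {s} → i ∉ des s → UniqueArc i s
    unique-arc {s} i∉s = conclude (reads s (n ∸ 2) (ℕ.m+[n∸m]≡n 1<n))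
      where
      conclude : (∃ λ R → Reads s 2 R) → UniqueArc i s
      conclude (R , rd) = go (⇝*-normal R)
        where
        go : (∃ λ p → ∃ λ q → ∃ λ t → R ⇝* normal p q t) → UniqueArc i s
        go (p , q , t , R⇝) = go′ (steps R⇝ ℕ.≤-refl i∉s rd)
          where
          go′ : Reduces s 2 (normal p q t) → UniqueArc i s
          go′ (s′ , agree , rd′ , unique) =
            unique (unique-normal {s′} p q t (i∉-cong {s} {s′} ℕ.≤-refl agree i∉s) rd′)

-- Some two of the iterates x , f x , f (f x) , … coincide; cancelling f exhibits x as an iterate of f x.
injective⇒surjective : ∀ {A : Set} (xs : List A) → (∀ x → x ∈ˡ xs) → (f : A → A) → Injective _≡_ _≡_ f →
                       ∀ x → ∃ λ y → f y ≡ x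
injective⇒surjective {A} xs complete f inj x = conclude (Fin.pigeonhole (ℕ.n<1+n (length xs)) index)
  where
  iterate : ℕ → A
  iterate zero    = x
  iterate (suc k) = f (iterate k)
  index : Fin (suc (length xs)) → Fin (length xs)
  index k = Any.index (complete (iterate (toℕ k)))
  at-index : ∀ k → iterate (toℕ k) ≡ List.lookup xs (index k)
  at-index k = Any.lookup-index (complete (iterate (toℕ k)))
  cancel : ∀ i j → i < j → iterate i ≡ iterate j → ∃ λ y → f y ≡ x
  cancel zero    (suc j) _   eq = iterate j , sym eq
  cancel (suc i) (suc j) i<j eq = cancel i j (ℕ.s<s⁻¹ i<j) (inj eq)
  conclude : (∃₂ λ i j → toℕ i < toℕ j × index i ≡ index j) → ∃ λ y → f y ≡ x
  conclude (i , j , i<j , eq) = cancel (toℕ i) (toℕ j) i<j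
    (trans (at-index i) (trans (cong (List.lookup xs) eq) (sym (at-index j))))

-- Comparison of the weights on tableaux

indicator-yes : ∀ {A : Set} (a? : Dec A) → A → indicator a? ≡ 1ᴸ
indicator-yes (yes _) _ = refl
indicator-yes (no ¬a) a = contradiction a ¬a

theorem9p10 :
    ∀ (a : ℕ) → a + a ≥ 3 →
    (Γ : LabeledGraph (a + a)) →
    Reduced Γ → NbAdmissible Γ → IsWGraph Γ (affineSymmetric (a + a)) →
    U Γ ≃ D̄ a a →
    (φ : LabeledGraph.V (Γ̄ a a) → LabeledGraph.V Γ) → IsEmbedding (Γ̄ a a) Γ φ →
    IsIsomorphism (Γ̄ a a) Γ φ
theorem9p10 a 3≤n Γ reduced admissible wgraph (f , f-iso) φ embedding = record
  { bijective   = φ-injective , λ v → proj₁ (φ-surjective v) , λ { refl → proj₂ (φ-surjective v) }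
  ; τ-preserved = τ-preserved
  ; m-preserved = m-preserved
  }
  where
  open Dual Γ
  open IsEmbedding embedding renaming (injective to φ-injective)

  -- `f` sends vertices back to tableaux, so `f ∘ φ` is an injective map of a finite set to itself
  -- and takes the value `f v`; injectivity of `f` then removes `f`.
  φ-surjective : ∀ v → ∃ λ s → φ s ≡ v
  φ-surjective v = map₂ f-injective
    (injective⇒surjective (allRSYT a a) (∈-allRSYT a a) (f ∘ φ) (φ-injective ∘ f-injective) (f v))
    where
    f-injective : Injective _≡_ _≡_ f
    f-injective = proj₁ (IsIsomorphism.bijective f-iso)

  _⟶_ : RSYT a a → RSYT a a → Set
  u ⟶ v = N (φ u) (φ v) ≢ 0ℤ

  ∈τ : ∀ {i} u → i ∈ des u → i ∈ τ (φ u)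
  ∈τ {i} u = subst (i ∈_) (sym (τ-preserved u))

  ∈τ⁻ : ∀ {i} u → i ∈ τ (φ u) → i ∈ des u
  ∈τ⁻ {i} u = subst (i ∈_) (τ-preserved u)

  m̄ : RSYT a a → RSYT a a → Laurent
  m̄ = LabeledGraph.m (Γ̄ a a)

  arc⇒m̄ : ∀ {u v} → Arc u v → m̄ u v ≡ 1ᴸ
  arc⇒m̄ {u} {v} = indicator-yes (firstKind? u v ⊎-dec secondKind? u v)

  arc⇒⟶ : ∀ {u v} → Arc u v → u ⟶ v
  arc⇒⟶ {u} {v} arc N≡0 = go (m-subgraph u v)
    where
    -- A subgraph may drop weights, but the weight of an arc is 1 and not 0, so the embedding has to
    -- preserve it.
    go : (m̄ u v ≈ m (φ u) (φ v)) ⊎ (m̄ u v ≈ 0ᴸ) → ⊥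
    go (inj₁ m̄≈m) with () ← trans (sym (cong ε (arc⇒m̄ arc))) (trans (ε-cong (m̄ u v) (m (φ u) (φ v)) m̄≈m) N≡0)
    go (inj₂ m̄≈0) = 1≉0 (subst (_≈ 0ᴸ) (arc⇒m̄ arc) m̄≈0)

  M = affineSymmetric (a + a)

  compatible : ∀ {i j u w} → M i j ≡ 2 → i ∈ des u → i ∉ des w → j ∈ des w → u ⟶ w → j ∈ des u
  compatible {i} {j} {u} {w} Mij i∈u i∉w j∈w u⟶w = decidable-stable (j ∈? des u) λ j∉u →
    u⟶w (compatibility Γ M wgraph Mij (∈τ u i∈u) (i∉w ∘ ∈τ⁻ w) (∈τ w j∈w) (j∉u ∘ ∈τ⁻ u))

  square : ∀ {i j u v w} → M i j ≡ 2 → i ∈ des u → j ∈ des u → i ∉ des w → j ∉ des w →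
           j ∈ des v → i ∉ des v → u ⟶ v → v ⟶ w → ∃ λ y → i ∈ des y × u ⟶ y × y ⟶ w
  square {i} {j} {u} {v} {w} Mij i∈u j∈u i∉w j∉w j∈v i∉v u⟶v v⟶w =
    pull (polygon Γ M wgraph admissible Mij (∈τ u i∈u) (∈τ u j∈u) (i∉w ∘ ∈τ⁻ w) (j∉w ∘ ∈τ⁻ w)
      (∈τ v j∈v) (i∉v ∘ ∈τ⁻ v) u⟶v v⟶w)
    where
    pull : (∃ λ y → i ∈ τ y × N (φ u) y ≢ 0ℤ × N y (φ w) ≢ 0ℤ) → ∃ λ y → i ∈ des y × u ⟶ y × y ⟶ w
    pull (y , i∈y , u⟶y , y⟶w) = go (φ-surjective y)
      where
      go : (∃ λ s → φ s ≡ y) → ∃ λ y → i ∈ des y × u ⟶ y × y ⟶ w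
      go (s , φs≡y) = s , ∈τ⁻ s (subst (λ y → i ∈ τ y) (sym φs≡y) i∈y) ,
        subst (λ y → N (φ u) y ≢ 0ℤ) (sym φs≡y) u⟶y , subst (λ y → N y (φ w) ≢ 0ℤ) (sym φs≡y) y⟶w

  bonded-unique : ∀ {i j v x y} → M i j ≡ 3 → j ∈ des v → i ∉ des v →
    i ∈ des x → j ∉ des x → x ⟶ v → i ∈ des y → j ∉ des y → y ⟶ v → x ≡ y
  bonded-unique {v = v} {x} {y} Mij j∈v i∉v i∈x j∉x x⟶v i∈y j∉y y⟶v = φ-injective
    (bond Γ M wgraph admissible Mij (∈τ v j∈v) (i∉v ∘ ∈τ⁻ v)
      (∈τ x i∈x) (j∉x ∘ ∈τ⁻ x) x⟶v (∈τ y i∈y) (j∉y ∘ ∈τ⁻ y) y⟶v)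

  open Uniqueness 3≤n _⟶_ (λ {u} {v} → arc⇒⟶ {u} {v})
    (λ {i} {j} {u} {w} → compatible {i} {j} {u} {w}) (λ {i} {j} {u} {v} {w} → square {i} {j} {u} {v} {w})
    (λ {i} {j} {v} {x} {y} → bonded-unique {i} {j} {v} {x} {y})

  -- Some descent i of `u` is missing in `v`. There is an arc into `v` from a source with descent i,
  -- and uniqueness identifies that source with `u`.
  ⟶⇒arc : ∀ {u v} → ¬ (des u ⊆ des v) → u ⟶ v → Arc u v
  ⟶⇒arc {u} {v} ⊈ u⟶v = go (Fin.any? λ i → i ∈? des u ×-dec ¬? (i ∈? des v))
    where
    go : Dec (∃ λ i → i ∈ des u × i ∉ des v) → Arc u v
    go (no ¬∃)              = contradiction (λ {i} i∈u → decidable-stable (i ∈? des v) λ i∉v → ¬∃ (i , i∈u , i∉v)) ⊈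
    go (yes (i , i∈u , i∉v)) = go′ (arc-into (ℕ.<-trans (ℕ.n<1+n 1) 3≤n) v i i∉v)
      where
      go′ : (∃ λ x → i ∈ des x × Arc x v) → Arc u v
      go′ (x , i∈x , arc) = subst (λ u → Arc u v) (unique-arc i {v} i∉v i∈x (arc⇒⟶ {x} {v} arc) i∈u u⟶v) arc

  m-preserved : ∀ u v → m (φ u) (φ v) ≈ m̄ u v
  m-preserved u v = go (m-subgraph u v)
    where
    -- A nonzero weight in Γ would contradict reducedness if the descents of `u` are among those of
    -- `v`, and would otherwise produce an arc, of weight 1 in the embedded graph.
    vanish : m̄ u v ≈ 0ᴸ → m (φ u) (φ v) ≈ 0ᴸ
    vanish m̄≈0 = case (N (φ u) (φ v) ℤ.≟ 0ℤ) (des u ⊆? des v)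
      where
      case : Dec (N (φ u) (φ v) ≡ 0ℤ) → Dec (des u ⊆ des v) → m (φ u) (φ v) ≈ 0ᴸ
      case (yes N≡0) _       = N≡0⇒m≈0 Γ M wgraph admissible (φ u) (φ v) N≡0
      case (no _)    (yes ⊆) = reduced (φ u) (φ v) λ i∈u → ∈τ v (⊆ (∈τ⁻ u i∈u))
      case (no N≢0)  (no ⊈)  = contradiction (subst (_≈ 0ᴸ) (arc⇒m̄ (⟶⇒arc {u} {v} ⊈ N≢0)) m̄≈0) 1≉0
    go : (m̄ u v ≈ m (φ u) (φ v)) ⊎ (m̄ u v ≈ 0ᴸ) → m (φ u) (φ v) ≈ m̄ u v
    go (inj₁ m̄≈m) k = sym (m̄≈m k)
    go (inj₂ m̄≈0) k = trans (vanish m̄≈0 k) (sym (m̄≈0 k))
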